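{- There is an absolute constant $C > 1$ such that the following holds. Let $n, k$ and $\ell$ be positive integers satisfying $n > 2k\ell^2$, and let $\alpha, \beta$ be real numbers with $\max\left(2\ell|\alpha|, |\beta|\right) \le \frac{n-2k}{(20C)^2 n}$. If $\mathcal{F} \subset \binom{[n]}{k}$ is a family of size $|\mathcal{F}| = (\ell - \alpha)\binom{n-1}{k-1}$ with $\mathrm{dp}(\mathcal{F}) \le \left(\binom{\ell}{2} + \beta\right)\binom{n-1}{k-1}\binom{n-k-1}{k-1}$, then there is a family $\mathcal{S}$ that is the union of $\ell$ stars satisfying \[ |\mathcal{F} \,\Delta\, \mathcal{S}| \le C\big((2\ell-1)\alpha + 2\beta\big)\frac{n}{n-2k}\binom{n-1}{k-1}. \]
   Context: $[n] = \{1,\dots,n\}$ and $\binom{[n]}{k}$ is the family of all $k$-element subsets of $[n]$. For a family $\mathcal{F}$ of sets, $\mathrm{dp}(\mathcal{F})$ denotes the number of unordered pairs $\{F, G\}$ of sets in $\mathcal{F}$ with $F \cap G = \emptyset$. The star with centre $i \in [n]$ is the family $\{F \in \binom{[n]}{k} : i \in F\}$; a union of $\ell$ stars means the union of the stars with $\ell$ distinct centres. $\Delta$ denotes symmetric difference.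
   Formalization: The numbers α and β are taken rational instead of real (and C is a rational constant); α is forced to be rational by the size condition, and a real β may be lowered to a rational admissible one, since the bound increases with β. -}

module Defs where

open import Data.Bool using (Bool; true; false; _∧_; _∨_; not; if_then_else_; _xor_)
open import Data.Nat using (ℕ; zero; suc; _+_; _≡ᵇ_)
open import Data.List using (List; []; _∷_; _++_; map)
open import Data.Vec using (Vec; []; _∷_)
open import Data.Fin.Subset using (Subset; ∣_∣)
open import Data.Integer using (+_)
open import Data.Rational using (ℚ; _/_)

Family : ℕ → Set
Family n = Subset n → Bool

allSubsets : (n : ℕ) → List (Subset n)
allSubsets zero = [] ∷ []
allSubsets (suc n) = map (true ∷_) (allSubsets n) ++ map (false ∷_) (allSubsets n)

countL : ∀ {A : Set} → (A → Bool) → List A → ℕ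
countL p [] = 0
countL p (x ∷ xs) = (if p x then 1 else 0) + countL p xs

card : ∀ {n} → Family n → ℕ
card {n} 𝓕 = countL 𝓕 (allSubsets n)

disjointB : ∀ {n} → Subset n → Subset n → Bool
disjointB [] [] = true
disjointB (a ∷ x) (b ∷ y) = not (a ∧ b) ∧ disjointB x y

-- Number of unordered pairs {x, y} (x ≠ y) from a duplicate-free list,
-- both in 𝓕, with x ∩ y = ∅.
dpL : ∀ {n} → Family n → List (Subset n) → ℕ
dpL 𝓕 [] = 0
dpL 𝓕 (x ∷ xs) =
  (if 𝓕 x then countL (λ y → 𝓕 y ∧ disjointB x y) xs else 0) + dpL 𝓕 xs

dp : ∀ {n} → Family n → ℕ
dp {n} 𝓕 = dpL 𝓕 (allSubsets n)

IsKUniform : ∀ {n} → ℕ → Family n → Set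
IsKUniform {n} k 𝓕 = ∀ (s : Subset n) → 𝓕 s ≡ true → ∣ s ∣ ≡ k
  where open import Relation.Binary.PropositionalEquality using (_≡_)

-- Union of the stars (in ([n] choose k)) with centres the elements of T:
-- the k-sets meeting T.
starUnion : ∀ {n} → ℕ → Subset n → Family n
starUnion k T s = (∣ s ∣ ≡ᵇ k) ∧ not (disjointB s T)

symDiffCard : ∀ {n} → Family n → Family n → ℕ
symDiffCard {n} 𝓕 𝓢 = countL (λ s → 𝓕 s xor 𝓢 s) (allSubsets n)

ℕ→ℚ : ℕ → ℚ
ℕ→ℚ m = (+ m) / 1

{-# OPTIONS --safe #-}
module Submission where

-- Let f be the indicator of 𝓕, M = C(n−1, k−1), and let f = g + h, where g(F) = Σ_{a ∈ F} c_a is the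
-- projection of f onto linear functions on the k-sets. On h the disjointness operator has norm at
-- most (k−1)/(n−k−1) times its value C(n−k−1, k−1) on centred linear functions, so the hypothesis on
-- dp(𝓕) forces (n−2k)‖h‖² ≤ n M ((2ℓ−1)α + 2β).
--
-- It remains to show that a Boolean f with ‖h‖² ≪ M is O(‖h‖²)-close to a union of ℓ stars. For
-- disjoint j-sets A, B the difference c(A) − c(B) is, up to two values of h, an integer. Building
-- A and B up by one random pair at a time, the mean of ψ(c(A) − c(B)), with ψ a smooth version of
-- the squared distance to ℤ, grows by almost the mean of ψ(c_a − c_b) at each step; after k/2 steps
-- this gives Σ_{a,b} ψ(c_a − c_b) = O(n‖h‖²/M). Hence the c_a are close to integers up to a common
-- shift, and f(F) = m + Σ_{a ∈ F} t_a with integers m and t_a for all but O(‖h‖²) of the k-sets F.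
-- Correlating with x_a − x_b shows |t_a − t_b| ≤ 1, so f(F) = m + |F ∩ T| for most F, and the first
-- two moments leave m = 0, |T| = ℓ or (for ℓ = 1) the complement of a star, which has too many
-- disjoint pairs.

open import Defs

-- Linear functions have Kneser eigenvalue -C(n-k-1, k-1), and from degree two on the eigenvalues
-- are at most C(n-k-2, k-2) in absolute value. Their ratio (k-1)/(n-k-1) falls short of 1 by
-- (n-2k)/(n-k-1), which is the origin of the factor n/(n-2k) in the conclusion. The obstacle is to
-- round the linear part with a constant independent of k. Comparing k-sets that differ by a single
-- exchange bounds Σ ψ(c_a - c_b) only by O(nkH/M), where H = ‖h‖²; the factor k is fatal. Making
-- k/2 exchanges at once costs no more than one, since still only two k-sets are compared, but the
-- contributions of the exchanges add up, and this recovers the factor k. Adding up rests on an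
-- approximate parallelogram law whose error is a product ψ(x)ψ(y). The squared distance to ℤ
-- violates it: near the kink at 1/2 its error is linear in y. The quartic repairs this and stays
-- inside ℚ. After rounding, all errors e are integers, so |e| ≤ e², and a bound on Σ e² controls
-- first moments as well as second ones.

module Proof where

  open import Data.Nat using (ℕ; zero; suc; _∸_; _≡ᵇ_; z≤n; s≤s; s≤s⁻¹) renaming (_+_ to _+ℕ_; _*_ to _*ℕ_; _<_ to _<ℕ_; _≤_ to _≤ℕ_)
  open import Data.Rational using (ℚ; _≤_; _<_; _/_; nonNegative; positive; toℚᵘ; 1/_; NonZero)
  open import Relation.Binary.PropositionalEquality using (_≡_; refl; sym; trans; cong; cong₂; subst; subst₂; _≢_)
  import Data.Rational as ℚ
  import Data.Rational.Properties as ℚ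
  import Data.Nat.Properties as ℕ
  import Data.Rational.Unnormalised as ℚᵘ
  import Data.Rational.Unnormalised.Properties as ℚᵘ
  import Data.Integer as ℤ
  import Data.Integer.Properties as ℤ
  import Data.Integer.DivMod as ℤ
  open import Data.Integer using (ℤ)
  open import Data.Maybe using (Maybe; just; nothing)
  open import Data.Sum using (_⊎_; inj₁; inj₂)
  open import Data.Product using (∃; _×_; _,_; proj₁; proj₂; Σ)
  open import Data.Empty using (⊥; ⊥-elim)
  open import Relation.Nullary using (¬_; yes; no; does)
  open import Relation.Binary.Definitions using (tri<; tri≈; tri>)
  open import Algebra.Bundles using (CommutativeRing)
  open import Algebra.Structures using (IsCommutativeRing)
  import Algebra.Solver.Ring as RingSolver
  open import Algebra.Solver.Ring.AlmostCommutativeRing using (fromCommutativeRing; _-Raw-AlmostCommutative⟶_)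
  open import Level using (0ℓ)
  open import Data.Bool using (Bool; true; false; not; _∧_; if_then_else_; _xor_)
  open import Data.Vec using (Vec; []; _∷_; replicate; map; lookup)
  open import Data.Fin.Subset using (Subset; ∁) renaming (∣_∣ to size)
  open import Data.Nat.Combinatorics using (_C_; nCk≡nC[n∸k]; nCn≡1; nCk+nC[k+1]≡[n+1]C[k+1]; k>n⇒nCk≡0)
  open import Data.Fin using (Fin) renaming (zero to fzero; suc to fsuc)
  open import Data.Vec.Properties using (lookup-map; lookup-replicate)
  open import Data.List using (List; []; _∷_; _++_) renaming (map to mapL)

  -- Ordered-field arithmetic on the rationals

  infixl 6 _+_ _-_
  infixl 7 _*_
  infix 8 -_

  -- The field operations are opaque: otherwise unification unfolds the
  -- normalising arithmetic of ℚ instead of comparing arguments.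
  opaque
    _+_ _*_ : ℚ → ℚ → ℚ
    _+_ = ℚ._+_
    _*_ = ℚ._*_

    -_ : ℚ → ℚ
    -_ = ℚ.-_

    ζ : ℤ → ℚ
    ζ z = z / 1

  _-_ : ℚ → ℚ → ℚ
  x - y = x + (- y)

  ι : ℕ → ℚ
  ι m = ζ (ℤ.+ m)

  𝟘 𝟙 𝟚 : ℚ
  𝟘 = ι 0
  𝟙 = ι 1
  𝟚 = ι 2

  opaque
    unfolding _+_

    toℚᵘ-ζ : ∀ z → toℚᵘ (ζ z) ℚᵘ.≃ ℚᵘ.mkℚᵘ z 0
    toℚᵘ-ζ z = ℚ.toℚᵘ-fromℚᵘ (ℚᵘ.mkℚᵘ z 0)

    ζ-+ : ∀ a b → ζ (a ℤ.+ b) ≡ ζ a + ζ b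
    ζ-+ a b = ℚ.toℚᵘ-injective (ℚᵘ.≃-trans (toℚᵘ-ζ (a ℤ.+ b)) (ℚᵘ.≃-sym (ℚᵘ.≃-trans (ℚ.toℚᵘ-homo-+ (ζ a) (ζ b))
      (ℚᵘ.≃-trans (ℚᵘ.+-cong (toℚᵘ-ζ a) (toℚᵘ-ζ b))
      (ℚᵘ.*≡* (cong (ℤ._* ℤ.+ 1) (cong₂ ℤ._+_ (ℤ.*-identityʳ a) (ℤ.*-identityʳ b))))))))

    ζ-* : ∀ a b → ζ (a ℤ.* b) ≡ ζ a * ζ b
    ζ-* a b = ℚ.toℚᵘ-injective (ℚᵘ.≃-trans (toℚᵘ-ζ (a ℤ.* b)) (ℚᵘ.≃-sym (ℚᵘ.≃-trans (ℚ.toℚᵘ-homo-* (ζ a) (ζ b))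
      (ℚᵘ.≃-trans (ℚᵘ.*-cong (toℚᵘ-ζ a) (toℚᵘ-ζ b)) ℚᵘ.≃-refl))))

    ζ-neg : ∀ a → ζ (ℤ.- a) ≡ - ζ a
    ζ-neg a = ℚ.toℚᵘ-injective (ℚᵘ.≃-trans (toℚᵘ-ζ (ℤ.- a)) (ℚᵘ.≃-sym (ℚᵘ.≃-trans (ℚ.toℚᵘ-homo‿- (ζ a)) (ℚᵘ.-‿cong (toℚᵘ-ζ a)))))

    ζ-mono : ∀ {a b} → a ℤ.≤ b → ζ a ≤ ζ b
    ζ-mono {a} {b} p = ℚ.toℚᵘ-cancel-≤ (ℚᵘ.≤-respʳ-≃ (ℚᵘ.≃-sym (toℚᵘ-ζ b)) (ℚᵘ.≤-respˡ-≃ (ℚᵘ.≃-sym (toℚᵘ-ζ a))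
      (ℚᵘ.*≤* (subst₂ ℤ._≤_ (sym (ℤ.*-identityʳ a)) (sym (ℤ.*-identityʳ b)) p))))

    0<1 : 𝟘 < 𝟙
    0<1 = ℚ.positive⁻¹ ℚ.1ℚ

    +-*-isCommutativeRing : IsCommutativeRing _≡_ _+_ _*_ -_ 𝟘 𝟙
    +-*-isCommutativeRing = ℚ.+-*-isCommutativeRing

    +-mono-≤ : ∀ {a b c d} → a ≤ b → c ≤ d → a + c ≤ b + d
    +-mono-≤ = ℚ.+-mono-≤

    +-mono-<-≤ : ∀ {a b c d} → a < b → c ≤ d → a + c < b + d
    +-mono-<-≤ = ℚ.+-mono-<-≤

    *-monoˡ : ∀ {x y} a → 𝟘 ≤ a → x ≤ y → a * x ≤ a * y
    *-monoˡ a p = ℚ.*-monoˡ-≤-nonNeg a {{nonNegative p}}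

    *-monoˡ-< : ∀ {x y} a → 𝟘 < a → x < y → a * x < a * y
    *-monoˡ-< a p = ℚ.*-monoʳ-<-pos a {{positive p}}

    *-cancel-≤ : ∀ {x y} a → 𝟘 < a → a * x ≤ a * y → x ≤ y
    *-cancel-≤ a p = ℚ.*-cancelˡ-≤-pos a {{positive p}}

    recip : ∀ a → 𝟘 < a → Σ ℚ λ b → a * b ≡ 𝟙
    recip a p = 1/_ a {{nz}} , ℚ.*-inverseʳ a {{nz}}
      where
      nz : NonZero a
      nz = ℚ.pos⇒nonZero a {{positive p}}

  ℚ-commutativeRing : CommutativeRing 0ℓ 0ℓ
  ℚ-commutativeRing = record { isCommutativeRing = +-*-isCommutativeRing }

  open CommutativeRing ℚ-commutativeRing using (+-identityˡ; +-identityʳ; +-comm; +-assoc; *-comm; *-assoc; *-identityˡ;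
      *-identityʳ; zeroˡ; zeroʳ; distribˡ; distribʳ; -‿inverseʳ)

  ℤ-morphism : CommutativeRing.rawRing ℤ.+-*-commutativeRing -Raw-AlmostCommutative⟶ fromCommutativeRing ℚ-commutativeRing
  ℤ-morphism = record { ⟦_⟧ = ζ ; +-homo = ζ-+ ; *-homo = ζ-* ; -‿homo = ζ-neg ; 0-homo = refl ; 1-homo = refl }

  ζ-≟ : ∀ a b → Maybe (ζ a ≡ ζ b)
  ζ-≟ a b with a ℤ.≟ b
  ... | yes e = just (cong ζ e)
  ... | no _ = nothing

  open RingSolver (CommutativeRing.rawRing ℤ.+-*-commutativeRing) (fromCommutativeRing ℚ-commutativeRing) ℤ-morphism ζ-≟
    using (Polynomial; con; _:+_; _:*_; _:-_; :-_; _:=_) renaming (solve to ring)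

  # : ∀ {m} → ℕ → Polynomial m
  # n = con (ℤ.+ n)

  ζ-- : ∀ a b → ζ (a ℤ.- b) ≡ ζ a - ζ b
  ζ-- a b = trans (ζ-+ a (ℤ.- b)) (cong (ζ a +_) (ζ-neg b))

  ι-+ : ∀ a b → ι (a +ℕ b) ≡ ι a + ι b
  ι-+ a b = ζ-+ (ℤ.+ a) (ℤ.+ b)

  ι-* : ∀ a b → ι (a *ℕ b) ≡ ι a * ι b
  ι-* a b = trans (cong ζ (ℤ.pos-* a b)) (ζ-* (ℤ.+ a) (ℤ.+ b))

  ι-mono : ∀ {a b} → a ≤ℕ b → ι a ≤ ι b
  ι-mono p = ζ-mono (ℤ.+≤+ p)

  ι-suc : ∀ a → ι (suc a) ≡ 𝟙 + ι a
  ι-suc a = ι-+ 1 a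

  0≤ι : ∀ a → 𝟘 ≤ ι a
  0≤ι a = ι-mono {0} {a} z≤n

  -- Inequalities are reduced to ring identities "right − left = sum of nonnegative terms".

  ≤-cert : ∀ {x y} e → y - x ≡ e → 𝟘 ≤ e → x ≤ y
  ≤-cert {x} {y} e eq p = subst₂ _≤_ (+-identityʳ x) (ring 2 (λ x y → x :+ (y :- x) := y) refl x y)
    (+-mono-≤ (ℚ.≤-refl {x}) (subst (𝟘 ≤_) (sym eq) p))

  0≤- : ∀ {x y} → x ≤ y → 𝟘 ≤ y - x
  0≤- {x} {y} p = subst (_≤ y - x) (-‿inverseʳ x) (+-mono-≤ p (ℚ.≤-refl { - x}))

  0<- : ∀ {x y} → x < y → 𝟘 < y - x
  0<- {x} {y} p = subst (_< y - x) (-‿inverseʳ x) (+-mono-<-≤ p (ℚ.≤-refl { - x}))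

  0≤+ : ∀ {x y} → 𝟘 ≤ x → 𝟘 ≤ y → 𝟘 ≤ x + y
  0≤+ {x} {y} p q = subst (_≤ x + y) (+-identityʳ 𝟘) (+-mono-≤ p q)

  0≤* : ∀ {x y} → 𝟘 ≤ x → 𝟘 ≤ y → 𝟘 ≤ x * y
  0≤* {x} {y} p q = subst (_≤ x * y) (zeroʳ x) (*-monoˡ x p q)

  0≤sq : ∀ x → 𝟘 ≤ x * x
  0≤sq x with ℚ.≤-total 𝟘 x
  ... | inj₁ p = 0≤* p p
  ... | inj₂ p = subst (𝟘 ≤_) (ring 1 (λ x → (# 0 :- x) :* (# 0 :- x) := x :* x) refl x) (0≤* (0≤- p) (0≤- p))

  0<* : ∀ {x y} → 𝟘 < x → 𝟘 < y → 𝟘 < x * y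
  0<* {x} {y} p q = subst (_< x * y) (zeroʳ x) (*-monoˡ-< x p q)

  0<+ : ∀ {x y} → 𝟘 < x → 𝟘 ≤ y → 𝟘 < x + y
  0<+ {x} {y} p q = subst (_< x + y) (+-identityʳ 𝟘) (+-mono-<-≤ p q)

  0<ι-suc : ∀ n → 𝟘 < ι (suc n)
  0<ι-suc n = subst (𝟘 <_) (sym (ι-suc n)) (0<+ 0<1 (0≤ι n))

  *-cancel-≡ : ∀ {x y} a → 𝟘 < a → a * x ≡ a * y → x ≡ y
  *-cancel-≡ a p eq = ℚ.≤-antisym (*-cancel-≤ a p (ℚ.≤-reflexive eq)) (*-cancel-≤ a p (ℚ.≤-reflexive (sym eq)))

  <⇒≱ : ∀ {x y} → x < y → ¬ (y ≤ x)
  <⇒≱ p q = ℚ.<-irrefl refl (ℚ.<-≤-trans p q)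

  sq≤0 : ∀ {x} → x * x ≤ 𝟘 → x ≡ 𝟘
  sq≤0 {x} p with ℚ.<-cmp 𝟘 x
  ... | tri≈ _ e _ = sym e
  ... | tri< l _ _ = ⊥-elim (<⇒≱ (0<* l l) p)
  ... | tri> _ _ g = ⊥-elim (<⇒≱ (subst (𝟘 <_) (ring 1 (λ x → (# 0 :- x) :* (# 0 :- x) := x :* x) refl x) (0<* (0<- g) (0<- g))) p)

  -- Sums over subsets

  opaque
    sumS : ∀ {n} → (Subset n → ℚ) → ℚ
    sumS {zero} φ = φ []
    sumS {suc n} φ = sumS (λ S → φ (true ∷ S)) + sumS (λ S → φ (false ∷ S))

    sumS-[] : (φ : Subset 0 → ℚ) → sumS φ ≡ φ []
    sumS-[] φ = refl

    sumS-∷ : ∀ {n} (φ : Subset (suc n) → ℚ) → sumS φ ≡ sumS (λ S → φ (true ∷ S)) + sumS (λ S → φ (false ∷ S))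
    sumS-∷ φ = refl

  interchange : ∀ a b c d → (a + b) + (c + d) ≡ (a + c) + (b + d)
  interchange = ring 4 (λ a b c d → (a :+ b) :+ (c :+ d) := (a :+ c) :+ (b :+ d)) refl

  ⟨_,_⟩ : ∀ {n} → (Subset n → ℚ) → (Subset n → ℚ) → ℚ
  ⟨ φ , ψ ⟩ = sumS (λ S → φ S * ψ S)

  sumS-cong : ∀ {n} {φ ψ : Subset n → ℚ} → (∀ S → φ S ≡ ψ S) → sumS φ ≡ sumS ψ
  sumS-cong {zero} e = trans (sumS-[] _) (trans (e []) (sym (sumS-[] _)))
  sumS-cong {suc n} e = trans (sumS-∷ _) (trans (cong₂ _+_ (sumS-cong (λ S → e (true ∷ S))) (sumS-cong (λ S → e (false ∷ S))))
      (sym (sumS-∷ _)))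

  sumS-+ : ∀ {n} (φ ψ : Subset n → ℚ) → sumS (λ S → φ S + ψ S) ≡ sumS φ + sumS ψ
  sumS-+ {zero} φ ψ = trans (sumS-[] _) (sym (cong₂ _+_ (sumS-[] φ) (sumS-[] ψ)))
  sumS-+ {suc n} φ ψ = trans (sumS-∷ _) (trans (cong₂ _+_ (sumS-+ _ _) (sumS-+ _ _)) (trans (interchange _ _ _ _)
    (sym (cong₂ _+_ (sumS-∷ φ) (sumS-∷ ψ)))))

  sumS-* : ∀ {n} a (φ : Subset n → ℚ) → sumS (λ S → a * φ S) ≡ a * sumS φ
  sumS-* {zero} a φ = trans (sumS-[] _) (cong (a *_) (sym (sumS-[] φ)))
  sumS-* {suc n} a φ = trans (sumS-∷ _) (trans (cong₂ _+_ (sumS-* a _) (sumS-* a _))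
      (trans (sym (distribˡ a _ _)) (cong (a *_) (sym (sumS-∷ φ)))))

  sumS-lin : ∀ {n} a b (φ ψ : Subset n → ℚ) → sumS (λ S → a * φ S + b * ψ S) ≡ a * sumS φ + b * sumS ψ
  sumS-lin a b φ ψ = trans (sumS-+ _ _) (cong₂ _+_ (sumS-* a φ) (sumS-* b ψ))

  sumS-mono : ∀ {n} {φ ψ : Subset n → ℚ} → (∀ S → φ S ≤ ψ S) → sumS φ ≤ sumS ψ
  sumS-mono {zero} e = subst₂ _≤_ (sym (sumS-[] _)) (sym (sumS-[] _)) (e [])
  sumS-mono {suc n} e = subst₂ _≤_ (sym (sumS-∷ _)) (sym (sumS-∷ _)) (+-mono-≤ (sumS-mono (λ S → e (true ∷ S)))
      (sumS-mono (λ S → e (false ∷ S))))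

  sumS-0 : ∀ {n} → sumS {n} (λ _ → 𝟘) ≡ 𝟘
  sumS-0 {n} = trans (sumS-cong {n} (λ _ → sym (zeroˡ 𝟘))) (trans (sumS-* {n} 𝟘 (λ _ → 𝟘)) (zeroˡ _))

  0≤sumS : ∀ {n} {φ : Subset n → ℚ} → (∀ S → 𝟘 ≤ φ S) → 𝟘 ≤ sumS φ
  0≤sumS {n} {φ} e = subst (_≤ sumS φ) (sumS-0 {n}) (sumS-mono e)

  sumS-sub : ∀ {n} (φ ψ : Subset n → ℚ) → sumS (λ S → φ S - ψ S) ≡ sumS φ - sumS ψ
  sumS-sub φ ψ = trans (sumS-cong (λ S → lem (φ S) (ψ S))) (trans (sumS-lin 𝟙 (- 𝟙) φ ψ) (sym (lem _ _)))
    where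
    lem : ∀ a b → a - b ≡ 𝟙 * a + (- 𝟙) * b
    lem = ring 2 (λ a b → a :- b := # 1 :* a :+ (:- # 1) :* b) refl

  ⟨⟩-comm : ∀ {n} (φ ψ : Subset n → ℚ) → ⟨ φ , ψ ⟩ ≡ ⟨ ψ , φ ⟩
  ⟨⟩-comm φ ψ = sumS-cong (λ S → *-comm (φ S) (ψ S))

  ⟨⟩-linʳ : ∀ {n} a b (θ φ ψ : Subset n → ℚ) → ⟨ θ , (λ S → a * φ S + b * ψ S) ⟩ ≡ a * ⟨ θ , φ ⟩ + b * ⟨ θ , ψ ⟩
  ⟨⟩-linʳ a b θ φ ψ = trans (sumS-cong (λ S → lem a b (θ S) (φ S) (ψ S))) (sumS-lin a b _ _)
    where
    lem : ∀ a b t x y → t * (a * x + b * y) ≡ a * (t * x) + b * (t * y)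
    lem = ring 5 (λ a b t x y → t :* (a :* x :+ b :* y) := a :* (t :* x) :+ b :* (t :* y)) refl

  ⟨⟩-linˡ : ∀ {n} a b (θ φ ψ : Subset n → ℚ) → ⟨ (λ S → a * φ S + b * ψ S) , θ ⟩ ≡ a * ⟨ φ , θ ⟩ + b * ⟨ ψ , θ ⟩
  ⟨⟩-linˡ a b θ φ ψ = trans (⟨⟩-comm _ _) (trans (⟨⟩-linʳ a b θ φ ψ) (cong₂ (λ x y → a * x + b * y) (⟨⟩-comm _ _) (⟨⟩-comm _ _)))

  ⟨⟩-+ʳ : ∀ {n} (θ φ ψ : Subset n → ℚ) → ⟨ θ , (λ S → φ S + ψ S) ⟩ ≡ ⟨ θ , φ ⟩ + ⟨ θ , ψ ⟩
  ⟨⟩-+ʳ θ φ ψ = trans (sumS-cong (λ S → distribˡ (θ S) (φ S) (ψ S))) (sumS-+ _ _)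

  ⟨⟩-+ˡ : ∀ {n} (θ φ ψ : Subset n → ℚ) → ⟨ (λ S → φ S + ψ S) , θ ⟩ ≡ ⟨ φ , θ ⟩ + ⟨ ψ , θ ⟩
  ⟨⟩-+ˡ θ φ ψ = trans (sumS-cong (λ S → distribʳ (θ S) (φ S) (ψ S))) (sumS-+ _ _)

  0≤⟨⟩ : ∀ {n} (φ : Subset n → ℚ) → 𝟘 ≤ ⟨ φ , φ ⟩
  0≤⟨⟩ φ = 0≤sumS (λ S → 0≤sq (φ S))

  norm-lin : ∀ {n} a b (φ ψ : Subset n → ℚ) → ⟨ (λ S → a * φ S + b * ψ S) , (λ S → a * φ S + b * ψ S) ⟩
    ≡ a * a * ⟨ φ , φ ⟩ + ((𝟙 + 𝟙) * a * b * ⟨ φ , ψ ⟩ + b * b * ⟨ ψ , ψ ⟩)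
  norm-lin a b φ ψ = trans (⟨⟩-linˡ a b _ φ ψ) (trans (cong₂ (λ x y → a * x + b * y) (⟨⟩-linʳ a b φ φ ψ)
      (trans (⟨⟩-linʳ a b ψ φ ψ) (cong (λ x → a * x + b * ⟨ ψ , ψ ⟩) (⟨⟩-comm ψ φ)))) (lem a b _ _ _))
    where
    lem : ∀ a b x y z → a * (a * x + b * y) + b * (a * y + b * z) ≡ a * a * x + ((𝟙 + 𝟙) * a * b * y + b * b * z)
    lem = ring 5 (λ a b x y z → a :* (a :* x :+ b :* y) :+ b :* (a :* y :+ b :* z) := a :* a :* x :+
        ((# 1 :+ # 1) :* a :* b :* y :+ b :* b :* z)) refl

  term≤sumS : ∀ {n} {φ : Subset n → ℚ} → (∀ S → 𝟘 ≤ φ S) → ∀ S → φ S ≤ sumS φ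
  term≤sumS p [] = ℚ.≤-reflexive (sym (sumS-[] _))
  term≤sumS {φ = φ} p (true ∷ S) = ℚ.≤-trans (term≤sumS (λ S → p (true ∷ S)) S)
    (subst₂ _≤_ (+-identityʳ _) (sym (sumS-∷ φ)) (+-mono-≤ ℚ.≤-refl (0≤sumS (λ S → p (false ∷ S)))))
  term≤sumS {φ = φ} p (false ∷ S) = ℚ.≤-trans (term≤sumS (λ S → p (false ∷ S)) S)
    (subst₂ _≤_ (+-identityˡ _) (sym (sumS-∷ φ)) (+-mono-≤ (0≤sumS (λ S → p (true ∷ S))) ℚ.≤-refl))

  norm0⇒0 : ∀ {n} (φ : Subset n → ℚ) → ⟨ φ , φ ⟩ ≤ 𝟘 → ∀ S → φ S ≡ 𝟘
  norm0⇒0 φ p S = sq≤0 (ℚ.≤-trans (term≤sumS (λ S → 0≤sq (φ S)) S) p)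

  ⟨⟩-zeroʳ : ∀ {n} (φ ψ : Subset n → ℚ) → (∀ S → ψ S ≡ 𝟘) → ⟨ φ , ψ ⟩ ≡ 𝟘
  ⟨⟩-zeroʳ {n} φ ψ e = trans (sumS-cong (λ S → trans (cong (φ S *_) (e S)) (zeroʳ (φ S)))) (sumS-0 {n})

  -- Division-free: `⟨ ψ , ψ ⟩` times the gap is the squared norm of `⟨ ψ , ψ ⟩` φ - `⟨ φ , ψ ⟩` ψ.
  -- If ψ has norm zero, it vanishes pointwise and so do both sides.
  cauchy-schwarz : ∀ {n} (φ ψ : Subset n → ℚ) → ⟨ φ , ψ ⟩ * ⟨ φ , ψ ⟩ ≤ ⟨ φ , φ ⟩ * ⟨ ψ , ψ ⟩
  cauchy-schwarz {n} φ ψ with ℚ.<-cmp 𝟘 ⟨ ψ , ψ ⟩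
  ... | tri< pos _ _ = *-cancel-≤ ⟨ ψ , ψ ⟩ pos (≤-cert _ (trans (lem ⟨ φ , φ ⟩ ⟨ φ , ψ ⟩ ⟨ ψ , ψ ⟩) (sym (norm-lin _ _ φ ψ)))
      (0≤⟨⟩ (λ S → ⟨ ψ , ψ ⟩ * φ S + (- ⟨ φ , ψ ⟩) * ψ S)))
    where
    lem : ∀ x y z → z * (x * z) - z * (y * y) ≡ z * z * x + ((𝟙 + 𝟙) * z * (- y) * y + (- y) * (- y) * z)
    lem = ring 3 (λ x y z → z :* (x :* z) :- z :* (y :* y) := z :* z :* x :+
        ((# 1 :+ # 1) :* z :* (:- y) :* y :+ (:- y) :* (:- y) :* z)) refl
  ... | tri≈ _ e _ = ℚ.≤-reflexive (trans (cong (λ x → x * x) (⟨⟩-zeroʳ φ ψ (norm0⇒0 ψ (ℚ.≤-reflexive (sym e)))))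
                       (trans (zeroʳ 𝟘) (sym (trans (cong (⟨ φ , φ ⟩ *_) (sym e)) (zeroʳ _)))))
  ... | tri> _ _ neg = ⊥-elim (<⇒≱ neg (0≤⟨⟩ ψ))

  -- Shadow operators and disjointness

  -- `∂` and `∂ᵀ` are the neighbour sums of the Boolean lattice: over the sets with one more point,
  -- and with one point fewer. Acting on all levels at once makes their identities inductions on n
  -- without level bookkeeping.
  ∂ : ∀ {n} → (Subset n → ℚ) → Subset n → ℚ
  ∂ φ [] = 𝟘
  ∂ φ (true ∷ S) = ∂ (λ S → φ (true ∷ S)) S
  ∂ φ (false ∷ S) = φ (true ∷ S) + ∂ (λ S → φ (false ∷ S)) S

  ∂ᵀ : ∀ {n} → (Subset n → ℚ) → Subset n → ℚ
  ∂ᵀ φ [] = 𝟘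
  ∂ᵀ φ (true ∷ S) = φ (false ∷ S) + ∂ᵀ (λ S → φ (true ∷ S)) S
  ∂ᵀ φ (false ∷ S) = ∂ᵀ (λ S → φ (false ∷ S)) S

  -- The Kneser operator: Z φ G is the sum of φ F over all F disjoint from G.
  Z : ∀ {n} → (Subset n → ℚ) → Subset n → ℚ
  Z φ [] = φ []
  Z φ (true ∷ G) = Z (λ S → φ (false ∷ S)) G
  Z φ (false ∷ G) = Z (λ S → φ (true ∷ S)) G + Z (λ S → φ (false ∷ S)) G

  ∂-local : ∀ {n} {φ ψ : Subset n → ℚ} (S : Subset n) → (∀ S′ → size S′ ≡ suc (size S) → φ S′ ≡ ψ S′) → ∂ φ S ≡ ∂ ψ S
  ∂-local [] e = refl
  ∂-local (true ∷ S) e = ∂-local S (λ S′ p → e (true ∷ S′) (cong suc p))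
  ∂-local (false ∷ S) e = cong₂ _+_ (e (true ∷ S) refl) (∂-local S (λ S′ p → e (false ∷ S′) p))

  ∂-+ : ∀ {n} (φ ψ : Subset n → ℚ) S → ∂ (λ S → φ S + ψ S) S ≡ ∂ φ S + ∂ ψ S
  ∂-+ φ ψ [] = sym (+-identityʳ 𝟘)
  ∂-+ φ ψ (true ∷ S) = ∂-+ _ _ S
  ∂-+ φ ψ (false ∷ S) = trans (cong (φ (true ∷ S) + ψ (true ∷ S) +_) (∂-+ _ _ S)) (interchange _ _ _ _)

  ∂-0 : ∀ {n} (S : Subset n) → ∂ (λ _ → 𝟘) S ≡ 𝟘
  ∂-0 [] = refl
  ∂-0 (true ∷ S) = ∂-0 S
  ∂-0 (false ∷ S) = trans (+-identityˡ _) (∂-0 S)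

  ∂ᵀ-local : ∀ {n} {φ ψ : Subset n → ℚ} (S : Subset n) → (∀ S′ → suc (size S′) ≡ size S → φ S′ ≡ ψ S′) → ∂ᵀ φ S ≡ ∂ᵀ ψ S
  ∂ᵀ-local [] e = refl
  ∂ᵀ-local (true ∷ S) e = cong₂ _+_ (e (false ∷ S) refl) (∂ᵀ-local S (λ S′ p → e (true ∷ S′) (cong suc p)))
  ∂ᵀ-local (false ∷ S) e = ∂ᵀ-local S (λ S′ p → e (false ∷ S′) p)

  ∂ᵀ-+ : ∀ {n} (φ ψ : Subset n → ℚ) S → ∂ᵀ (λ S → φ S + ψ S) S ≡ ∂ᵀ φ S + ∂ᵀ ψ S
  ∂ᵀ-+ φ ψ [] = sym (+-identityʳ 𝟘)
  ∂ᵀ-+ φ ψ (true ∷ S) = trans (cong (φ (false ∷ S) + ψ (false ∷ S) +_) (∂ᵀ-+ _ _ S)) (interchange _ _ _ _)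
  ∂ᵀ-+ φ ψ (false ∷ S) = ∂ᵀ-+ _ _ S

  Z-cong : ∀ {n} {φ ψ : Subset n → ℚ} → (∀ S → φ S ≡ ψ S) → ∀ G → Z φ G ≡ Z ψ G
  Z-cong e [] = e []
  Z-cong e (true ∷ G) = Z-cong (λ S → e (false ∷ S)) G
  Z-cong e (false ∷ G) = cong₂ _+_ (Z-cong (λ S → e (true ∷ S)) G) (Z-cong (λ S → e (false ∷ S)) G)

  Z-+ : ∀ {n} (φ ψ : Subset n → ℚ) G → Z (λ S → φ S + ψ S) G ≡ Z φ G + Z ψ G
  Z-+ φ ψ [] = refl
  Z-+ φ ψ (true ∷ G) = Z-+ _ _ G
  Z-+ φ ψ (false ∷ G) = trans (cong₂ _+_ (Z-+ _ _ G) (Z-+ _ _ G)) (interchange _ _ _ _)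

  Z-* : ∀ {n} a (φ : Subset n → ℚ) G → Z (λ S → a * φ S) G ≡ a * Z φ G
  Z-* a φ [] = refl
  Z-* a φ (true ∷ G) = Z-* a _ G
  Z-* a φ (false ∷ G) = trans (cong₂ _+_ (Z-* a _ G) (Z-* a _ G)) (sym (distribˡ a _ _))

  ∂-adjoint : ∀ {n} (φ ψ : Subset n → ℚ) → ⟨ ∂ φ , ψ ⟩ ≡ ⟨ φ , ∂ᵀ ψ ⟩
  ∂-adjoint {zero} φ ψ = trans (sumS-[] _) (trans (trans (zeroˡ (ψ [])) (sym (zeroʳ (φ [])))) (sym (sumS-[] _)))
  ∂-adjoint {suc n} φ ψ = trans (sumS-∷ _) (trans (cong₂ _+_ (∂-adjoint φ₁ ψ₁)
      (trans (⟨⟩-+ˡ ψ₀ φ₁ (∂ φ₀)) (cong (⟨ φ₁ , ψ₀ ⟩ +_) (∂-adjoint φ₀ ψ₀))))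
    (trans (ring 3 (λ a b c → a :+ (b :+ c) := (b :+ a) :+ c) refl _ _ _)
        (trans (cong (_+ ⟨ φ₀ , ∂ᵀ ψ₀ ⟩) (sym (⟨⟩-+ʳ φ₁ ψ₀ (∂ᵀ ψ₁)))) (sym (sumS-∷ _)))))
    where
    φ₀ φ₁ ψ₀ ψ₁ : Subset n → ℚ
    φ₀ S = φ (false ∷ S)
    φ₁ S = φ (true ∷ S)
    ψ₀ S = ψ (false ∷ S)
    ψ₁ S = ψ (true ∷ S)

  Z-adjoint : ∀ {n} (φ ψ : Subset n → ℚ) → ⟨ Z φ , ψ ⟩ ≡ ⟨ φ , Z ψ ⟩
  Z-adjoint {zero} φ ψ = trans (sumS-[] _) (sym (sumS-[] _))
  Z-adjoint {suc n} φ ψ = trans (sumS-∷ _) (trans (cong₂ _+_ (Z-adjoint φ₀ ψ₁)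
      (trans (⟨⟩-+ˡ ψ₀ (Z φ₁) (Z φ₀)) (cong₂ _+_ (Z-adjoint φ₁ ψ₀) (Z-adjoint φ₀ ψ₀))))
    (trans (ring 3 (λ a b c → a :+ (b :+ c) := b :+ (a :+ c)) refl _ _ _)
        (trans (cong (⟨ φ₁ , Z ψ₀ ⟩ +_) (sym (⟨⟩-+ʳ φ₀ (Z ψ₁) (Z ψ₀)))) (sym (sumS-∷ _)))))
    where
    φ₀ φ₁ ψ₀ ψ₁ : Subset n → ℚ
    φ₀ S = φ (false ∷ S)
    φ₁ S = φ (true ∷ S)
    ψ₀ S = ψ (false ∷ S)
    ψ₁ S = ψ (true ∷ S)

  -- The sl₂ relation of the Boolean lattice. Proper exchanges of a point agree in both orders;
  -- returning to S itself is possible in n - |S| ways by adding first and in |S| ways by removing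
  -- first.
  ∂∂ᵀ-comm : ∀ {n} (φ : Subset n → ℚ) S → ∂ (∂ᵀ φ) S ≡ ∂ᵀ (∂ φ) S + (ι n - ι (size S) - ι (size S)) * φ S
  ∂∂ᵀ-comm {zero} φ [] = ring 1 (λ p → # 0 := # 0 :+ (# 0 :- # 0 :- # 0) :* p) refl (φ [])
  ∂∂ᵀ-comm {suc n} φ (true ∷ S) = trans (∂-+ _ _ S) (trans (cong (∂ (λ S → φ (false ∷ S)) S +_) (∂∂ᵀ-comm _ S))
    (trans (lem _ _ _ (ι n) (ι (size S))) (cong₂ (λ x y → φ (true ∷ S) + ∂ (λ S → φ (false ∷ S)) S + ∂ᵀ (∂ (λ S → φ (true ∷ S))) S
       + (x - y - y) * φ (true ∷ S)) (sym (ι-suc n)) (sym (ι-suc (size S))))))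
    where
    lem : ∀ a b p n s → a + (b + (n - s - s) * p) ≡ p + a + b + (𝟙 + n - (𝟙 + s) - (𝟙 + s)) * p
    lem = ring 5 (λ a b p n s → a :+ (b :+ (n :- s :- s) :* p) := p :+ a :+ b :+ (# 1 :+ n :- (# 1 :+ s) :- (# 1 :+ s)) :* p) refl
  ∂∂ᵀ-comm {suc n} φ (false ∷ S) = trans (cong (φ (false ∷ S) + ∂ᵀ (λ S → φ (true ∷ S)) S +_) (∂∂ᵀ-comm _ S))
    (trans (lem _ _ _ (ι n) (ι (size S)))
    (cong₂ (λ x y → x + (y - ι (size S) - ι (size S)) * φ (false ∷ S)) (sym (∂ᵀ-+ _ _ S)) (sym (ι-suc n))))
    where
    lem : ∀ p a b n s → p + a + (b + (n - s - s) * p) ≡ (a + b) + (𝟙 + n - s - s) * p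
    lem = ring 5 (λ p a b n s → p :+ a :+ (b :+ (n :- s :- s) :* p) := (a :+ b) :+ (# 1 :+ n :- s :- s) :* p) refl

  -- A set F disjoint from G is counted once for every point outside both, that is n - |G| - |F|
  -- times. As |F| varies, its share stays under `Z`.
  ∂Z : ∀ {n} (φ : Subset n → ℚ) G → ∂ (Z φ) G ≡ (ι n - ι (size G)) * Z φ G - Z (λ F → ι (size F) * φ F) G
  ∂Z {zero} φ [] = lem (φ [])
    where
    lem : ∀ p → 𝟘 ≡ (𝟘 - 𝟘) * p - 𝟘 * p
    lem = ring 1 (λ p → # 0 := (# 0 :- # 0) :* p :- # 0 :* p) refl
  ∂Z {suc n} φ (true ∷ G) = trans (∂Z _ G) (cong (λ x → x * Z (λ S → φ (false ∷ S)) G - Z (λ F → ι (size F) * φ (false ∷ F)) G)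
    (trans (lem (ι n) (ι (size G))) (cong₂ _-_ (sym (ι-suc n)) (sym (ι-suc (size G))))))
    where
    lem : ∀ a b → a - b ≡ 𝟙 + a - (𝟙 + b)
    lem = ring 2 (λ a b → a :- b := # 1 :+ a :- (# 1 :+ b)) refl
  ∂Z {suc n} φ (false ∷ G) = trans (cong (Z φ₀ G +_) (trans (∂-+ _ _ G) (cong₂ _+_ (∂Z φ₁ G) (∂Z φ₀ G))))
    (trans (lem _ _ (ι n) (ι (size G)) _ _)
    (cong₂ (λ x y → (x - ι (size G)) * (Z φ₁ G + Z φ₀ G) - (y + Z (λ F → ι (size F) * φ₀ F) G)) (sym (ι-suc n)) (sym eq)))
    where
    φ₀ φ₁ : Subset n → ℚ
    φ₀ S = φ (false ∷ S)
    φ₁ S = φ (true ∷ S)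
    eq : Z (λ F → ι (suc (size F)) * φ₁ F) G ≡ Z φ₁ G + Z (λ F → ι (size F) * φ₁ F) G
    eq = trans (Z-cong (λ F → trans (cong (_* φ₁ F) (ι-suc (size F))) (trans (distribʳ (φ₁ F) 𝟙 (ι (size F)))
        (cong (_+ ι (size F) * φ₁ F) (*-identityˡ (φ₁ F)))))  G) (Z-+ _ _ G)
    lem : ∀ z0 z1 n g u v → z0 + (((n - g) * z1 - u) + ((n - g) * z0 - v)) ≡ (𝟙 + n - g) * (z1 + z0) - (z1 + u + v)
    lem = ring 6 (λ z0 z1 n g u v → z0 :+ (((n :- g) :* z1 :- u) :+ ((n :- g) :* z0 :- v)) := (# 1 :+ n :- g) :* (z1 :+ z0) :-
        (z1 :+ u :+ v)) refl

  -- Levels, linear functions and counting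

  lev : ∀ {n} → ℕ → Subset n → ℚ
  lev zero [] = 𝟙
  lev (suc k) [] = 𝟘
  lev zero (true ∷ S) = 𝟘
  lev (suc k) (true ∷ S) = lev k S
  lev k (false ∷ S) = lev k S

  lev-yes : ∀ {n} k (S : Subset n) → size S ≡ k → lev k S ≡ 𝟙
  lev-yes zero [] e = refl
  lev-yes (suc k) (true ∷ S) e = lev-yes k S (ℕ.suc-injective e)
  lev-yes zero (false ∷ S) e = lev-yes zero S e
  lev-yes (suc k) (false ∷ S) e = lev-yes (suc k) S e

  lev-no : ∀ {n} k (S : Subset n) → size S ≢ k → lev k S ≡ 𝟘
  lev-no zero [] e = ⊥-elim (e refl)
  lev-no (suc k) [] e = refl
  lev-no zero (true ∷ S) e = refl
  lev-no (suc k) (true ∷ S) e = lev-no k S (λ p → e (cong suc p))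
  lev-no zero (false ∷ S) e = lev-no zero S e
  lev-no (suc k) (false ∷ S) e = lev-no (suc k) S e

  onLevel : ∀ {n} k (S : Subset n) {x y : ℚ} → (size S ≡ k → x ≡ y) → lev k S * x ≡ lev k S * y
  onLevel k S {x} {y} e with size S ℕ.≟ k
  ... | yes p = cong (lev k S *_) (e p)
  ... | no p = trans (cong (_* x) (lev-no k S p)) (trans (zeroˡ x) (sym (trans (cong (_* y) (lev-no k S p)) (zeroˡ y))))

  0≤lev : ∀ {n} k (S : Subset n) → 𝟘 ≤ lev k S
  0≤lev k S with size S ℕ.≟ k
  ... | yes p = subst (𝟘 ≤_) (sym (lev-yes k S p)) (0≤ι 1)
  ... | no p = subst (𝟘 ≤_) (sym (lev-no k S p)) (0≤ι 0)

  lev-idem : ∀ {n} k (S : Subset n) → lev k S * lev k S ≡ lev k S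
  lev-idem k S = trans (onLevel k S (lev-yes k S)) (*-identityʳ _)

  Supp : ∀ {n} → ℕ → (Subset n → ℚ) → Set
  Supp k φ = ∀ S → size S ≢ k → φ S ≡ 𝟘

  lev-Supp : ∀ {n} k (φ : Subset n → ℚ) → Supp k (λ S → lev k S * φ S)
  lev-Supp k φ S p = trans (cong (_* φ S) (lev-no k S p)) (zeroˡ _)

  Supp-lev : ∀ {n} {k} {φ : Subset n → ℚ} → Supp k φ → ∀ S → lev k S * φ S ≡ φ S
  Supp-lev {k = k} {φ} s S with size S ℕ.≟ k
  ... | yes p = trans (cong (_* φ S) (lev-yes k S p)) (*-identityˡ _)
  ... | no p = trans (cong (lev k S *_) (s S p)) (trans (zeroʳ _) (sym (s S p)))

  Supp-* : ∀ {n} {k} {φ : Subset n → ℚ} → Supp k φ → ∀ S {x y} → (size S ≡ k → x ≡ y) → φ S * x ≡ φ S * y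
  Supp-* {k = k} {φ} s S {x} {y} e with size S ℕ.≟ k
  ... | yes p = cong (φ S *_) (e p)
  ... | no p = trans (trans (cong (_* x) (s S p)) (zeroˡ x)) (sym (trans (cong (_* y) (s S p)) (zeroˡ y)))

  wt : ∀ {n} → Vec ℚ n → Subset n → ℚ
  wt [] [] = 𝟘
  wt (c ∷ cs) (true ∷ S) = c + wt cs S
  wt (c ∷ cs) (false ∷ S) = wt cs S

  cwt : ∀ {n} → Vec ℚ n → Subset n → ℚ
  cwt [] [] = 𝟘
  cwt (c ∷ cs) (true ∷ S) = cwt cs S
  cwt (c ∷ cs) (false ∷ S) = c + cwt cs S

  tot : ∀ {n} → Vec ℚ n → ℚ
  tot [] = 𝟘
  tot (c ∷ cs) = c + tot cs

  dot : ∀ {n} → Vec ℚ n → Vec ℚ n → ℚ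
  dot [] [] = 𝟘
  dot (c ∷ cs) (d ∷ ds) = c * d + dot cs ds

  ones : ∀ n → Vec ℚ n
  ones n = replicate n 𝟙

  free : ∀ {n} → Subset n → ℕ
  free [] = 0
  free (true ∷ S) = free S
  free (false ∷ S) = suc (free S)

  free+size : ∀ {n} (S : Subset n) → free S +ℕ size S ≡ n
  free+size [] = refl
  free+size (true ∷ S) = trans (ℕ.+-suc (free S) (size S)) (cong suc (free+size S))
  free+size (false ∷ S) = cong suc (free+size S)

  wt+cwt : ∀ {n} (c : Vec ℚ n) S → wt c S + cwt c S ≡ tot c
  wt+cwt [] [] = +-identityˡ 𝟘
  wt+cwt (c ∷ cs) (true ∷ S) = trans (+-assoc c _ _) (cong (c +_) (wt+cwt cs S))
  wt+cwt (c ∷ cs) (false ∷ S) = trans (ring 3 (λ w c x → w :+ (c :+ x) := c :+ (w :+ x)) refl _ _ _) (cong (c +_) (wt+cwt cs S))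

  wt-ones : ∀ {n} (S : Subset n) → wt (ones n) S ≡ ι (size S)
  wt-ones [] = refl
  wt-ones (true ∷ S) = trans (cong (𝟙 +_) (wt-ones S)) (sym (ι-suc _))
  wt-ones (false ∷ S) = wt-ones S

  tot-ones : ∀ n → tot (ones n) ≡ ι n
  tot-ones zero = refl
  tot-ones (suc n) = trans (cong (𝟙 +_) (tot-ones n)) (sym (ι-suc n))

  cwt-full : ∀ {n} (c : Vec ℚ n) G → free G ≡ 0 → cwt c G ≡ 𝟘
  cwt-full [] [] e = refl
  cwt-full (c ∷ cs) (true ∷ G) e = cwt-full cs G e

  -- Pascal's rule with rational values, so that it reduces definitionally and feeds the ring
  -- solver; `bin≡C` returns to the library coefficient.
  bin : ℕ → ℕ → ℚ
  bin n zero = 𝟙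
  bin zero (suc k) = 𝟘
  bin (suc n) (suc k) = bin n k + bin n (suc k)

  bin≡C : ∀ n k → bin n k ≡ ι (n C k)
  bin≡C n zero = cong ι (sym (trans (nCk≡nC[n∸k] {0} {n} z≤n) (nCn≡1 n)))
  bin≡C zero (suc k) = cong ι (sym (k>n⇒nCk≡0 {0} {suc k} (s≤s z≤n)))
  bin≡C (suc n) (suc k) = trans (cong₂ _+_ (bin≡C n k) (bin≡C n (suc k)))
      (trans (sym (ι-+ _ _)) (cong ι (nCk+nC[k+1]≡[n+1]C[k+1] n k)))

  Z-0 : ∀ {n} (G : Subset n) → Z (λ _ → 𝟘) G ≡ 𝟘
  Z-0 G = trans (Z-cong (λ _ → sym (zeroˡ 𝟘)) G) (trans (Z-* 𝟘 (λ _ → 𝟘) G) (zeroˡ _))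

  Z-lev : ∀ {n} k (G : Subset n) → Z (lev k) G ≡ bin (free G) k
  Z-lev zero [] = refl
  Z-lev (suc k) [] = refl
  Z-lev zero (true ∷ G) = Z-lev zero G
  Z-lev (suc k) (true ∷ G) = Z-lev (suc k) G
  Z-lev zero (false ∷ G) = trans (cong₂ _+_ (Z-0 G) (Z-lev zero G)) (+-identityˡ _)
  Z-lev (suc k) (false ∷ G) = cong₂ _+_ (Z-lev k G) (Z-lev (suc k) G)

  lev0-wt : ∀ {n} (c : Vec ℚ n) S → lev 0 S * wt c S ≡ 𝟘
  lev0-wt [] [] = zeroʳ _
  lev0-wt (c ∷ cs) (true ∷ S) = zeroˡ _
  lev0-wt (c ∷ cs) (false ∷ S) = lev0-wt cs S

  -- Every point outside G lies in the same number C(free G - 1, k) of (k+1)-sets avoiding G. The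
  -- truncated subtraction is harmless: for full G the factor `cwt c G` is zero.
  Z-wt : ∀ {n} k (c : Vec ℚ n) G → Z (λ F → lev (suc k) F * wt c F) G ≡ bin (free G ∸ 1) k * cwt c G
  Z-wt k [] [] = trans (zeroˡ _) (sym (zeroʳ _))
  Z-wt k (c ∷ cs) (true ∷ G) = Z-wt k cs G
  Z-wt {suc n} k (c ∷ cs) (false ∷ G) = trans (cong₂ _+_ (trans split (cong₂ _+_ (cong (c *_) (Z-lev k G)) (below k)))
      (Z-wt k cs G))
     (combine k (free G) refl)
    where
    split : Z (λ F → lev k F * (c + wt cs F)) G ≡ c * Z (lev k) G + Z (λ F → lev k F * wt cs F) G
    split = trans (Z-cong (λ F → ring 3 (λ l c w → l :* (c :+ w) := c :* l :+ l :* w) refl (lev k F) c (wt cs F)) G)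
      (trans (Z-+ _ _ G) (cong (_+ Z (λ F → lev k F * wt cs F) G) (Z-* c (lev k) G)))
    low : ℕ → ℚ
    low zero = 𝟘
    low (suc k) = bin (free G ∸ 1) k * cwt cs G
    below : ∀ k → Z (λ F → lev k F * wt cs F) G ≡ low k
    below zero = trans (Z-cong (lev0-wt cs) G) (Z-0 G)
    below (suc k) = Z-wt k cs G
    combine : ∀ k f → free G ≡ f → (c * bin (free G) k + low k) + bin (free G ∸ 1) k * cwt cs G ≡ bin (free G) k * (c + cwt cs G)
    combine zero f e = ring 2 (λ c x → (c :* # 1 :+ # 0) :+ # 1 :* x := # 1 :* (c :+ x)) refl c (cwt cs G)
    combine (suc k) zero e rewrite cwt-full cs G e = ring 4 (λ c x y z → (c :* x :+ y :* # 0) :+ z :* # 0 := x :* (c :+ # 0)) refl c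
        _ _ _
    combine (suc k) (suc f) e rewrite e = ring 4 (λ c x y w → (c :* (x :+ y) :+ x :* w) :+ y :* w := (x :+ y) :* (c :+ w)) refl c _
        _ (cwt cs G)

  none : ∀ n → Subset n
  none n = replicate n false

  -- Every set is disjoint from the empty one, so sums over a level are special values of `Z-lev`
  -- and `Z-wt`.
  Z-none : ∀ {n} (φ : Subset n → ℚ) → Z φ (none n) ≡ sumS φ
  Z-none {zero} φ = sym (sumS-[] φ)
  Z-none {suc n} φ = trans (cong₂ _+_ (Z-none _) (Z-none _)) (sym (sumS-∷ φ))

  free-none : ∀ n → free (none n) ≡ n
  free-none zero = refl
  free-none (suc n) = cong suc (free-none n)

  cwt-none : ∀ {n} (c : Vec ℚ n) → cwt c (none n) ≡ tot c
  cwt-none [] = refl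
  cwt-none (c ∷ cs) = cong (c +_) (cwt-none cs)

  sum-lev : ∀ n k → sumS {n} (lev k) ≡ bin n k
  sum-lev n k = trans (sym (Z-none _)) (trans (Z-lev k (none n)) (cong (λ m → bin m k) (free-none n)))

  sum-wt : ∀ {n} k (c : Vec ℚ n) → ⟨ lev (suc k) , wt c ⟩ ≡ bin (n ∸ 1) k * tot c
  sum-wt {n} k c = trans (sym (Z-none _)) (trans (Z-wt k c (none n)) (cong₂ (λ m x → bin (m ∸ 1) k * x) (free-none n) (cwt-none c)))

  sumS-lin4 : ∀ {n} a b c d (φ ψ θ χ : Subset n → ℚ) →
    sumS (λ S → (a * φ S + b * ψ S) + (c * θ S + d * χ S)) ≡ (a * sumS φ + b * sumS ψ) + (c * sumS θ + d * sumS χ)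
  sumS-lin4 a b c d φ ψ θ χ = trans (sumS-+ _ _) (cong₂ _+_ (sumS-lin a b φ ψ) (sumS-lin c d θ χ))

  -- A point lies in C(n-1, k) of the (k+1)-sets and a pair of points in C(n-2, k-1). The latter is
  -- written as C(n-1, k) - C(n-2, k), which is also right for k = 0.
  sum-wt-wt : ∀ {n} k (c d : Vec ℚ n) → sumS (λ F → lev (suc k) F * (wt c F * wt d F))
    ≡ bin (n ∸ 2) k * dot c d + (bin (n ∸ 1) k - bin (n ∸ 2) k) * (tot c * tot d)
  sum-wt-wt k [] [] = trans (sumS-[] _) (ring 1 (λ x → # 0 :* (# 0 :* # 0) := x :* # 0 :+ (x :- x) :* (# 0 :* # 0)) refl (bin 0 k))
  sum-wt-wt {suc n} k (c ∷ cs) (d ∷ ds) = trans (sumS-∷ _) (trans (cong₂ _+_ (trans split (fill k)) (sum-wt-wt k cs ds))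
      (combine k cs ds))
    where
    W : ℕ → ℚ
    W k = sumS (λ F → lev k F * (wt cs F * wt ds F))
    split : sumS (λ F → lev k F * ((c + wt cs F) * (d + wt ds F))) ≡ (c * d * sumS {n} (lev k) + c * ⟨ lev k , wt ds ⟩) +
        (d * ⟨ lev k , wt cs ⟩ + 𝟙 * W k)
    split = trans (sumS-cong (λ F → ring 5 (λ l c w d v → l :* ((c :+ w) :* (d :+ v)) := (c :* d :* l :+ c :* (l :* v)) :+
        (d :* (l :* w) :+ # 1 :* (l :* (w :* v)))) refl (lev k F) c (wt cs F) d (wt ds F)))
      (sumS-lin4 _ _ _ _ _ _ _ _)
    low low₂ : ℕ → Vec ℚ n → Vec ℚ n → ℚ
    low zero cs ds = 𝟘
    low (suc k) cs ds = bin (n ∸ 1) k * tot cs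
    low₂ zero cs ds = 𝟘
    low₂ (suc k) cs ds = bin (n ∸ 2) k * dot cs ds + (bin (n ∸ 1) k - bin (n ∸ 2) k) * (tot cs * tot ds)
    fill₁ : ∀ k cs → ⟨ lev k , wt cs ⟩ ≡ low k cs cs
    fill₁ zero cs = trans (sumS-cong (lev0-wt cs)) (sumS-0 {n})
    fill₁ (suc k) cs = sum-wt k cs
    fill₂ : ∀ k → W k ≡ low₂ k cs ds
    fill₂ zero = trans (sumS-cong (λ F → trans (sym (*-assoc _ _ _)) (trans (cong (_* wt ds F) (lev0-wt cs F)) (zeroˡ _))))
        (sumS-0 {n})
    fill₂ (suc k) = sum-wt-wt k cs ds
    fill : ∀ k → (c * d * sumS {n} (lev k) + c * ⟨ lev k , wt ds ⟩) + (d * ⟨ lev k , wt cs ⟩ + 𝟙 * W k)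
      ≡ (c * d * bin n k + c * low k ds ds) + (d * low k cs cs + 𝟙 * low₂ k cs ds)
    fill k = cong₂ _+_ (cong₂ (λ x y → c * d * x + c * y) (sum-lev n k) (fill₁ k ds))
        (cong₂ (λ x y → d * x + 𝟙 * y) (fill₁ k cs) (fill₂ k))
    combine : ∀ k cs ds → ((c * d * bin n k + c * low k ds ds) + (d * low k cs cs + 𝟙 * low₂ k cs ds))
       + (bin (n ∸ 2) k * dot cs ds + (bin (n ∸ 1) k - bin (n ∸ 2) k) * (tot cs * tot ds))
       ≡ bin (n ∸ 1) k * (c * d + dot cs ds) + (bin n k - bin (n ∸ 1) k) * ((c + tot cs) * (d + tot ds))
    combine zero cs ds = ring 5 (λ c d x t u → ((c :* d :* # 1 :+ c :* # 0) :+ (d :* # 0 :+ # 1 :* # 0)) :+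
        (# 1 :* x :+ (# 1 :- # 1) :* (t :* u))
       := # 1 :* (c :* d :+ x) :+ (# 1 :- # 1) :* ((c :+ t) :* (d :+ u))) refl c d (dot cs ds) (tot cs) (tot ds)
    -- Tails of length 0 and 1, where `n ∸ 1` or `n ∸ 2` truncates, are checked apart.
    combine (suc k) [] [] = ring 4 (λ c d x y → ((c :* d :* x :+ c :* (y :* # 0)) :+
        (d :* (y :* # 0) :+ # 1 :* (y :* # 0 :+ (y :- y) :* (# 0 :* # 0)))) :+ (x :* # 0 :+ (x :- x) :* (# 0 :* # 0))
       := x :* (c :* d :+ # 0) :+ (x :- x) :* ((c :+ # 0) :* (d :+ # 0))) refl c d (bin 0 (suc k)) (bin 0 k)
    combine (suc k) (e ∷ []) (f ∷ []) = ring 6 (λ c d x y e f → ((c :* d :* (y :+ x) :+ c :* (y :* (f :+ # 0))) :+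
        (d :* (y :* (e :+ # 0)) :+ # 1 :* (y :* (e :* f :+ # 0) :+ (y :- y) :* ((e :+ # 0) :* (f :+ # 0))))) :+
        (x :* (e :* f :+ # 0) :+ (x :- x) :* ((e :+ # 0) :* (f :+ # 0)))
       := x :* (c :* d :+ (e :* f :+ # 0)) :+ ((y :+ x) :- x) :* ((c :+ (e :+ # 0)) :* (d :+ (f :+ # 0)))) refl c d (bin 0 (suc k))
           (bin 0 k) e f
    combine (suc k) cs@(_ ∷ _ ∷ _) ds = big _ _ (bin (n ∸ 1) k) (bin (n ∸ 2) k) (bin (n ∸ 2) (suc k)) (dot cs ds) (tot cs) (tot ds)
      where
      big : ∀ c d y z x D t u → ((c * d * (y + (z + x)) + c * (y * u)) + (d * (y * t) + 𝟙 * (z * D + (y - z) * (t * u)))) +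
          (x * D + ((z + x) - x) * (t * u))
        ≡ (z + x) * (c * d + D) + ((y + (z + x)) - (z + x)) * ((c + t) * (d + u))
      big = ring 8 (λ c d y z x D t u → ((c :* d :* (y :+ (z :+ x)) :+ c :* (y :* u)) :+
          (d :* (y :* t) :+ # 1 :* (z :* D :+ (y :- z) :* (t :* u)))) :+ (x :* D :+ ((z :+ x) :- x) :* (t :* u))
        := (z :+ x) :* (c :* d :+ D) :+ ((y :+ (z :+ x)) :- (z :+ x)) :* ((c :+ t) :* (d :+ u))) refl

  -- The spectral bound

  size≡0⇒none : ∀ {n} (S : Subset n) → size S ≡ 0 → S ≡ none n
  size≡0⇒none [] e = refl
  size≡0⇒none (false ∷ S) e = cong (false ∷_) (size≡0⇒none S e)

  wt-none : ∀ {n} (c : Vec ℚ n) → wt c (none n) ≡ 𝟘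
  wt-none [] = refl
  wt-none (c ∷ cs) = wt-none cs

  -- On a level k ≥ 1 this includes orthogonality to constants, because `wt (ones n)` is constantly
  -- k there.
  Orth : ∀ {n} → (Subset n → ℚ) → Set
  Orth {n} h = ∀ (c : Vec ℚ n) → ⟨ h , wt c ⟩ ≡ 𝟘

  ∂-Supp : ∀ {n} {k} {φ : Subset n → ℚ} → Supp (suc k) φ → Supp k (∂ φ)
  ∂-Supp s S p = trans (∂-local S (λ S′ e → s S′ (λ q → p (ℕ.suc-injective (trans (sym e) q))))) (∂-0 S)

  ∂ᵀ-const : ∀ {n} a (S : Subset n) → ∂ᵀ (λ _ → a) S ≡ ι (size S) * a
  ∂ᵀ-const a [] = sym (zeroˡ a)
  ∂ᵀ-const a (true ∷ S) = trans (cong (a +_) (∂ᵀ-const a S)) (trans (ring 2 (λ a s → a :+ s :* a := (# 1 :+ s) :* a) refl a _)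
      (cong (_* a) (sym (ι-suc (size S)))))
  ∂ᵀ-const a (false ∷ S) = ∂ᵀ-const a S

  ∂ᵀ-wt : ∀ {n} (c : Vec ℚ n) S → ∂ᵀ (wt c) S ≡ (ι (size S) - 𝟙) * wt c S
  ∂ᵀ-wt [] [] = sym (zeroʳ _)
  ∂ᵀ-wt (c ∷ cs) (true ∷ S) = trans (cong (wt cs S +_) (trans (∂ᵀ-+ (λ _ → c) (wt cs) S) (cong₂ _+_ (∂ᵀ-const c S) (∂ᵀ-wt cs S))))
    (trans (ring 3 (λ w s c → w :+ (s :* c :+ (s :- # 1) :* w) := (# 1 :+ s :- # 1) :* (c :+ w)) refl _ _ c)
    (cong (λ x → (x - 𝟙) * (c + wt cs S)) (sym (ι-suc (size S)))))
  ∂ᵀ-wt (c ∷ cs) (false ∷ S) = ∂ᵀ-wt cs S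

  -- The adjoint preserves linear functions up to a factor: removing one point of S at a time, each
  -- point survives |S| - 1 removals.
  ∂-Orth : ∀ {n} {k} {h : Subset n → ℚ} → Supp k h → Orth h → Orth (∂ h)
  ∂-Orth {k = k} {h} s o c = trans (∂-adjoint h (wt c)) (trans (sumS-cong
      (λ S → trans (Supp-* s S (λ e → trans (∂ᵀ-wt c S) (cong (λ m → (ι m - 𝟙) * wt c S) e)))
      (ring 3 (λ h k w → h :* (k :* w) := k :* (h :* w)) refl (h S) (ι k - 𝟙) (wt c S))))
    (trans (sumS-* (ι k - 𝟙) _) (trans (cong ((ι k - 𝟙) *_) (o c)) (zeroʳ _))))

  singletons : ∀ {n} → (Subset n → ℚ) → Vec ℚ n
  singletons {zero} w = []
  singletons {suc n} w = w (true ∷ none n) ∷ singletons (λ S → w (false ∷ S))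

  wt-singletons : ∀ {n} (w : Subset n → ℚ) S → size S ≡ 1 → w S ≡ wt (singletons w) S
  wt-singletons {suc n} w (true ∷ S) e with size≡0⇒none S (ℕ.suc-injective e)
  ... | refl = sym (trans (cong (w (true ∷ none n) +_) (wt-none (singletons (λ S → w (false ∷ S))))) (+-identityʳ _))
  wt-singletons w (false ∷ S) e = wt-singletons (λ S → w (false ∷ S)) S e

  -- Every function on singletons is linear, so `w` is orthogonal to itself.
  level1-norm : ∀ {n} {w : Subset n → ℚ} → Supp 1 w → Orth w → ⟨ w , w ⟩ ≡ 𝟘
  level1-norm {w = w} s o = trans (sumS-cong (λ S → Supp-* s S (wt-singletons w S))) (o (singletons w))

  sq-cancel : ∀ {x H K} → 𝟘 ≤ x → 𝟘 ≤ K * H → x * x ≤ H * (K * x) → x ≤ K * H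
  sq-cancel {x} {H} {K} p q r with ℚ.<-cmp 𝟘 x
  ... | tri< pos _ _ = *-cancel-≤ x pos (subst (x * x ≤_) (ring 3 (λ x H K → H :* (K :* x) := x :* (K :* H)) refl x H K) r)
  ... | tri≈ _ e _ = subst (_≤ K * H) e q
  ... | tri> _ _ neg = ⊥-elim (<⇒≱ neg p)

  ∂ᵀ-norm : ∀ {n} k {w : Subset n → ℚ} → Supp k w → ⟨ ∂ᵀ w , ∂ᵀ w ⟩ ≡ ⟨ ∂ w , ∂ w ⟩ + (ι n - ι k - ι k) * ⟨ w , w ⟩
  ∂ᵀ-norm {n} k {w} s = trans (sym (∂-adjoint (∂ᵀ w) w)) (trans (sumS-cong
      (λ S → trans (*-comm _ _) (trans (Supp-* s S (λ e → trans (∂∂ᵀ-comm w S)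
      (cong (λ m → ∂ᵀ (∂ w) S + (ι n - ι m - ι m) * w S) e))) (ring 3 (λ w t q → w :* (t :+ q :* w) := # 1 :* (w :* t) :+ q :*
          (w :* w)) refl (w S) _ _))))
    (trans (sumS-lin 𝟙 (ι n - ι k - ι k) _ _) (cong (_+ (ι n - ι k - ι k) * ⟨ w , w ⟩)
        (trans (*-identityˡ _) (sym (∂-adjoint w (∂ w)))))))

  -- For w = ∂ h, ‖w‖² = ⟨ h , ∂ᵀ w ⟩ and ‖∂ᵀ w‖² is controlled by ‖∂ w‖² one level below.
  shadow-bound : ∀ {n} m {h : Subset n → ℚ} → 3 +ℕ m ≤ℕ n → Supp (2 +ℕ m) h → Orth h →
    ⟨ ∂ h , ∂ h ⟩ ≤ ι m * (ι n - ι m - ι 3) * ⟨ h , h ⟩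
  shadow-bound {n} zero {h} le s o = ℚ.≤-reflexive (trans (level1-norm (∂-Supp s) (∂-Orth s o))
      (sym (trans (cong (_* ⟨ h , h ⟩) (zeroˡ _)) (zeroˡ _))))
  shadow-bound {n} (suc m) {h} le s o = sq-cancel {K = ι (suc m) * (ι n - ι (suc m) - ι 3)} (0≤⟨⟩ w)
      (0≤* (0≤* (0≤ι (suc m)) (subst (𝟘 ≤_) (trans (cong (λ z → ι n - z) (ι-+ 3 (suc m)))
          (ring 2 (λ n m → n :- (# 3 :+ m) := n :- m :- # 3) refl _ _)) (0≤- (ι-mono le)))) (0≤⟨⟩ h))
      (ℚ.≤-trans (subst (_≤ ⟨ h , h ⟩ * ⟨ ∂ᵀ w , ∂ᵀ w ⟩) (cong (λ z → z * z) (sym (∂-adjoint h w))) (cauchy-schwarz h (∂ᵀ w)))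
        (*-monoˡ ⟨ h , h ⟩ (0≤⟨⟩ h) bound))
    where
    w : Subset n → ℚ
    w = ∂ h
    ih : ⟨ ∂ w , ∂ w ⟩ ≤ ι m * (ι n - ι m - ι 3) * ⟨ w , w ⟩
    ih = shadow-bound m (ℕ.≤-trans (ℕ.n≤1+n _) le) (∂-Supp s) (∂-Orth s o)
    -- The commutator adds n - 2(m+2), and m(n-m-3) + n - 2m - 4 = (m+1)(n-m-4). These are the
    -- eigenvalues of `∂ᵀ` after `∂` on functions of degree exactly two, so the induction is sharp.
    bound : ⟨ ∂ᵀ w , ∂ᵀ w ⟩ ≤ ι (suc m) * (ι n - ι (suc m) - ι 3) * ⟨ w , w ⟩
    bound = subst₂ _≤_ (sym (∂ᵀ-norm (2 +ℕ m) (∂-Supp s)))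
       (trans (cong (λ z → ι m * (ι n - ι m - ι 3) * ⟨ w , w ⟩ + (ι n - z - z) * ⟨ w , w ⟩) (ι-+ 2 m))
         (trans (ring 3 (λ m n w → m :* (n :- m :- # 3) :* w :+ (n :- (# 2 :+ m) :- (# 2 :+ m)) :* w := (# 1 :+ m) :*
             (n :- (# 1 :+ m) :- # 3) :* w) refl (ι m) (ι n) ⟨ w , w ⟩)
           (cong (λ z → z * (ι n - z - ι 3) * ⟨ w , w ⟩) (sym (ι-suc m)))))
       (+-mono-≤ ih ℚ.≤-refl)

  bin-absorb : ∀ n k → ι (suc k) * bin (suc n) (suc k) ≡ ι (suc n) * bin n k
  bin-absorb zero zero = cong (𝟙 *_) (+-identityʳ 𝟙)
  bin-absorb zero (suc k) = trans (cong (ι (2 +ℕ k) *_) (+-identityʳ 𝟘)) (trans (zeroʳ _) (sym (zeroʳ _)))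
  bin-absorb (suc n) zero = trans (ring 1 (λ x → # 1 :* (# 1 :+ x) := # 1 :+ # 1 :* x) refl _)
      (trans (cong (𝟙 +_) (bin-absorb n zero))
    (trans (ring 1 (λ x → # 1 :+ x :* # 1 := (# 1 :+ x) :* # 1) refl _) (cong (_* 𝟙) (sym (ι-suc (suc n))))))
  bin-absorb (suc n) (suc k) = trans (cong (_* (bin (suc n) (suc k) + bin (suc n) (suc (suc k)))) (ι-suc (suc k)))
    (trans (ring 3 (λ k x y → (# 1 :+ k) :* (x :+ y) := (k :* x :+ x) :+ (# 1 :+ k) :* y) refl (ι (suc k)) _ _)
    (trans (cong₂ (λ u v → (u + bin (suc n) (suc k)) + v) (bin-absorb n k)
        (trans (cong (_* bin (suc n) (suc (suc k))) (sym (ι-suc (suc k)))) (bin-absorb n (suc k))))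
    (trans (ring 3 (λ n x y → (n :* x :+ (x :+ y)) :+ n :* y := (# 1 :+ n) :* (x :+ y)) refl (ι (suc n)) _ _)
    (cong (_* (bin n k + bin n (suc k))) (sym (ι-suc (suc n)))))))

  bin-next : ∀ n k → ι (suc k) * bin n (suc k) ≡ (ι n - ι k) * bin n k
  bin-next n k = trans (ring 3 (λ s x y → s :* y := s :* (x :+ y) :- s :* x) refl (ι (suc k)) (bin n k) (bin n (suc k)))
    (trans (cong₂ (λ u v → u - v * bin n k) (trans (bin-absorb n k) (cong (_* bin n k) (ι-suc n))) (ι-suc k))
    (ring 3 (λ n k x → (# 1 :+ n) :* x :- (# 1 :+ k) :* x := (n :- k) :* x) refl (ι n) (ι k) (bin n k)))

  bin-up : ∀ n k → (ι (suc n) - ι k) * bin (suc n) k ≡ ι (suc n) * bin n k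
  bin-up n zero = ring 1 (λ n → (n :- # 0) :* # 1 := n :* # 1) refl (ι (suc n))
  bin-up n (suc k) = trans (sym (bin-next (suc n) (suc k))) (bin-absorb n (suc k))

  bin-over : ∀ n k → n <ℕ k → bin n k ≡ 𝟘
  bin-over zero (suc k) p = refl
  bin-over (suc n) (suc k) (s≤s p) = trans (cong₂ _+_ (bin-over n k p) (bin-over n (suc k) (ℕ.m<n⇒m<1+n p))) (+-identityʳ 𝟘)

  bin-diag : ∀ n → bin n n ≡ 𝟙
  bin-diag zero = refl
  bin-diag (suc n) = trans (cong₂ _+_ (bin-diag n) (bin-over n (suc n) ℕ.≤-refl)) (+-identityʳ 𝟙)

  0≤bin : ∀ n k → 𝟘 ≤ bin n k
  0≤bin n k = subst (𝟘 ≤_) (sym (bin≡C n k)) (0≤ι _)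

  Z-small : ∀ {n} {k} {φ : Subset n → ℚ} G → Supp k φ → free G <ℕ k → Z φ G ≡ 𝟘
  Z-small [] s p = s [] (ℕ.<⇒≢ p)
  Z-small (true ∷ G) s p = Z-small G (λ S q → s (false ∷ S) q) p
  Z-small {k = suc k} (false ∷ G) s (s≤s p) = trans (cong₂ _+_ (Z-small G (λ S q → s (true ∷ S) (λ e → q (ℕ.suc-injective e))) p)
    (Z-small G (λ S q → s (false ∷ S) q) (ℕ.m<n⇒m<1+n p))) (+-identityʳ 𝟘)

  -- When G leaves free exactly as many points as the level needs, its complement is the only
  -- admissible set.
  Z-∁ : ∀ {n} {φ : Subset n → ℚ} G → Supp (free G) φ → Z φ G ≡ φ (∁ G)
  Z-∁ [] s = refl
  Z-∁ (true ∷ G) s = Z-∁ G (λ S q → s (false ∷ S) q)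
  Z-∁ (false ∷ G) s = trans (cong₂ _+_ (Z-∁ G (λ S q → s (true ∷ S) (λ e → q (ℕ.suc-injective e))))
      (Z-small G (λ S q → s (false ∷ S) q) ℕ.≤-refl)) (+-identityʳ _)

  size-∁ : ∀ {n} (G : Subset n) → size (∁ G) ≡ free G
  size-∁ [] = refl
  size-∁ (true ∷ G) = size-∁ G
  size-∁ (false ∷ G) = cong suc (size-∁ G)

  sumS-∁ : ∀ {n} (φ : Subset n → ℚ) → sumS (λ S → φ (∁ S)) ≡ sumS φ
  sumS-∁ {zero} φ = trans (sumS-[] _) (sym (sumS-[] φ))
  sumS-∁ {suc n} φ = trans (sumS-∷ _) (trans (+-comm _ _) (trans (cong₂ _+_ (sumS-∁ (λ S → φ (true ∷ S)))
      (sumS-∁ (λ S → φ (false ∷ S)))) (sym (sumS-∷ φ))))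

  sq-abs : ∀ {y z} → 𝟘 ≤ z → y * y ≤ z * z → 𝟘 ≤ z + y
  sq-abs {y} {z} p q with ℚ.<-cmp y 𝟘
  ... | tri< neg _ _ = *-cancel-≤ (z - y) (subst (𝟘 <_) (ring 2 (λ y z → (# 0 :- y) :+ z := z :- y) refl y z) (0<+ (0<- neg) p))
          (≤-cert _ (ring 2 (λ y z → (z :- y) :* (z :+ y) :- (z :- y) :* # 0 := z :* z :- y :* y) refl y z) (0≤- q))
  ... | tri≈ _ e _ = 0≤+ p (ℚ.≤-reflexive (sym e))
  ... | tri> _ _ pos = 0≤+ p (ℚ.<⇒≤ pos)

  -- Z h on level n − k is h composed with complementation, and ∂ carries Z h on one level to a
  -- multiple of Z h on the next; n − 2k shadow bounds reach level k.
  module Spectral {n k′ d : ℕ} (n≡ : n ≡ suc k′ +ℕ (suc k′ +ℕ d)) (h : Subset n → ℚ) (s : Supp (suc k′) h) (o : Orth h) where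

    k : ℕ
    k = suc k′

    H : ℚ
    H = ⟨ h , h ⟩

    a : ℕ → ℚ
    a m = sumS (λ G → lev m G * (Z h G * Z h G))

    u : ℕ → Subset n → ℚ
    u m G = lev m G * Z h G

    u-norm : ∀ m → ⟨ u m , u m ⟩ ≡ a m
    u-norm m = sumS-cong (λ G → trans (ring 2 (λ l z → (l :* z) :* (l :* z) := (l :* l) :* (z :* z)) refl (lev m G) (Z h G))
        (cong (_* (Z h G * Z h G)) (lev-idem m G)))

    sum-h : sumS h ≡ 𝟘
    sum-h = *-cancel-≡ (ι k) (0<ι-suc k′) (trans (sym (sumS-* (ι k) h)) (trans
        (sumS-cong (λ S → trans (*-comm _ _) (Supp-* s S (λ e → trans (cong ι (sym e)) (sym (wt-ones S))))))
       (trans (o (ones n)) (sym (zeroʳ _)))))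

    h-cwt : ∀ c → ⟨ h , cwt c ⟩ ≡ 𝟘
    h-cwt c = trans (sumS-cong (λ S → trans (cong (h S *_) (trans (ring 2 (λ w v → v := (w :+ v) :- w) refl (wt c S) (cwt c S))
        (cong (_- wt c S) (wt+cwt c S))))
        (ring 3 (λ h t w → h :* (t :- w) := t :* h :+ (:- # 1) :* (h :* w)) refl (h S) (tot c) (wt c S))))
      (trans (sumS-lin (tot c) (- 𝟙) h (λ S → h S * wt c S)) (trans (cong₂ (λ x y → tot c * x + (- 𝟙) * y) sum-h (o c))
          (ring 1 (λ t → t :* # 0 :+ (:- # 1) :* # 0 := # 0) refl (tot c))))

    free-k : ∀ F → size F ≡ k → free F ≡ k +ℕ d
    free-k F e = ℕ.+-cancelʳ-≡ k _ _ (trans (trans (cong (free F +ℕ_) (sym e)) (free+size F)) (trans n≡ (ℕ.+-comm k (k +ℕ d))))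

    -- Moving `Z` to the other side turns a linear function on level m + 1 into a multiple of
    -- `cwt c` on level k, and `h` is orthogonal to that.
    u-Orth : ∀ m → Orth (u (suc m))
    u-Orth m c = trans (sumS-cong (λ G → ring 3 (λ l z w → l :* z :* w := z :* (l :* w)) refl (lev (suc m) G) (Z h G) (wt c G)))
      (trans (Z-adjoint h (λ G → lev (suc m) G * wt c G)) (trans (sumS-cong
          (λ F → trans (Supp-* s F (λ e → trans (Z-wt m c F) (cong (λ f → bin (f ∸ 1) m * cwt c F) (free-k F e))))
        (ring 3 (λ h b w → h :* (b :* w) := b :* (h :* w)) refl (h F) (bin (k′ +ℕ d) m) (cwt c F))))
      (trans (sumS-* (bin (k′ +ℕ d) m) _) (trans (cong (bin (k′ +ℕ d) m *_) (h-cwt c)) (zeroʳ _)))))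

    ∂u : ∀ m G → ∂ (u (suc m)) G ≡ (ι n - ι m - ι k) * u m G
    ∂u m G with size G ℕ.≟ m
    ... | no p = trans (∂-Supp (lev-Supp (suc m) (Z h)) G p) (sym (trans (cong ((ι n - ι m - ι k) *_) (lev-Supp m (Z h) G p))
        (zeroʳ _)))
    ... | yes p = trans (∂-local G (λ S e → trans (cong (_* Z h S) (lev-yes (suc m) S (trans e (cong suc p)))) (*-identityˡ _)))
       (trans (∂Z h G) (trans (cong₂ (λ x y → (ι n - ι x) * Z h G - y) p
           (trans (Z-cong (λ F → trans (*-comm _ _) (trans (Supp-* s F (cong ι)) (*-comm _ _))) G) (Z-* (ι k) h G)))
       (trans (ring 4 (λ n m k z → (n :- m) :* z :- k :* z := (n :- m :- k) :* (# 1 :* z)) refl (ι n) (ι m) (ι k) (Z h G))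
         (cong (λ x → (ι n - ι m - ι k) * (x * Z h G)) (sym (lev-yes m G p))))))

    ∂u-norm : ∀ m → ⟨ ∂ (u (suc m)) , ∂ (u (suc m)) ⟩ ≡ (ι n - ι m - ι k) * (ι n - ι m - ι k) * a m
    ∂u-norm m = trans (sumS-cong (λ G → trans (cong₂ _*_ (∂u m G) (∂u m G))
        (ring 2 (λ q u → (q :* u) :* (q :* u) := (q :* q) :* (u :* u)) refl _ _)))
      (trans (sumS-* _ _) (cong ((ι n - ι m - ι k) * (ι n - ι m - ι k) *_) (u-norm m)))

    a-step : ∀ m → 3 +ℕ m ≤ℕ n → (ι n - ι (suc m) - ι k) * (ι n - ι (suc m) - ι k) * a (suc m) ≤ ι m * (ι n - ι m - ι 3) * a
        (2 +ℕ m)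
    a-step m le = subst₂ _≤_ (∂u-norm (suc m)) (cong (ι m * (ι n - ι m - ι 3) *_) (u-norm (2 +ℕ m)))
      (shadow-bound m le (lev-Supp (2 +ℕ m) (Z h)) (u-Orth (suc m)))

    a-top : a (k +ℕ d) ≡ H
    a-top = trans (sumS-cong pt) (sumS-∁ (λ S → h S * h S))
      where
      pt : ∀ G → lev (k +ℕ d) G * (Z h G * Z h G) ≡ h (∁ G) * h (∁ G)
      pt G with size G ℕ.≟ k +ℕ d
      ... | yes p = trans (trans (cong (_* (Z h G * Z h G)) (lev-yes _ G p)) (*-identityˡ _))
          (cong (λ z → z * z) (Z-∁ G (subst (λ f → Supp f h) (sym fk) s)))
        where
        fk : free G ≡ k
        fk = ℕ.+-cancelʳ-≡ (k +ℕ d) _ _ (trans (cong (free G +ℕ_) (sym p)) (trans (free+size G) n≡))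
      ... | no p = trans (trans (cong (_* (Z h G * Z h G)) (lev-no _ G p)) (zeroˡ _))
         (sym (trans (cong (λ z → z * z) (s (∁ G) (λ e → p (ℕ.+-cancelˡ-≡ k _ _
             (trans (cong (_+ℕ size G) (sym (trans (sym (size-∁ G)) e))) (trans (free+size G) n≡)))))) (zeroʳ 𝟘)))

    b : ℚ
    b = bin (k′ +ℕ d) k′

    private
      κ δ : ℚ
      κ = ι k′
      δ = ι d

    -- Downward induction from level n - k, where e = 0, to level k, where e = d: the product of the
    -- one-level ratios of `a-step` with denominators cleared. At i = 0 it says that on level k the
    -- norm of `Z h` is at most (k-1)/(n-k-1) times `b` times the norm of `h`.
    chain : ∀ e i → e +ℕ i ≡ d → (κ + ι e) * (κ + δ) * a (suc (k′ +ℕ i)) ≤ κ * (κ + ι i) *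
        (bin (k′ +ℕ e) k′ * bin (k′ +ℕ d) (k′ +ℕ i)) * H
    chain zero i refl = ℚ.≤-reflexive (trans (cong ((κ + ι 0) * (κ + ι i) *_) a-top)
      (trans (ring 3 (λ k i H → (k :+ # 0) :* (k :+ i) :* H := k :* (k :+ i) :* (# 1 :* # 1) :* H) refl κ (ι i) H)
      (cong₂ (λ x y → κ * (κ + ι i) * (x * y) * H) (sym (trans (cong (λ z → bin z k′) (ℕ.+-identityʳ k′)) (bin-diag k′)))
          (sym (bin-diag (k′ +ℕ i))))))
    chain (suc e) i refl = *-cancel-≤ (E * E) (0<* (0<ι-suc e) (0<ι-suc e))
       (ℚ.≤-trans (ℚ.≤-reflexive step₁) (ℚ.≤-trans (*-monoˡ ((κ + E) * (κ + δ))
           (0≤* (0≤+ (0≤ι k′) (0≤ι (suc e))) (0≤+ (0≤ι k′) (0≤ι d))) rec)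
       (ℚ.≤-trans (ℚ.≤-reflexive step₂) (ℚ.≤-trans (*-monoˡ ((κ + ι i) * (κ + E))
           (0≤* (0≤+ (0≤ι k′) (0≤ι i)) (0≤+ (0≤ι k′) (0≤ι (suc e)))) ih) (ℚ.≤-reflexive step₃)))))
      where
      E : ℚ
      E = ι (suc e)
      ιn : ι n ≡ ((𝟙 + κ) + (𝟙 + κ)) + (E + ι i)
      ιn = trans (cong ι (trans n≡ (sym (ℕ.+-assoc k k d)))) (trans (ι-+ (k +ℕ k) d)
          (cong₂ _+_ (trans (ι-+ k k) (cong₂ _+_ (ι-suc k′) (ι-suc k′))) (ι-+ (suc e) i)))
      le : 3 +ℕ (k′ +ℕ i) ≤ℕ n
      le = subst (3 +ℕ (k′ +ℕ i) ≤ℕ_) (sym n≡) (s≤s (ℕ.≤-trans (s≤s (ℕ.≤-reflexive (ℕ.+-comm 1 (k′ +ℕ i))))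
          (ℕ.≤-trans (ℕ.≤-reflexive (trans (cong suc (ℕ.+-assoc k′ i 1)) refl))
             (ℕ.≤-trans (s≤s (ℕ.+-monoʳ-≤ k′ (ℕ.≤-trans (ℕ.≤-reflexive (ℕ.+-comm i 1)) (s≤s (ℕ.m≤n+m i e))))) (ℕ.m≤n+m _ k′)))))
      eqE : ι n - ι (suc (k′ +ℕ i)) - ι k ≡ E
      eqE = trans (cong₂ _-_ (cong₂ _-_ ιn (trans (ι-suc _) (cong (𝟙 +_) (ι-+ k′ i)))) (ι-suc k′))
         (ring 3 (λ k e i → ((# 1 :+ k) :+ (# 1 :+ k)) :+ (e :+ i) :- (# 1 :+ (k :+ i)) :- (# 1 :+ k) := e) refl κ E (ι i))
      eqF : ι n - ι (k′ +ℕ i) - ι 3 ≡ κ + ι e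
      eqF = trans (cong₂ (λ x y → x - y - ι 3) (trans ιn (cong (λ z → ((𝟙 + κ) + (𝟙 + κ)) + (z + ι i)) (ι-suc e))) (ι-+ k′ i))
         (ring 3 (λ k e i → ((# 1 :+ k) :+ (# 1 :+ k)) :+ ((# 1 :+ e) :+ i) :- (k :+ i) :- # 3 := k :+ e) refl κ (ι e) (ι i))
      A₁ A₂ : ℚ
      A₁ = a (suc (k′ +ℕ i))
      A₂ = a (2 +ℕ (k′ +ℕ i))
      rec : E * E * A₁ ≤ (κ + ι i) * (κ + ι e) * A₂
      rec = subst₂ _≤_ (cong (λ x → x * x * A₁) eqE) (cong₂ (λ x y → x * y * A₂) (ι-+ k′ i) eqF) (a-step (k′ +ℕ i) le)
      ih : (κ + ι e) * (κ + δ) * A₂ ≤ κ * (κ + ι (suc i)) * (bin (k′ +ℕ e) k′ * bin (k′ +ℕ d) (suc (k′ +ℕ i))) * H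
      ih = subst (λ m → (κ + ι e) * (κ + δ) * a (suc m) ≤ κ * (κ + ι (suc i)) * (bin (k′ +ℕ e) k′ * bin (k′ +ℕ d) m) * H)
          (ℕ.+-suc k′ i) (chain e (suc i) (ℕ.+-suc e i))
      step₁ : E * E * ((κ + E) * (κ + δ) * A₁) ≡ (κ + E) * (κ + δ) * (E * E * A₁)
      step₁ = ring 4 (λ e x y a → e :* e :* (x :* y :* a) := x :* y :* (e :* e :* a)) refl E (κ + E) (κ + δ) A₁
      step₂ : (κ + E) * (κ + δ) * ((κ + ι i) * (κ + ι e) * A₂) ≡ (κ + ι i) * (κ + E) * ((κ + ι e) * (κ + δ) * A₂)
      step₂ = ring 5 (λ x y z w a → x :* y :* (z :* w :* a) := z :* x :* (w :* y :* a)) refl (κ + E) (κ + δ) (κ + ι i) (κ + ι e) A₂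
      B₁ B₂ : ℚ
      B₁ = bin (k′ +ℕ suc e) k′
      B₂ = bin (k′ +ℕ d) (k′ +ℕ i)
      up : (κ + E) * bin (k′ +ℕ e) k′ ≡ E * B₁
      up = sym (trans (cong₂ (λ x m → x * bin m k′) (trans (ring 2 (λ k e → e := k :+ e :- k) refl κ E)
          (cong (_- κ) (trans (sym (ι-+ k′ (suc e))) (cong ι (ℕ.+-suc k′ e))))) (ℕ.+-suc k′ e))
         (trans (bin-up (k′ +ℕ e) k′) (cong (_* bin (k′ +ℕ e) k′) (trans (cong ι (sym (ℕ.+-suc k′ e))) (ι-+ k′ (suc e))))))
      next : (κ + ι (suc i)) * bin (k′ +ℕ d) (suc (k′ +ℕ i)) ≡ E * B₂
      next = trans (cong (_* bin (k′ +ℕ d) (suc (k′ +ℕ i))) (trans (sym (ι-+ k′ (suc i))) (cong ι (ℕ.+-suc k′ i))))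
          (trans (bin-next (k′ +ℕ d) (k′ +ℕ i))
         (cong (_* B₂) (trans (cong₂ _-_ (trans (ι-+ k′ d) (cong (κ +_) (ι-+ (suc e) i))) (ι-+ k′ i))
             (ring 3 (λ k e i → k :+ (e :+ i) :- (k :+ i) := e) refl κ E (ι i)))))
      step₃ : (κ + ι i) * (κ + E) * (κ * (κ + ι (suc i)) * (bin (k′ +ℕ e) k′ * bin (k′ +ℕ d) (suc (k′ +ℕ i))) * H)
        ≡ E * E * (κ * (κ + ι i) * (B₁ * B₂) * H)
      step₃ = trans (ring 7 (λ z x k w p q H → z :* x :* (k :* w :* (p :* q) :* H) := k :* z :* ((x :* p) :* (w :* q)) :* H) refl
          (κ + ι i) (κ + E) κ (κ + ι (suc i)) (bin (k′ +ℕ e) k′) (bin (k′ +ℕ d) (suc (k′ +ℕ i))) H)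
        (trans (cong₂ (λ x y → κ * (κ + ι i) * (x * y) * H) up next)
          (ring 6 (λ e k z p q H → k :* z :* ((e :* p) :* (e :* q)) :* H := e :* e :* (k :* z :* (p :* q) :* H)) refl E κ (κ + ι i)
              B₁ B₂ H))

    -- Cauchy-Schwarz and the last link of `chain`. The ratio b(k-1)/(n-k-1) equals C(n-k-2, k-2),
    -- the Kneser eigenvalue in degree two.
    spectral-lower : 𝟘 ≤ κ * b * H + (κ + δ) * ⟨ h , Z h ⟩
    spectral-lower = sq-abs (0≤* (0≤* (0≤ι k′) (0≤bin (k′ +ℕ d) k′)) (0≤⟨⟩ h))
      (ℚ.≤-trans (ℚ.≤-reflexive (ring 2 (λ q x → (q :* x) :* (q :* x) := (q :* q) :* (x :* x)) refl (κ + δ) ⟨ h , Z h ⟩))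
      (ℚ.≤-trans (*-monoˡ ((κ + δ) * (κ + δ)) (0≤sq (κ + δ)) cs)
      (ℚ.≤-trans (ℚ.≤-reflexive (ring 3 (λ q H a → q :* q :* (H :* a) := H :* (q :* q :* a)) refl (κ + δ) H (a k)))
      (ℚ.≤-trans (*-monoˡ H (0≤⟨⟩ h) top) (ℚ.≤-reflexive (ring 3 (λ k b H → H :* (k :* (k :+ # 0) :* (b :* b) :* H) := (k :* b :* H)
          :* (k :* b :* H)) refl κ b H))))))
      where
      top : (κ + δ) * (κ + δ) * a k ≤ κ * (κ + ι 0) * (b * b) * H
      top = subst (λ m → (κ + δ) * (κ + δ) * a (suc m) ≤ κ * (κ + ι 0) * (b * bin (k′ +ℕ d) m) * H) (ℕ.+-identityʳ k′)
          (chain d 0 (ℕ.+-identityʳ d))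
      cs : ⟨ h , Z h ⟩ * ⟨ h , Z h ⟩ ≤ H * a k
      cs = subst₂ _≤_ (cong (λ z → z * z) (sumS-cong (λ S → trans (ring 3 (λ h l z → h :* (l :* z) := (l :* h) :* z) refl (h S)
          (lev k S) (Z h S)) (cong (_* Z h S) (Supp-lev s S)))))
        (cong (H *_) (u-norm k)) (cauchy-schwarz h (u k))

  -- Projection onto linear functions

  -- The degree vector: entry a is the sum of φ over the sets containing a. Adding the two slices
  -- forgets the first point before the others are treated.
  deg : ∀ {n} → (Subset n → ℚ) → Vec ℚ n
  deg {zero} φ = []
  deg {suc n} φ = sumS (λ S → φ (true ∷ S)) ∷ deg (λ S → φ (true ∷ S) + φ (false ∷ S))

  ⟨⟩-wt : ∀ {n} (φ : Subset n → ℚ) c → ⟨ φ , wt c ⟩ ≡ dot (deg φ) c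
  ⟨⟩-wt φ [] = trans (sumS-[] _) (zeroʳ _)
  ⟨⟩-wt {suc n} φ (c ∷ cs) = trans (sumS-∷ _) (trans (cong (_+ ⟨ φ₀ , wt cs ⟩) split) (trans (+-assoc _ _ _)
      (cong₂ _+_ (*-comm c _) (trans (sym (⟨⟩-+ˡ (wt cs) φ₁ φ₀)) (⟨⟩-wt (λ S → φ₁ S + φ₀ S) cs)))))
    where
    φ₀ φ₁ : Subset n → ℚ
    φ₀ S = φ (false ∷ S)
    φ₁ S = φ (true ∷ S)
    split : sumS (λ S → φ₁ S * (c + wt cs S)) ≡ c * sumS φ₁ + ⟨ φ₁ , wt cs ⟩
    split = trans (sumS-cong (λ S → ring 3 (λ p c w → p :* (c :+ w) := c :* p :+ p :* w) refl (φ₁ S) c (wt cs S)))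
        (trans (sumS-+ _ _) (cong (_+ ⟨ φ₁ , wt cs ⟩) (sumS-* c φ₁)))

  dot-ones : ∀ {n} (v : Vec ℚ n) → dot v (ones n) ≡ tot v
  dot-ones [] = refl
  dot-ones (x ∷ v) = cong₂ _+_ (*-identityʳ x) (dot-ones v)

  tot-affine : ∀ {n} r q (v : Vec ℚ n) → tot (map (λ x → r * (x - q)) v) ≡ r * (tot v - ι n * q)
  tot-affine r q [] = ring 2 (λ r q → # 0 := r :* (# 0 :- # 0 :* q)) refl r q
  tot-affine {suc n} r q (x ∷ v) = trans (cong (r * (x - q) +_) (tot-affine r q v))
    (trans (ring 5 (λ r q x t n → r :* (x :- q) :+ r :* (t :- n :* q) := r :* (x :+ t :- (# 1 :+ n) :* q)) refl r q x (tot v) (ι n))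
    (cong (λ z → r * (x + tot v - z * q)) (sym (ι-suc n))))

  dot-affine : ∀ {n} r q (v e : Vec ℚ n) → dot (map (λ x → r * (x - q)) v) e ≡ r * (dot v e - q * tot e)
  dot-affine r q [] [] = ring 2 (λ r q → # 0 := r :* (# 0 :- q :* # 0)) refl r q
  dot-affine r q (x ∷ v) (y ∷ e) = trans (cong (r * (x - q) * y +_) (dot-affine r q v e))
    (ring 6 (λ r q x y d t → r :* (x :- q) :* y :+ r :* (d :- q :* t) := r :* (x :* y :+ d :- q :* (y :+ t))) refl r q x y (dot v e)
        (tot e))

  0<bin : ∀ n k → k ≤ℕ n → 𝟘 < bin n k
  0<bin n zero p = 0<1
  0<bin (suc n) (suc k) (s≤s p) = 0<+ (0<bin n k p) (0≤bin n (suc k))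

  -- d + 1 plays the role of n − 2k.
  module Sizes {N k′ d : ℕ} (n≡ : suc (suc N) ≡ suc k′ +ℕ (suc k′ +ℕ suc d)) where

    n k : ℕ
    n = suc (suc N)
    k = suc k′

    -- Counts of k-sets: all; through one point; through one point and missing another; through an
    -- outside point and disjoint from a given k-set.
    Nb M K b : ℚ
    Nb = bin n k
    M = bin (suc N) k′
    K = bin N k′
    b = bin (k′ +ℕ suc d) k′

    k′≤N : k′ ≤ℕ N
    k′≤N = subst (k′ ≤ℕ_) (sym (ℕ.suc-injective (trans (ℕ.suc-injective n≡) (ℕ.+-suc k′ (k′ +ℕ suc d))))) (ℕ.m≤m+n k′ _)

    0<K : 𝟘 < K
    0<K = 0<bin N k′ k′≤N

    0<M : 𝟘 < M
    0<M = 0<bin (suc N) k′ (ℕ.m≤n⇒m≤1+n k′≤N)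

    0<b : 𝟘 < b
    0<b = 0<bin (k′ +ℕ suc d) k′ (ℕ.m≤m+n k′ (suc d))

    K-M : (ι (suc N) - ι k′) * M ≡ ι (suc N) * K
    K-M = bin-up N k′

    k*Nb : ι k * Nb ≡ ι n * M
    k*Nb = bin-absorb (suc N) k′

    ιn : ι n ≡ (𝟙 + ι k′) + ((𝟙 + ι k′) + ι (suc d))
    ιn = trans (cong ι n≡) (trans (ι-+ k (k +ℕ suc d)) (cong₂ _+_ (ι-suc k′)
        (trans (ι-+ k (suc d)) (cong (_+ ι (suc d)) (ι-suc k′)))))

  module Projection {N k′ d : ℕ} (n≡ : suc (suc N) ≡ suc k′ +ℕ (suc k′ +ℕ suc d)) (f : Subset (suc (suc N)) → ℚ)
    (f-Supp : Supp (suc k′) f) (f-bool : ∀ S → f S * f S ≡ f S) where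

    open Sizes n≡ public

    D : Vec ℚ n
    D = deg f

    -- The size of the family in units of a star; the hypothesis on the size makes it ℓ - α.
    s : ℚ
    s = proj₁ (recip M 0<M) * sumS f

    Ms : M * s ≡ sumS f
    Ms = trans (sym (*-assoc _ _ _)) (trans (cong (_* sumS f) (proj₂ (recip M 0<M))) (*-identityˡ _))

    -- By `sum-wt-wt`, orthogonality of the residue means K c_a + (M - K) `tot c` = D_a for every a.
    -- Summing over a gives `tot c` = s, which is already substituted here.
    c : Vec ℚ n
    c = map (λ x → proj₁ (recip K 0<K) * (x - (M - K) * s)) D

    K*r : ∀ x → K * (proj₁ (recip K 0<K) * x) ≡ x
    K*r x = trans (sym (*-assoc _ _ _)) (trans (cong (_* x) (proj₂ (recip K 0<K))) (*-identityˡ _))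

    tot-D : tot D ≡ ι k * (M * s)
    tot-D = trans (sym (dot-ones D)) (trans (sym (⟨⟩-wt f (ones n))) (trans
        (sumS-cong (λ S → trans (Supp-* f-Supp S (λ e → trans (wt-ones S) (cong ι e))) (*-comm _ _)))
      (trans (sumS-* (ι k) f) (cong (ι k *_) (sym Ms)))))

    tot-c : tot c ≡ s
    tot-c = *-cancel-≡ K 0<K (trans (cong (K *_) (tot-affine _ _ D)) (trans (K*r _)
        (trans (cong₂ (λ x y → x - y * ((M - K) * s)) (trans tot-D (cong (_* (M * s)) (ι-suc k′))) (ι-suc (suc N)))
       (trans (ring 5 (λ k n M K s → (# 1 :+ k) :* (M :* s) :- (# 1 :+ n) :* ((M :- K) :* s) := K :* s :+ s :*
           (n :* K :- (n :- k) :* M)) refl (ι k′) (ι (suc N)) M K s)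
        (trans (cong (λ x → K * s + s * (ι (suc N) * K - x)) K-M) (ring 3 (λ K s x → K :* s :+ s :* (x :- x) := K :* s) refl K s
            _))))))

    h : Subset n → ℚ
    h S = lev k S * (f S - wt c S)

    h-Supp : Supp k h
    h-Supp = lev-Supp k _

    h-Orth : Orth h
    h-Orth e = trans (sumS-cong (λ S → trans (ring 4 (λ l f w v → l :* (f :- w) :* v := (l :* f) :* v :- l :* (w :* v)) refl
        (lev k S) (f S) (wt c S) (wt e S))
        (cong (λ x → x * wt e S - lev k S * (wt c S * wt e S)) (Supp-lev f-Supp S))))
      (trans (sumS-sub _ _) (trans (cong₂ _-_ (⟨⟩-wt f e) (trans (sum-wt-wt k′ c e)
          (cong₂ _+_ (trans (cong (K *_) (dot-affine _ _ D e)) (K*r _)) (cong (λ x → (M - K) * (x * tot e)) tot-c))))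
        (ring 4 (λ x q s t → x :- ((x :- q :* s :* t) :+ q :* (s :* t)) := # 0) refl (dot D e) (M - K) s (tot e))))

    H : ℚ
    H = ⟨ h , h ⟩

    private module Sp = Spectral {n} {k′} {suc d} n≡ h h-Supp h-Orth

    g : Subset n → ℚ
    g S = lev k S * wt c S

    f≡g+h : ∀ S → f S ≡ g S + h S
    f≡g+h S = trans (sym (Supp-lev f-Supp S)) (ring 3 (λ l f w → l :* f := l :* w :+ l :* (f :- w)) refl (lev k S) (f S) (wt c S))

    h-g : ⟨ h , g ⟩ ≡ 𝟘
    h-g = trans (sumS-cong (λ S → Supp-* h-Supp S (λ e → trans (cong (_* wt c S) (lev-yes k S e)) (*-identityˡ _)))) (h-Orth c)

    norm-f : ⟨ f , f ⟩ ≡ M * s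
    norm-f = trans (sumS-cong f-bool) (sym Ms)

    norm-g+H : ⟨ g , g ⟩ + H ≡ M * s
    norm-g+H = trans (sym (trans (sumS-cong (λ S → trans (cong₂ _*_ (f≡g+h S) (f≡g+h S))
        (ring 2 (λ g h → (g :+ h) :* (g :+ h) := (# 1 :* (g :* g) :+ # 1 :* (h :* h)) :+ (# 1 :* (h :* g) :+ # 1 :* (h :* g))) refl
        (g S) (h S))))
        (trans (sumS-lin4 _ _ _ _ _ _ _ _) (trans (cong (λ x → (𝟙 * ⟨ g , g ⟩ + 𝟙 * H) + (𝟙 * x + 𝟙 * x)) h-g)
            (ring 2 (λ x y → (# 1 :* x :+ # 1 :* y) :+ (# 1 :* # 0 :+ # 1 :* # 0) := x :+ y) refl _ _))))) norm-f

    Zg : ∀ F → size F ≡ k → Z g F ≡ b * cwt c F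
    Zg F e = trans (Z-wt k′ c F) (cong (λ m → bin (m ∸ 1) k′ * cwt c F) (Sp.free-k F e))

    h-Zg : ⟨ h , Z g ⟩ ≡ 𝟘
    h-Zg = trans (sumS-cong (λ S → trans (Supp-* h-Supp S (Zg S)) (ring 3 (λ h b w → h :* (b :* w) := b :* (h :* w)) refl (h S) b
        (cwt c S))))
      (trans (sumS-* b _) (trans (cong (b *_) (Sp.h-cwt c)) (zeroʳ _)))

    g-Zg : ⟨ g , Z g ⟩ ≡ b * (s * (M * s) - ⟨ g , g ⟩)
    g-Zg = trans (sumS-cong (λ S → trans (Supp-* (lev-Supp k (wt c)) S (Zg S))
        (trans (cong (λ x → lev k S * wt c S * (b * x)) (cwt≡ S)) (trans
        (ring 4 (λ l w b s → l :* w :* (b :* (s :- w)) := b :* s :* (l :* w) :+ (:- b) :* (l :* w :* w)) refl (lev k S) (wt c S) b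
        s)
        (cong (λ x → b * s * (lev k S * wt c S) + (- b) * x) (trans (cong (λ x → x * wt c S * wt c S) (sym (lev-idem k S)))
            (ring 2 (λ l w → l :* l :* w :* w := (l :* w) :* (l :* w)) refl (lev k S) (wt c S))))))))
      (trans (sumS-lin (b * s) (- b) _ _) (trans (cong (λ x → b * s * x + (- b) * ⟨ g , g ⟩)
          (trans (sum-wt k′ c) (cong (M *_) tot-c))) (ring 4 (λ b s M x → b :* s :* (M :* s) :+ (:- b) :* x := b :*
          (s :* (M :* s) :- x)) refl b s M ⟨ g , g ⟩)))
      where
      cwt≡ : ∀ S → cwt c S ≡ s - wt c S
      cwt≡ S = trans (ring 2 (λ w v → v := (w :+ v) :- w) refl (wt c S) (cwt c S)) (cong (_- wt c S) (trans (wt+cwt c S) tot-c))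

    -- On level k, `Z` sends wt c to b(s - wt c), again linear, so the cross terms vanish and the
    -- linear part contributes b(s·Ms - ‖g‖²). Pythagoras then replaces ‖g‖² by Ms - H.
    energy : ⟨ f , Z f ⟩ ≡ b * (M * (s * s - s) + H) + ⟨ h , Z h ⟩
    energy = trans (sumS-cong (λ S → trans (cong₂ _*_ (f≡g+h S) (trans (Z-cong f≡g+h S) (Z-+ g h S)))
        (ring 4 (λ g h x y → (g :+ h) :* (x :+ y) := (# 1 :* (g :* x) :+ # 1 :* (g :* y)) :+ (# 1 :* (h :* x) :+ # 1 :* (h :* y)))
        refl (g S) (h S) (Z g S) (Z h S))))
      (trans (sumS-lin4 _ _ _ _ _ _ _ _) (trans (cong₂ (λ x y → (𝟙 * x + 𝟙 * ⟨ g , Z h ⟩) + (𝟙 * y + 𝟙 * ⟨ h , Z h ⟩)) g-Zg h-Zg)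
      (trans (cong (λ x → (𝟙 * (b * (s * (M * s) - ⟨ g , g ⟩)) + 𝟙 * x) + (𝟙 * 𝟘 + 𝟙 * ⟨ h , Z h ⟩))
          (trans (sym (Z-adjoint g h)) (trans (⟨⟩-comm _ _) h-Zg)))
      (trans (ring 5 (λ b Q x H z → (# 1 :* (b :* (Q :- x)) :+ # 1 :* # 0) :+ (# 1 :* # 0 :+ # 1 :* z) := b :* (Q :- (x :+ H) :+ H)
          :+ z) refl b (s * (M * s)) ⟨ g , g ⟩ H ⟨ h , Z h ⟩)
      (trans (cong (λ x → b * (s * (M * s) - x + H) + ⟨ h , Z h ⟩) norm-g+H)
          (ring 5 (λ b s M H z → b :* (s :* (M :* s) :- M :* s :+ H) :+ z := b :* (M :* (s :* s :- s) :+ H) :+ z) refl b s M H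
          _))))))

    energy-bound : ι (suc d) * (b * H) ≤ (ι k′ + ι (suc d)) * (⟨ f , Z f ⟩ - b * (M * (s * s - s)))
    energy-bound = ≤-cert _ (trans (cong (λ x → (ι k′ + ι (suc d)) * (x - b * (M * (s * s - s))) - ι (suc d) * (b * H)) energy)
      (ring 6 (λ k d b Q H z → (k :+ d) :* ((b :* (Q :+ H) :+ z) :- b :* Q) :- d :* (b :* H) := k :* b :* H :+ (k :+ d) :* z) refl
          (ι k′) (ι (suc d)) b (M * (s * s - s)) H ⟨ h , Z h ⟩)) Sp.spectral-lower

    -- With s = ℓ - α, s² - s = ℓ² - ℓ - (2ℓ-1)α + α², so the energy exceeds its linear part by at
    -- most bM(Δ - α²). Non-negativity of H gives the first claim; relaxing n - k - 1 to n gives the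
    -- second.
    stability : ∀ {ℓ α β} → s ≡ ℓ - α → ⟨ f , Z f ⟩ ≤ (ℓ * ℓ - ℓ + 𝟚 * β) * (M * b) →
      (𝟘 ≤ (𝟚 * ℓ - 𝟙) * α + 𝟚 * β) × (ι (suc d) * H ≤ ι n * (M * ((𝟚 * ℓ - 𝟙) * α + 𝟚 * β)))
    stability {ℓ} {α} {β} s≡ dp≤ = 0≤Δ , final
      where
      Δ q : ℚ
      Δ = (𝟚 * ℓ - 𝟙) * α + 𝟚 * β
      q = ι k′ + ι (suc d)
      0<q : 𝟘 < q
      0<q = subst (𝟘 <_) (+-comm _ _) (0<+ (0<ι-suc d) (0≤ι k′))
      scaled : b * (ι (suc d) * H) ≤ b * (q * (M * (Δ - α * α)))
      scaled = ℚ.≤-trans (ℚ.≤-reflexive (ring 3 (λ b d H → b :* (d :* H) := d :* (b :* H)) refl b (ι (suc d)) H))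
          (ℚ.≤-trans energy-bound
        (≤-cert _
          (trans (cong (λ s → b * (q * (M * (Δ - α * α))) - q * (⟨ f , Z f ⟩ - b * (M * (s * s - s)))) s≡)
          (ring 7 (λ b q M l a be z → b :* (q :* (M :* (((# 2 :* l :- # 1) :* a :+ # 2 :* be) :- a :* a))) :- q :*
              (z :- b :* (M :* ((l :- a) :* (l :- a) :- (l :- a))))
              := q :* ((l :* l :- l :+ # 2 :* be) :* (M :* b) :- z)) refl b q M ℓ α β ⟨ f , Z f ⟩))
          (0≤* (ℚ.<⇒≤ 0<q) (0≤- dp≤))))
      base : ι (suc d) * H ≤ q * (M * (Δ - α * α))
      base = *-cancel-≤ b 0<b scaled
      0≤Δ-αα : 𝟘 ≤ Δ - α * α
      0≤Δ-αα = *-cancel-≤ (q * M) (0<* 0<q 0<M) (ℚ.≤-trans (ℚ.≤-reflexive (zeroʳ _))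
          (ℚ.≤-trans (0≤* (0≤ι (suc d)) (0≤⟨⟩ h)) (subst (ι (suc d) * H ≤_) (sym (*-assoc q M (Δ - α * α))) base)))
      0≤Δ : 𝟘 ≤ Δ
      0≤Δ = subst (𝟘 ≤_) (ring 2 (λ D x → D :- x :+ x := D) refl Δ (α * α)) (0≤+ 0≤Δ-αα (0≤sq α))
      final : ι (suc d) * H ≤ ι n * (M * Δ)
      final = ℚ.≤-trans base (≤-cert _
         (ring 5 (λ n q M D a → n :* (M :* D) :- q :* (M :* (D :- a)) := (n :- q) :* (M :* D) :+ q :* M :* a) refl (ι n) q M Δ
             (α * α))
         (0≤+ (0≤* (subst (𝟘 ≤_) (sym (trans (cong (_- q) ιn) (ring 2 (λ k d → (# 1 :+ k) :+ ((# 1 :+ k) :+ d) :- (k :+ d) := # 2 :+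
             k) refl (ι k′) (ι (suc d))))) (0≤+ (0≤ι 2) (0≤ι k′))) (0≤* (ℚ.<⇒≤ 0<M) 0≤Δ))
           (0≤* (0≤* (ℚ.<⇒≤ 0<q) (ℚ.<⇒≤ 0<M)) (0≤sq α))))

  -- A smooth substitute for the squared distance to the nearest integer

  opaque
    unfolding _+_

    clear-denominator : ∀ x → x * ζ (ℚ.↧ x) ≡ ζ (ℚ.↥ x)
    clear-denominator x = ℚ.toℚᵘ-injective (ℚᵘ.≃-trans (ℚ.toℚᵘ-homo-* x (ζ (ℚ.↧ x)))
        (ℚᵘ.≃-trans (ℚᵘ.*-cong (ℚᵘ.≃-refl {toℚᵘ x}) (toℚᵘ-ζ (ℚ.↧ x)))
       (ℚᵘ.≃-trans (lem x) (ℚᵘ.≃-sym (toℚᵘ-ζ (ℚ.↥ x))))))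
      where
      lem : ∀ x → toℚᵘ x ℚᵘ.* ℚᵘ.mkℚᵘ (ℚ.↧ x) 0 ℚᵘ.≃ ℚᵘ.mkℚᵘ (ℚ.↥ x) 0
      lem (ℚ.mkℚ p q _) = ℚᵘ.*≡* (trans (ℤ.*-identityʳ _) (cong (p ℤ.*_) (cong ℤ.+_ (sym (ℕ.*-identityʳ (suc q))))))

  -- For x = p/q this is the floor of (2p + q)/(2q), that is of x + 1/2.
  nearest : ℚ → ℤ
  nearest x = (ℤ.+ 2 ℤ.* ℚ.↥ x ℤ.+ ℚ.↧ x) ℤ./ℕ (2 *ℕ ℚ.↧ₙ x)

  rem : ℚ → ℚ
  rem x = x - ζ (nearest x)

  rem-small : ∀ x → ι 4 * (rem x * rem x) ≤ 𝟙
  rem-small x@(ℚ.mkℚ p q _) = *-cancel-≤ (D * D) (0<* (0<ι-suc q) (0<ι-suc q)) (≤-cert _ eq (0≤* (0≤ι r) (0≤- r≤)))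
    where
    D : ℚ
    D = ι (suc q)
    a : ℤ
    a = ℤ.+ 2 ℤ.* p ℤ.+ ℤ.+ suc q
    r : ℕ
    r = a ℤ.%ℕ (2 *ℕ suc q)
    z : ℤ
    z = nearest x
    r≤ : ι r ≤ 𝟚 * D
    r≤ = subst (ι r ≤_) (ι-* 2 (suc q)) (ι-mono (ℕ.<⇒≤ (ℤ.n%ℕd<d a (2 *ℕ suc q))))
    euclid : 𝟚 * ζ p + D ≡ ι r + ζ z * (𝟚 * D)
    euclid = trans (sym (trans (ζ-+ (ℤ.+ 2 ℤ.* p) (ℤ.+ suc q)) (cong (_+ D) (ζ-* (ℤ.+ 2) p))))
      (trans (cong ζ (ℤ.a≡a%ℕn+[a/ℕn]*n a (2 *ℕ suc q))) (trans (ζ-+ _ _)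
          (cong (ι r +_) (trans (ζ-* z _) (cong (ζ z *_) (ι-* 2 (suc q)))))))
    -- The Euclidean remainder r lies in [0, 2q], and r - q is 2q times `rem x`.
    key : ι r - D ≡ 𝟚 * (D * rem x)
    key = trans (ring 3 (λ r D w → r :- D := (r :+ w) :- D :- w) refl (ι r) D (ζ z * (𝟚 * D)))
        (trans (cong (λ t → t - D - ζ z * (𝟚 * D)) (sym euclid))
      (trans (ring 3 (λ p D z → (# 2 :* p :+ D) :- D :- z :* (# 2 :* D) := # 2 :* (p :- D :* z)) refl (ζ p) D (ζ z))
      (trans (cong (λ t → 𝟚 * (t - D * ζ z)) (sym (clear-denominator x)))
          (ring 3 (λ x D z → # 2 :* (x :* D :- D :* z) := # 2 :* (D :* (x :- z))) refl x D (ζ z)))))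
    eq : D * D * 𝟙 - D * D * (ι 4 * (rem x * rem x)) ≡ ι r * (𝟚 * D - ι r)
    eq = trans (ring 2 (λ D e → D :* D :* # 1 :- D :* D :* (# 4 :* (e :* e)) := D :* D :- (# 2 :* (D :* e)) :* (# 2 :* (D :* e)))
        refl D (rem x))
      (trans (cong (λ t → D * D - t * t) (sym key)) (ring 2 (λ D r → D :* D :- (r :- D) :* (r :- D) := r :* (# 2 :* D :- r)) refl D
          (ι r)))

  -- The derivative of x² − 2x⁴ vanishes at 1/2, so its 1-periodic extension ψ has no kink and
  -- satisfies the parallelogram law up to a product error term.
  quartic : ℚ → ℚ
  quartic x = x * x - 𝟚 * (x * x * (x * x))

  Half : ℚ → Set
  Half r = ι 4 * (r * r) ≤ 𝟙

  half-bounds : ∀ {r} → Half r → (𝟘 ≤ 𝟙 + 𝟚 * r) × (𝟘 ≤ 𝟙 - 𝟚 * r)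
  half-bounds {r} p = sq-abs (0≤ι 1) (ℚ.≤-trans (ℚ.≤-reflexive (ring 1 (λ r → (# 2 :* r) :* (# 2 :* r) := # 4 :* (r :* r)) refl r))
      (ℚ.≤-trans p (ℚ.≤-reflexive (sym (*-identityʳ 𝟙)))))
    , sq-abs (0≤ι 1) (ℚ.≤-trans (ℚ.≤-reflexive (ring 1 (λ r → (:- (# 2 :* r)) :* (:- (# 2 :* r)) := # 4 :* (r :* r)) refl r))
        (ℚ.≤-trans p (ℚ.≤-reflexive (sym (*-identityʳ 𝟙)))))

  1≤ι-suc : ∀ m → 𝟙 ≤ ι (suc m)
  1≤ι-suc m = ι-mono (s≤s z≤n)

  ζ-neg-suc : ∀ m → ζ (ℤ.-[1+ m ]) ≡ - ι (suc m)
  ζ-neg-suc m = ζ-neg (ℤ.+ suc m)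

  shift-sq : ∀ {r} z → Half r → r * r ≤ (r + ζ z) * (r + ζ z)
  shift-sq {r} (ℤ.+ zero) p = ℚ.≤-reflexive (ring 1 (λ r → r :* r := (r :+ # 0) :* (r :+ # 0)) refl r)
  shift-sq {r} (ℤ.+ suc m) p = ≤-cert _ (ring 2 (λ r w → (r :+ w) :* (r :+ w) :- r :* r := w :* ((w :- # 1) :+ (# 1 :+ # 2 :* r)))
      refl r w)
      (0≤* (0≤ι _) (0≤+ (0≤- (1≤ι-suc m)) (proj₁ (half-bounds p))))
    where
    w : ℚ
    w = ι (suc m)
  shift-sq {r} (ℤ.-[1+ m ]) p = subst (λ t → r * r ≤ (r + t) * (r + t)) (sym (ζ-neg-suc m))
      (≤-cert _ (ring 2 (λ r w → (r :+ (:- w)) :* (r :+ (:- w)) :- r :* r := w :* ((w :- # 1) :+ (# 1 :- # 2 :* r))) refl r w)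
      (0≤* (0≤ι _) (0≤+ (0≤- (1≤ι-suc m)) (proj₂ (half-bounds p)))))
    where
    w : ℚ
    w = ι (suc m)

  ζ-sq : ∀ z → z ≢ ℤ.+ 0 → 𝟙 ≤ ζ z * ζ z
  ζ-sq (ℤ.+ zero) p = ⊥-elim (p refl)
  ζ-sq (ℤ.+ suc m) p = ≤-cert _ (ring 1 (λ w → w :* w :- # 1 := (w :- # 1) :* (w :- # 1) :+ # 2 :* (w :- # 1)) refl w)
      (0≤+ (0≤sq _) (0≤* (0≤ι 2) (0≤- (1≤ι-suc m))))
    where
    w : ℚ
    w = ι (suc m)
  ζ-sq (ℤ.-[1+ m ]) p = subst (λ t → 𝟙 ≤ t * t) (sym (ζ-neg-suc m)) (≤-cert _
      (ring 1 (λ w → (:- w) :* (:- w) :- # 1 := (w :- # 1) :* (w :- # 1) :+ # 2 :* (w :- # 1)) refl w)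
      (0≤+ (0≤sq _) (0≤* (0≤ι 2) (0≤- (1≤ι-suc m)))))
    where
    w : ℚ
    w = ι (suc m)

  -- The difference factors as ((r+z)² - r²)((z² - 1) + (2r+z)²), both factors being non-negative
  -- for |r| ≤ 1/2 and z ≠ 0. Hence ψ x is the maximum of `quartic` over x + ℤ, and a lower bound
  -- for ψ may use any integer shift.
  quartic-shift : ∀ {r} z → Half r → quartic (r + ζ z) ≤ quartic r
  quartic-shift {r} z p with z ℤ.≟ ℤ.+ 0
  ... | yes refl = ℚ.≤-reflexive (cong quartic (+-identityʳ r))
  ... | no z≢0 = ≤-cert _
      (ring 2 (λ r z → (r :* r :- # 2 :* (r :* r :* (r :* r))) :- ((r :+ z) :* (r :+ z) :- # 2 :*
          ((r :+ z) :* (r :+ z) :* ((r :+ z) :* (r :+ z))))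
         := ((r :+ z) :* (r :+ z) :- r :* r) :* ((z :* z :- # 1) :+ (r :+ r :+ z) :* (r :+ r :+ z))) refl r (ζ z))
      (0≤* (0≤- (shift-sq z p)) (0≤+ (0≤- (ζ-sq z z≢0)) (0≤sq _)))

  ψ : ℚ → ℚ
  ψ x = quartic (rem x)

  rem-shift : ∀ x z → x - ζ z ≡ rem x + ζ (nearest x ℤ.- z)
  rem-shift x z = trans (ring 3 (λ x y z → x :- z := (x :- y) :+ (y :- z)) refl x (ζ (nearest x)) (ζ z))
      (cong (rem x +_) (sym (ζ-- (nearest x) z)))

  quartic≤ψ : ∀ x z → quartic (x - ζ z) ≤ ψ x
  quartic≤ψ x z = subst (λ t → quartic t ≤ ψ x) (sym (rem-shift x z)) (quartic-shift (nearest x ℤ.- z) (rem-small x))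

  rem-nearest : ∀ x z → rem x * rem x ≤ (x - ζ z) * (x - ζ z)
  rem-nearest x z = subst (λ t → rem x * rem x ≤ t * t) (sym (rem-shift x z)) (shift-sq (nearest x ℤ.- z) (rem-small x))

  ψ≤ : ∀ x z → ψ x ≤ (x - ζ z) * (x - ζ z)
  ψ≤ x z = ℚ.≤-trans (≤-cert _ (ring 1 (λ r → r :- (r :- # 2 :* (r :* r)) := # 2 :* (r :* r)) refl (rem x * rem x))
      (0≤* (0≤ι 2) (0≤sq _))) (rem-nearest x z)

  rem≤ψ : ∀ x → rem x * rem x ≤ 𝟚 * ψ x
  rem≤ψ x = ≤-cert _ (ring 1 (λ r → # 2 :* (r :- # 2 :* (r :* r)) :- r := r :* (# 1 :- # 4 :* r)) refl (rem x * rem x))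
      (0≤* (0≤sq _) (0≤- (rem-small x)))

  0≤ψ : ∀ x → 𝟘 ≤ ψ x
  0≤ψ x = *-cancel-≤ 𝟚 (0<ι-suc 1) (ℚ.≤-trans (ℚ.≤-reflexive (zeroʳ 𝟚)) (ℚ.≤-trans (0≤sq (rem x)) (rem≤ψ x)))

  ψ0 : ψ 𝟘 ≡ 𝟘
  ψ0 = ℚ.≤-antisym (ℚ.≤-trans (ψ≤ 𝟘 (ℤ.+ 0)) (ℚ.≤-reflexive (ring 0 ((# 0 :- # 0) :* (# 0 :- # 0) := # 0) refl))) (0≤ψ 𝟘)

  -- For remainders a and b the quartic has defect exactly 24a²b², and a² ≤ 2ψ x, b² ≤ 2ψ y turn 24
  -- into 96. By `quartic≤ψ` the sum and difference of the nearest integers serve as shifts for x +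
  -- y and x - y.
  ψ-parallelogram : ∀ x y → 𝟚 * ψ x + 𝟚 * ψ y - ι 96 * (ψ x * ψ y) ≤ ψ (x + y) + ψ (x - y)
  ψ-parallelogram x y = ℚ.≤-trans (≤-cert _
      (ring 2 (λ a b → ((a :+ b) :* (a :+ b) :- # 2 :* ((a :+ b) :* (a :+ b) :* ((a :+ b) :* (a :+ b))) :+
          ((a :- b) :* (a :- b) :- # 2 :* ((a :- b) :* (a :- b) :* ((a :- b) :* (a :- b))))) :-
           (# 2 :* (a :* a :- # 2 :* (a :* a :* (a :* a))) :+ # 2 :* (b :* b :- # 2 :* (b :* b :* (b :* b))) :- # 96 :*
               ((a :* a :- # 2 :* (a :* a :* (a :* a))) :* (b :* b :- # 2 :* (b :* b :* (b :* b)))))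
         := # 24 :* ((# 2 :* (a :* a :- # 2 :* (a :* a :* (a :* a))) :- a :* a) :* (# 2 :* (b :* b :- # 2 :* (b :* b :* (b :* b))))
             :+ (a :* a) :* (# 2 :* (b :* b :- # 2 :* (b :* b :* (b :* b))) :- b :* b))) refl a b)
      (0≤* (0≤ι 24) (0≤+ (0≤* (0≤- (rem≤ψ x)) (0≤* (0≤ι 2) (0≤ψ y))) (0≤* (0≤sq a) (0≤- (rem≤ψ y))))))
    (+-mono-≤ (subst (λ t → quartic t ≤ ψ (x + y)) (trans (cong (λ t → x + y - t) (ζ-+ (nearest x) (nearest y)))
        (ring 4 (λ x y u v → x :+ y :- (u :+ v) := (x :- u) :+ (y :- v)) refl x y _ _))
        (quartic≤ψ (x + y) (nearest x ℤ.+ nearest y)))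
      (subst (λ t → quartic t ≤ ψ (x - y)) (trans (cong (λ t → x - y - t) (ζ-- (nearest x) (nearest y)))
          (ring 4 (λ x y u v → x :- y :- (u :- v) := (x :- u) :- (y :- v)) refl x y _ _))
          (quartic≤ψ (x - y) (nearest x ℤ.- nearest y))))
    where
    a b : ℚ
    a = rem x
    b = rem y

  -- Partial colourings: nothing marks a free element.

  data Mark : Set where
    mA mB mE : Mark

  Colouring : ℕ → Set
  Colouring n = Vec (Maybe Mark) n

  Op : ℕ → Set
  Op n = (Colouring n → ℚ) → Colouring n → ℚ

  ν : ∀ {n} → Colouring n → ℕ
  ν [] = 0
  ν (nothing ∷ κ) = suc (ν κ)
  ν (just _ ∷ κ) = ν κ

  -- The sum of Θ over all ways to give one free element the mark m.
  raise : ∀ {n} → Mark → Op n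
  raise m Θ [] = 𝟘
  raise m Θ (nothing ∷ κ) = Θ (just m ∷ κ) + raise m (λ κ → Θ (nothing ∷ κ)) κ
  raise m Θ (just x ∷ κ) = raise m (λ κ → Θ (just x ∷ κ)) κ

  raise-≤ : ∀ {n} m {Θ Θ′ : Colouring n → ℚ} κ → (∀ κ′ → suc (ν κ′) ≡ ν κ → Θ κ′ ≤ Θ′ κ′) → raise m Θ κ ≤ raise m Θ′ κ
  raise-≤ m [] e = ℚ.≤-refl
  raise-≤ m (nothing ∷ κ) e = +-mono-≤ (e (just m ∷ κ) refl) (raise-≤ m κ (λ κ′ p → e (nothing ∷ κ′) (cong suc p)))
  raise-≤ m (just x ∷ κ) e = raise-≤ m κ (λ κ′ p → e (just x ∷ κ′) p)

  raise-local : ∀ {n} m {Θ Θ′ : Colouring n → ℚ} κ → (∀ κ′ → suc (ν κ′) ≡ ν κ → Θ κ′ ≡ Θ′ κ′) → raise m Θ κ ≡ raise m Θ′ κ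
  raise-local m κ e = ℚ.≤-antisym (raise-≤ m κ (λ κ′ p → ℚ.≤-reflexive (e κ′ p)))
      (raise-≤ m κ (λ κ′ p → ℚ.≤-reflexive (sym (e κ′ p))))

  raise-cong : ∀ {n} m {Θ Θ′ : Colouring n → ℚ} → (∀ κ → Θ κ ≡ Θ′ κ) → ∀ κ → raise m Θ κ ≡ raise m Θ′ κ
  raise-cong m e κ = raise-local m κ (λ κ′ _ → e κ′)

  raise-+ : ∀ {n} m (Θ Θ′ : Colouring n → ℚ) κ → raise m (λ κ → Θ κ + Θ′ κ) κ ≡ raise m Θ κ + raise m Θ′ κ
  raise-+ m Θ Θ′ [] = sym (+-identityʳ 𝟘)
  raise-+ m Θ Θ′ (nothing ∷ κ) = trans (cong (Θ (just m ∷ κ) + Θ′ (just m ∷ κ) +_) (raise-+ m _ _ κ)) (interchange _ _ _ _)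
  raise-+ m Θ Θ′ (just x ∷ κ) = raise-+ m _ _ κ

  raise-* : ∀ {n} m a (Θ : Colouring n → ℚ) κ → raise m (λ κ → a * Θ κ) κ ≡ a * raise m Θ κ
  raise-* m a Θ [] = sym (zeroʳ a)
  raise-* m a Θ (nothing ∷ κ) = trans (cong (a * Θ (just m ∷ κ) +_) (raise-* m a _ κ)) (sym (distribˡ a _ _))
  raise-* m a Θ (just x ∷ κ) = raise-* m a _ κ

  raise-comm : ∀ {n} m m′ (Θ : Colouring n → ℚ) κ → raise m (raise m′ Θ) κ ≡ raise m′ (raise m Θ) κ
  raise-comm m m′ Θ [] = refl
  raise-comm m m′ Θ (nothing ∷ κ) = trans (cong (raise m′ (λ κ → Θ (just m ∷ κ)) κ +_)
      (trans (raise-+ m _ _ κ) (cong (raise m (λ κ → Θ (just m′ ∷ κ)) κ +_) (raise-comm m m′ _ κ))))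
    (trans (ring 3 (λ a b c → a :+ (b :+ c) := b :+ (a :+ c)) refl _ _ _)
        (cong (raise m (λ κ → Θ (just m′ ∷ κ)) κ +_) (sym (raise-+ m′ _ _ κ))))
  raise-comm m m′ Θ (just x ∷ κ) = raise-comm m m′ _ κ

  raise-const : ∀ {n} m a (κ : Colouring n) → raise m (λ _ → a) κ ≡ ι (ν κ) * a
  raise-const m a [] = sym (zeroˡ a)
  raise-const m a (nothing ∷ κ) = trans (cong (a +_) (raise-const m a κ))
      (trans (ring 2 (λ a v → a :+ v :* a := (# 1 :+ v) :* a) refl a _) (cong (_* a) (sym (ι-suc (ν κ)))))
  raise-const m a (just x ∷ κ) = raise-const m a κ

  iter : ∀ {A : Set} → ℕ → (A → A) → A → A
  iter zero F x = x
  iter (suc j) F x = F (iter j F x)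

  raises : ∀ {n} → Mark → ℕ → Op n
  raises m j Θ = iter j (raise m) Θ

  raises-≤ : ∀ {n} m j {Θ Θ′ : Colouring n → ℚ} κ → (∀ κ′ → j +ℕ ν κ′ ≡ ν κ → Θ κ′ ≤ Θ′ κ′) → raises m j Θ κ ≤ raises m j Θ′ κ
  raises-≤ m zero κ e = e κ refl
  raises-≤ m (suc j) κ e = raise-≤ m κ (λ κ₁ p → raises-≤ m j κ₁ (λ κ′ q → e κ′ (trans (cong suc q) p)))

  raises-local : ∀ {n} m j {Θ Θ′ : Colouring n → ℚ} κ → (∀ κ′ → j +ℕ ν κ′ ≡ ν κ → Θ κ′ ≡ Θ′ κ′) → raises m j Θ κ ≡ raises m j Θ′ κ
  raises-local m j κ e = ℚ.≤-antisym (raises-≤ m j κ (λ κ′ p → ℚ.≤-reflexive (e κ′ p)))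
      (raises-≤ m j κ (λ κ′ p → ℚ.≤-reflexive (sym (e κ′ p))))

  raises-* : ∀ {n} m j a (Θ : Colouring n → ℚ) κ → raises m j (λ κ → a * Θ κ) κ ≡ a * raises m j Θ κ
  raises-* m zero a Θ κ = refl
  raises-* m (suc j) a Θ κ = trans (raise-cong m (raises-* m j a Θ) κ) (raise-* m a _ κ)

  raise-raises : ∀ {n} m m′ j (Θ : Colouring n → ℚ) κ → raise m (raises m′ j Θ) κ ≡ raises m′ j (raise m Θ) κ
  raise-raises m m′ zero Θ κ = refl
  raise-raises m m′ (suc j) Θ κ = trans (raise-comm m m′ _ κ) (raise-cong m′ (raise-raises m m′ j Θ) κ)

  raises-comm : ∀ {n} m m′ i j (Θ : Colouring n → ℚ) κ → raises m i (raises m′ j Θ) κ ≡ raises m′ j (raises m i Θ) κ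
  raises-comm m m′ zero j Θ κ = refl
  raises-comm m m′ (suc i) j Θ κ = trans (raise-cong m (raises-comm m m′ i j Θ) κ) (raise-raises m m′ j _ κ)

  P : ∀ {n} → Op n
  P Θ = raise mA (raise mB Θ)

  P-≤ : ∀ {n} {Θ Θ′ : Colouring n → ℚ} κ → (∀ κ′ → 2 +ℕ ν κ′ ≡ ν κ → Θ κ′ ≤ Θ′ κ′) → P Θ κ ≤ P Θ′ κ
  P-≤ κ e = raise-≤ mA κ (λ κ₁ p → raise-≤ mB κ₁ (λ κ₂ q → e κ₂ (trans (cong suc q) p)))

  P-cong : ∀ {n} {Θ Θ′ : Colouring n → ℚ} → (∀ κ → Θ κ ≡ Θ′ κ) → ∀ κ → P Θ κ ≡ P Θ′ κ
  P-cong e = raise-cong mA (raise-cong mB e)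

  Ps-≤ : ∀ {n} j {Θ Θ′ : Colouring n → ℚ} κ → (∀ κ′ → (j +ℕ j) +ℕ ν κ′ ≡ ν κ → Θ κ′ ≤ Θ′ κ′) → iter j P Θ κ ≤ iter j P Θ′ κ
  Ps-≤ zero κ e = e κ refl
  Ps-≤ (suc j) κ e = P-≤ κ (λ κ₁ p → Ps-≤ j κ₁ (λ κ′ q → e κ′ (trans (cong (λ t → suc (t +ℕ ν κ′)) (ℕ.+-suc j j))
      (trans (cong (λ t → suc (suc t)) q) p))))

  Ps-local : ∀ {n} j {Θ Θ′ : Colouring n → ℚ} κ → (∀ κ′ → (j +ℕ j) +ℕ ν κ′ ≡ ν κ → Θ κ′ ≡ Θ′ κ′) → iter j P Θ κ ≡ iter j P Θ′ κ
  Ps-local j κ e = ℚ.≤-antisym (Ps-≤ j κ (λ κ′ p → ℚ.≤-reflexive (e κ′ p))) (Ps-≤ j κ (λ κ′ p → ℚ.≤-reflexive (sym (e κ′ p))))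

  Ps-lin : ∀ {n} j a b (Θ Θ′ : Colouring n → ℚ) κ → iter j P (λ κ → a * Θ κ + b * Θ′ κ) κ ≡ a * iter j P Θ κ + b * iter j P Θ′ κ
  Ps-lin zero a b Θ Θ′ κ = refl
  Ps-lin {n} (suc j) a b Θ Θ′ κ = trans (P-cong (Ps-lin j a b Θ Θ′) κ) (trans
      (raise-cong mA (raise-lin mB {iter j P Θ} {iter j P Θ′}) κ) (raise-lin mA {raise mB (iter j P Θ)} {raise mB (iter j P Θ′)} κ))
    where
    raise-lin : ∀ m {Θ Θ′ : Colouring n → ℚ} κ → raise m (λ κ → a * Θ κ + b * Θ′ κ) κ ≡ a * raise m Θ κ + b * raise m Θ′ κ
    raise-lin m {Θ} {Θ′} κ = trans (raise-+ m _ _ κ) (cong₂ _+_ (raise-* m a Θ κ) (raise-* m b Θ′ κ))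

  Ps-shift : ∀ {n} j (Θ : Colouring n → ℚ) κ → iter (suc j) P Θ κ ≡ iter j P (P Θ) κ
  Ps-shift zero Θ κ = refl
  Ps-shift (suc j) Θ κ = P-cong (Ps-shift j Θ) κ

  Ps-split : ∀ {n} j (Θ : Colouring n → ℚ) κ → iter j P Θ κ ≡ raises mA j (raises mB j Θ) κ
  Ps-split zero Θ κ = refl
  Ps-split (suc j) Θ κ = trans (P-cong (Ps-split j Θ) κ) (raise-cong mA (raise-raises mB mA j _) κ)

  -- Counting ordered configurations

  blank : ∀ n → Colouring n
  blank n = replicate n nothing

  ν-blank : ∀ n → ν (blank n) ≡ n
  ν-blank zero = refl
  ν-blank (suc n) = cong suc (ν-blank n)

  -- Falling factorials rather than binomials, because iterated `raise` chooses its points in order.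
  fall : ℕ → ℕ → ℚ
  fall v zero = 𝟙
  fall v (suc i) = ι v * fall (v ∸ 1) i

  fall-+ : ∀ v a b → fall v (a +ℕ b) ≡ fall v a * fall (v ∸ a) b
  fall-+ v zero b = sym (*-identityˡ _)
  fall-+ v (suc a) b = trans (cong (ι v *_) (trans (fall-+ (v ∸ 1) a b) (cong (λ t → fall (v ∸ 1) a * fall t b)
      (ℕ.∸-+-assoc v 1 a)))) (sym (*-assoc _ _ _))

  0<fall : ∀ v i → i ≤ℕ v → 𝟘 < fall v i
  0<fall v zero p = 0<1
  0<fall (suc v) (suc i) (s≤s p) = 0<* (0<ι-suc v) (0<fall v i p)

  fact : ℕ → ℚ
  fact zero = 𝟙
  fact (suc k) = ι (suc k) * fact k

  0<fact : ∀ k → 𝟘 < fact k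
  0<fact zero = 0<1
  0<fact (suc k) = 0<* (0<ι-suc k) (0<fact k)

  fall-bin : ∀ n k → fall n k ≡ fact k * bin n k
  fall-bin n zero = sym (*-identityˡ 𝟙)
  fall-bin zero (suc k) = trans (zeroˡ _) (sym (zeroʳ _))
  fall-bin (suc n) (suc k) = trans (cong (ι (suc n) *_) (fall-bin n k)) (trans
      (ring 3 (λ n f x → n :* (f :* x) := f :* (n :* x)) refl (ι (suc n)) (fact k) (bin n k))
    (trans (cong (fact k *_) (sym (bin-absorb n k))) (ring 3 (λ s f x → f :* (s :* x) := s :* f :* x) refl (ι (suc k)) (fact k) _)))

  -- If the mark does not affect Θ, every `raise` merely counts the free points, one fewer each
  -- time.
  raises-inv : ∀ {n} m (Θ : Colouring n → ℚ) → (∀ κ → raise m Θ κ ≡ ι (ν κ) * Θ κ) → ∀ i κ → raises m i Θ κ ≡ fall (ν κ) i * Θ κ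
  raises-inv m Θ inv zero κ = sym (*-identityˡ _)
  raises-inv m Θ inv (suc i) κ = trans (raise-local m κ (λ κ′ p → trans (raises-inv m Θ inv i κ′)
      (cong (λ t → fall t i * Θ κ′) (cong (_∸ 1) p))))
    (trans (raise-* m (fall (ν κ ∸ 1) i) Θ κ) (trans (cong (fall (ν κ ∸ 1) i *_) (inv κ))
        (ring 3 (λ f v t → f :* (v :* t) := v :* f :* t) refl _ _ _)))

  X : ∀ {n} → Vec ℚ n → Colouring n → ℚ
  X [] [] = 𝟘
  X (c ∷ cs) (just mA ∷ κ) = c + X cs κ
  X (c ∷ cs) (just mB ∷ κ) = (- c) + X cs κ
  X (c ∷ cs) (just mE ∷ κ) = X cs κ
  X (c ∷ cs) (nothing ∷ κ) = X cs κ

  select : ∀ {n} → (Mark → Bool) → Colouring n → Subset n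
  select χ [] = []
  select χ (nothing ∷ κ) = false ∷ select χ κ
  select χ (just m ∷ κ) = χ m ∷ select χ κ

  -- The sets A ∪ E and B ∪ E: the common part E pads both sides to size k and cancels in c(A) -
  -- c(B).
  χA χB : Mark → Bool
  χA mA = true
  χA mB = false
  χA mE = true
  χB mA = false
  χB mB = true
  χB mE = true

  X-select : ∀ {n} (c : Vec ℚ n) κ → X c κ ≡ wt c (select χA κ) - wt c (select χB κ)
  X-select [] [] = ring 0 (# 0 := # 0 :- # 0) refl
  X-select (c ∷ cs) (nothing ∷ κ) = X-select cs κ
  X-select (c ∷ cs) (just mA ∷ κ) = trans (cong (c +_) (X-select cs κ)) (ring 3 (λ c a b → c :+ (a :- b) := (c :+ a) :- b) refl c _
      _)
  X-select (c ∷ cs) (just mB ∷ κ) = trans (cong ((- c) +_) (X-select cs κ))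
      (ring 3 (λ c a b → (:- c) :+ (a :- b) := a :- (c :+ b)) refl c _ _)
  X-select (c ∷ cs) (just mE ∷ κ) = trans (X-select cs κ) (ring 3 (λ c a b → a :- b := (c :+ a) :- (c :+ b)) refl c _ _)

  raise-E-X : ∀ {n} (c : Vec ℚ n) (F : ℚ → ℚ) κ → raise mE (λ κ → F (X c κ)) κ ≡ ι (ν κ) * F (X c κ)
  raise-E-X [] F [] = sym (zeroˡ _)
  raise-E-X (c ∷ cs) F (nothing ∷ κ) = trans (cong (F (X cs κ) +_) (raise-E-X cs F κ))
      (trans (ring 2 (λ a v → a :+ v :* a := (# 1 :+ v) :* a) refl _ _) (cong (_* F (X cs κ)) (sym (ι-suc (ν κ)))))
  raise-E-X (c ∷ cs) F (just mA ∷ κ) = raise-E-X cs (λ x → F (c + x)) κ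
  raise-E-X (c ∷ cs) F (just mB ∷ κ) = raise-E-X cs (λ x → F ((- c) + x)) κ
  raise-E-X (c ∷ cs) F (just mE ∷ κ) = raise-E-X cs F κ

  raise-select-out : ∀ {n} χ m → χ m ≡ false → (Φ : Subset n → ℚ) → ∀ κ → raise m (λ κ → Φ (select χ κ)) κ ≡ ι (ν κ) * Φ
      (select χ κ)
  raise-select-out χ m e Φ [] = sym (zeroˡ _)
  raise-select-out χ m e Φ (nothing ∷ κ) = trans (cong₂ _+_ (cong (λ x → Φ (x ∷ select χ κ)) e)
      (raise-select-out χ m e (λ S → Φ (false ∷ S)) κ))
    (trans (ring 2 (λ a v → a :+ v :* a := (# 1 :+ v) :* a) refl _ _) (cong (_* Φ (false ∷ select χ κ)) (sym (ι-suc (ν κ)))))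
  raise-select-out χ m e Φ (just x ∷ κ) = raise-select-out χ m e (λ S → Φ (χ x ∷ S)) κ

  -- `∂` adds any unselected point, also one that carries a mark outside χ, whereas `raise` uses
  -- only free points. The extra terms are non-negative.
  raise-select-in : ∀ {n} χ m → χ m ≡ true → (Φ : Subset n → ℚ) → (∀ S → 𝟘 ≤ Φ S) → ∀ κ → raise m (λ κ → Φ (select χ κ)) κ ≤ ∂ Φ
      (select χ κ)
  raise-select-in χ m e Φ p [] = ℚ.≤-refl
  raise-select-in χ m e Φ p (nothing ∷ κ) = +-mono-≤ (ℚ.≤-reflexive (cong (λ x → Φ (x ∷ select χ κ)) e))
      (raise-select-in χ m e _ (λ S → p (false ∷ S)) κ)
  raise-select-in χ m e Φ p (just x ∷ κ) with χ x
  ... | true = raise-select-in χ m e (λ S → Φ (true ∷ S)) (λ S → p (true ∷ S)) κ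
  ... | false = ℚ.≤-trans (raise-select-in χ m e (λ S → Φ (false ∷ S)) (λ S → p (false ∷ S)) κ)
     (subst (_≤ Φ (true ∷ select χ κ) + ∂ (λ S → Φ (false ∷ S)) (select χ κ)) (+-identityˡ _) (+-mono-≤ (p _) ℚ.≤-refl))

  0≤∂ : ∀ {n} {Φ : Subset n → ℚ} → (∀ S → 𝟘 ≤ Φ S) → ∀ S → 𝟘 ≤ ∂ Φ S
  0≤∂ p [] = ℚ.≤-refl
  0≤∂ p (true ∷ S) = 0≤∂ (λ S → p (true ∷ S)) S
  0≤∂ p (false ∷ S) = 0≤+ (p (true ∷ S)) (0≤∂ (λ S → p (false ∷ S)) S)

  0≤∂s : ∀ {n} i {Φ : Subset n → ℚ} → (∀ S → 𝟘 ≤ Φ S) → ∀ S → 𝟘 ≤ iter i ∂ Φ S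
  0≤∂s zero p = p
  0≤∂s (suc i) p = 0≤∂ (0≤∂s i p)

  raises-select-in : ∀ {n} χ m → χ m ≡ true → ∀ i (Φ : Subset n → ℚ) → (∀ S → 𝟘 ≤ Φ S) → ∀ κ → raises m i (λ κ → Φ (select χ κ)) κ ≤
      iter i ∂ Φ (select χ κ)
  raises-select-in χ m e zero Φ p κ = ℚ.≤-refl
  raises-select-in χ m e (suc i) Φ p κ = ℚ.≤-trans (raise-≤ m κ (λ κ′ _ → raises-select-in χ m e i Φ p κ′))
      (raise-select-in χ m e (iter i ∂ Φ) (0≤∂s i p) κ)

  ∂ᵀ-lev : ∀ {n} k (S : Subset n) → ∂ᵀ (lev k) S ≡ ι (suc k) * lev (suc k) S
  ∂ᵀ-lev k [] = sym (zeroʳ _)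
  ∂ᵀ-lev zero (true ∷ S) = trans (cong (lev 0 S +_) (trans (∂ᵀ-const 𝟘 S) (zeroʳ _))) (trans (+-identityʳ _) (sym (*-identityˡ _)))
  ∂ᵀ-lev (suc k) (true ∷ S) = trans (cong (lev (suc k) S +_) (∂ᵀ-lev k S))
      (trans (ring 2 (λ l s → l :+ s :* l := (# 1 :+ s) :* l) refl _ _) (cong (_* lev (suc k) S) (sym (ι-suc (suc k)))))
  ∂ᵀ-lev zero (false ∷ S) = ∂ᵀ-lev zero S
  ∂ᵀ-lev (suc k) (false ∷ S) = ∂ᵀ-lev (suc k) S

  -- By adjointness each `∂` becomes a `∂ᵀ` on `lev m`, which climbs one level with the factor m +
  -- 1; the factorials collect these factors.
  lev-∂s : ∀ {n} i m (Φ : Subset n → ℚ) → fact m * ⟨ lev m , iter i ∂ Φ ⟩ ≡ fact (m +ℕ i) * ⟨ lev (m +ℕ i) , Φ ⟩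
  lev-∂s zero m Φ = cong (λ t → fact t * ⟨ lev t , Φ ⟩) (sym (ℕ.+-identityʳ m))
  lev-∂s (suc i) m Φ = trans (cong (fact m *_) (trans (⟨⟩-comm _ _) (trans (∂-adjoint (iter i ∂ Φ) (lev m))
      (trans (sumS-cong (λ S → trans (cong (iter i ∂ Φ S *_) (∂ᵀ-lev m S))
      (ring 3 (λ p s l → p :* (s :* l) := s :* (l :* p)) refl _ _ _))) (sumS-* (ι (suc m)) _)))))
    (trans (ring 3 (λ f s x → f :* (s :* x) := s :* f :* x) refl _ _ _) (trans (lev-∂s i (suc m) Φ)
        (cong (λ t → fact t * ⟨ lev t , Φ ⟩) (sym (ℕ.+-suc m i)))))

  lev0-sum : ∀ {n} (φ : Subset n → ℚ) → ⟨ lev 0 , φ ⟩ ≡ φ (none n)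
  lev0-sum {zero} φ = trans (sumS-[] _) (*-identityˡ _)
  lev0-sum {suc n} φ = trans (sumS-∷ _) (trans (cong₂ _+_ (trans (sumS-* 𝟘 _) (zeroˡ _)) (lev0-sum (λ S → φ (false ∷ S))))
      (+-identityˡ _))

  ∂s-none : ∀ {n} k (Φ : Subset n → ℚ) → iter k ∂ Φ (none n) ≡ fact k * ⟨ lev k , Φ ⟩
  ∂s-none k Φ = trans (sym (lev0-sum _)) (trans (sym (*-identityˡ _)) (lev-∂s k 0 Φ))

  select-blank : ∀ χ n → select χ (blank n) ≡ none n
  select-blank χ zero = refl
  select-blank χ (suc n) = cong (false ∷_) (select-blank χ n)

  iter-+ : ∀ {A : Set} i j (F : A → A) x → iter i F (iter j F x) ≡ iter (i +ℕ j) F x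
  iter-+ zero j F x = refl
  iter-+ (suc i) j F x = cong F (iter-+ i j F x)

  -- Marks p and E span the selected set; the marks q are dummies.
  configurations-≤ : ∀ {n} χ p q → χ p ≡ true → χ mE ≡ true → χ q ≡ false → ∀ j i (Φ : Subset n → ℚ) → (∀ S → 𝟘 ≤ Φ S) →
    raises p j (raises q j (raises mE i (λ κ → Φ (select χ κ)))) (blank n) ≤ fall (n ∸ (j +ℕ i)) j *
        (fact (j +ℕ i) * ⟨ lev (j +ℕ i) , Φ ⟩)
  configurations-≤ {n} χ p q χp χE χq j i Φ pos = ℚ.≤-trans (ℚ.≤-reflexive
      (trans reorder (trans count (trans (raises-local p j (blank n) (λ κ _ → raises-* mE i f _ κ)) (raises-* p j f _ (blank n))))))
      (*-monoˡ f 0≤f (ℚ.≤-trans (raises-≤ p j (blank n) (λ κ _ → raises-select-in χ mE χE i Φ pos κ))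
          (ℚ.≤-trans (raises-select-in χ p χp j (iter i ∂ Φ) (0≤∂s i pos) (blank n))
        (ℚ.≤-reflexive (trans (cong₂ (λ G S → G S) (iter-+ j i ∂ Φ) (select-blank χ n)) (∂s-none (j +ℕ i) Φ))))))
    where
    f : ℚ
    f = fall (n ∸ (j +ℕ i)) j
    0≤fall : ∀ v i → 𝟘 ≤ fall v i
    0≤fall v zero = 0≤ι 1
    0≤fall v (suc i) = 0≤* (0≤ι v) (0≤fall (v ∸ 1) i)
    0≤f : 𝟘 ≤ f
    0≤f = 0≤fall (n ∸ (j +ℕ i)) j
    Φ∘ : Colouring n → ℚ
    Φ∘ κ = Φ (select χ κ)
    reorder : raises p j (raises q j (raises mE i Φ∘)) (blank n) ≡ raises p j (raises mE i (raises q j Φ∘)) (blank n)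
    reorder = raises-local p j (blank n) (λ κ _ → raises-comm q mE j i Φ∘ κ)
    count : raises p j (raises mE i (raises q j Φ∘)) (blank n) ≡ raises p j (raises mE i (λ κ → f * Φ∘ κ)) (blank n)
    count = raises-local p j (blank n) (λ κ e → raises-local mE i κ (λ κ′ e′ → trans
        (raises-inv q Φ∘ (raise-select-out χ q χq Φ) j κ′)
       (cong (λ t → fall t j * Φ∘ κ′) (trans (sym (ℕ.m+n∸m≡n (j +ℕ i) (ν κ′)))
           (cong (_∸ (j +ℕ i)) (trans (ℕ.+-assoc j i (ν κ′)) (trans (cong (j +ℕ_) e′) (trans e (ν-blank n)))))))))

  -- A colouring with |A| = |B| = j and |E| = i yields two (j+i)-sets whose weights differ by c(A) -
  -- c(B). Summing the pointwise bound over all colourings, the left side does not see E and picks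
  -- up the number of its choices, while on the right each (j+i)-set occurs boundedly often. The 4
  -- is 2 for each side.
  ψ-transfer : ∀ {n} (c : Vec ℚ n) (H : Subset n → ℚ) → (∀ S S′ → ψ (wt c S - wt c S′) ≤ 𝟚 * H S + 𝟚 * H S′) → (∀ S → 𝟘 ≤ H S) → ∀ j
      i →
    fall (n ∸ (j +ℕ j)) i * iter j P (λ κ → ψ (X c κ)) (blank n) ≤ ι 4 *
        (fall (n ∸ (j +ℕ i)) j * (fact (j +ℕ i) * ⟨ lev (j +ℕ i) , H ⟩))
  ψ-transfer {n} c H bound pos j i = ℚ.≤-trans (ℚ.≤-reflexive lhs) (ℚ.≤-trans
      (Ps-≤ j (blank n) (λ κ _ → raises-≤ mE i κ (λ κ′ _ → pointwise κ′)))
      (ℚ.≤-trans (ℚ.≤-reflexive (trans (Ps-local j (blank n) (λ κ _ → raises-+2 i κ)) (Ps-lin j 𝟚 𝟚 _ _ (blank n))))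
      (ℚ.≤-trans (+-mono-≤ (*-monoˡ 𝟚 (0≤ι 2) sideA) (*-monoˡ 𝟚 (0≤ι 2) sideB))
          (ℚ.≤-reflexive (ring 1 (λ x → # 2 :* x :+ # 2 :* x := # 4 :* x) refl _)))))
    where
    Θ HA HB : Colouring n → ℚ
    Θ κ = ψ (X c κ)
    HA κ = H (select χA κ)
    HB κ = H (select χB κ)
    f : ℚ
    f = fall (n ∸ (j +ℕ j)) i
    lhs : f * iter j P Θ (blank n) ≡ iter j P (raises mE i Θ) (blank n)
    lhs = trans (trans (ring 2 (λ f t → f :* t := f :* t :+ # 0 :* t) refl f _) (sym (Ps-lin j f 𝟘 Θ Θ (blank n))))
      (Ps-local j (blank n) (λ κ e → trans (ring 2 (λ f t → f :* t :+ # 0 :* t := f :* t) refl f (Θ κ))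
        (trans (cong (λ t → fall t i * Θ κ) (trans (cong (_∸ (j +ℕ j)) (trans (sym (ν-blank n)) (sym e)))
            (ℕ.m+n∸m≡n (j +ℕ j) (ν κ)))) (sym (raises-inv mE Θ (raise-E-X c ψ) i κ)))))
    pointwise : ∀ κ → Θ κ ≤ 𝟚 * HA κ + 𝟚 * HB κ
    pointwise κ = subst (λ t → ψ t ≤ 𝟚 * HA κ + 𝟚 * HB κ) (sym (X-select c κ)) (bound (select χA κ) (select χB κ))
    raises-+2 : ∀ i κ → raises mE i (λ κ → 𝟚 * HA κ + 𝟚 * HB κ) κ ≡ 𝟚 * raises mE i HA κ + 𝟚 * raises mE i HB κ
    raises-+2 zero κ = refl
    raises-+2 (suc i) κ = trans (raise-cong mE (raises-+2 i) κ) (trans (raise-+ mE _ _ κ)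
        (cong₂ _+_ (raise-* mE 𝟚 _ κ) (raise-* mE 𝟚 _ κ)))
    bnd : ℚ
    bnd = fall (n ∸ (j +ℕ i)) j * (fact (j +ℕ i) * ⟨ lev (j +ℕ i) , H ⟩)
    sideA : iter j P (raises mE i HA) (blank n) ≤ bnd
    sideA = subst (_≤ bnd) (sym (Ps-split j _ (blank n))) (configurations-≤ χA mA mB refl refl refl j i H pos)
    sideB : iter j P (raises mE i HB) (blank n) ≤ bnd
    sideB = subst (_≤ bnd) (sym (trans (Ps-split j _ (blank n)) (raises-comm mA mB j j _ (blank n))))
        (configurations-≤ χB mB mA refl refl refl j i H pos)

  -- The level-one inequality by adding one random pair at a time

  FS : ∀ {n} → Vec ℚ n → Colouring n → (ℚ → ℚ) → ℚ
  FS [] [] G = 𝟘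
  FS (c ∷ cs) (nothing ∷ κ) G = G c + FS cs κ G
  FS (c ∷ cs) (just _ ∷ κ) G = FS cs κ G

  FS-≤ : ∀ {n} (c : Vec ℚ n) κ {G G′ : ℚ → ℚ} → (∀ x → G x ≤ G′ x) → FS c κ G ≤ FS c κ G′
  FS-≤ [] [] e = ℚ.≤-refl
  FS-≤ (c ∷ cs) (nothing ∷ κ) e = +-mono-≤ (e c) (FS-≤ cs κ e)
  FS-≤ (c ∷ cs) (just _ ∷ κ) e = FS-≤ cs κ e

  FS-cong : ∀ {n} (c : Vec ℚ n) κ {G G′ : ℚ → ℚ} → (∀ x → G x ≡ G′ x) → FS c κ G ≡ FS c κ G′
  FS-cong c κ e = ℚ.≤-antisym (FS-≤ c κ (λ x → ℚ.≤-reflexive (e x))) (FS-≤ c κ (λ x → ℚ.≤-reflexive (sym (e x))))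

  FS-+ : ∀ {n} (c : Vec ℚ n) κ (G G′ : ℚ → ℚ) → FS c κ (λ x → G x + G′ x) ≡ FS c κ G + FS c κ G′
  FS-+ [] [] G G′ = sym (+-identityʳ 𝟘)
  FS-+ (c ∷ cs) (nothing ∷ κ) G G′ = trans (cong (G c + G′ c +_) (FS-+ cs κ G G′)) (interchange _ _ _ _)
  FS-+ (c ∷ cs) (just _ ∷ κ) G G′ = FS-+ cs κ G G′

  FS-* : ∀ {n} (c : Vec ℚ n) κ a (G : ℚ → ℚ) → FS c κ (λ x → a * G x) ≡ a * FS c κ G
  FS-* [] [] a G = sym (zeroʳ a)
  FS-* (c ∷ cs) (nothing ∷ κ) a G = trans (cong (a * G c +_) (FS-* cs κ a G)) (sym (distribˡ a _ _))
  FS-* (c ∷ cs) (just _ ∷ κ) a G = FS-* cs κ a G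

  FS-lin : ∀ {n} (c : Vec ℚ n) κ a b (G G′ : ℚ → ℚ) → FS c κ (λ x → a * G x + b * G′ x) ≡ a * FS c κ G + b * FS c κ G′
  FS-lin c κ a b G G′ = trans (FS-+ c κ _ _) (cong₂ _+_ (FS-* c κ a G) (FS-* c κ b G′))

  FS-const : ∀ {n} (c : Vec ℚ n) κ a → FS c κ (λ _ → a) ≡ ι (ν κ) * a
  FS-const [] [] a = sym (zeroˡ a)
  FS-const (c ∷ cs) (nothing ∷ κ) a = trans (cong (a +_) (FS-const cs κ a))
      (trans (ring 2 (λ a v → a :+ v :* a := (# 1 :+ v) :* a) refl a _) (cong (_* a) (sym (ι-suc (ν κ)))))
  FS-const (c ∷ cs) (just _ ∷ κ) a = FS-const cs κ a

  0≤FS : ∀ {n} (c : Vec ℚ n) κ {G : ℚ → ℚ} → (∀ x → 𝟘 ≤ G x) → 𝟘 ≤ FS c κ G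
  0≤FS c κ p = ℚ.≤-trans (ℚ.≤-reflexive (sym (trans (FS-const c κ 𝟘) (zeroʳ _)))) (FS-≤ c κ p)

  FS-≤blank : ∀ {n} (c : Vec ℚ n) κ {G : ℚ → ℚ} → (∀ x → 𝟘 ≤ G x) → FS c κ G ≤ FS c (blank n) G
  FS-≤blank [] [] p = ℚ.≤-refl
  FS-≤blank (c ∷ cs) (nothing ∷ κ) p = +-mono-≤ ℚ.≤-refl (FS-≤blank cs κ p)
  FS-≤blank (c ∷ cs) (just _ ∷ κ) {G} p = subst (_≤ G c + FS cs (blank _) G) (+-identityˡ _) (+-mono-≤ (p c) (FS-≤blank cs κ p))

  FS-swap : ∀ {n m} (c : Vec ℚ n) κ (d : Vec ℚ m) λ′ (G : ℚ → ℚ → ℚ) → FS c κ (λ a → FS d λ′ (λ b → G a b)) ≡ FS d λ′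
      (λ b → FS c κ (λ a → G a b))
  FS-swap [] [] d λ′ G = sym (trans (FS-const d λ′ 𝟘) (zeroʳ _))
  FS-swap (c ∷ cs) (nothing ∷ κ) d λ′ G = trans (cong (FS d λ′ (G c) +_) (FS-swap cs κ d λ′ G))
      (sym (FS-+ d λ′ (G c) (λ b → FS cs κ (λ a → G a b))))
  FS-swap (c ∷ cs) (just _ ∷ κ) d λ′ G = FS-swap cs κ d λ′ G

  S2 : ∀ {n} → Vec ℚ n → Colouring n → (ℚ → ℚ → ℚ) → ℚ
  S2 c κ G = FS c κ (λ a → FS c κ (λ b → G a b))

  raise-B-X : ∀ {n} (c : Vec ℚ n) (F : ℚ → ℚ) κ → raise mB (λ κ → F (X c κ)) κ ≡ FS c κ (λ b → F (X c κ - b))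
  raise-B-X [] F [] = refl
  raise-B-X (c ∷ cs) F (nothing ∷ κ) = cong₂ _+_ (cong F (+-comm (- c) (X cs κ))) (raise-B-X cs F κ)
  raise-B-X (c ∷ cs) F (just mA ∷ κ) = trans (raise-B-X cs (λ x → F (c + x)) κ)
      (FS-cong cs κ (λ b → cong F (sym (+-assoc c (X cs κ) (- b)))))
  raise-B-X (c ∷ cs) F (just mB ∷ κ) = trans (raise-B-X cs (λ x → F ((- c) + x)) κ)
      (FS-cong cs κ (λ b → cong F (sym (+-assoc (- c) (X cs κ) (- b)))))
  raise-B-X (c ∷ cs) F (just mE ∷ κ) = raise-B-X cs F κ

  -- The point just marked A is no longer free for the inner sum; the unrestricted double sum
  -- includes it, and the diagonal is subtracted.
  raise-A-FS : ∀ {n} (c : Vec ℚ n) (Φ : ℚ → ℚ → ℚ) κ → raise mA (λ κ → FS c κ (Φ (X c κ))) κ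
    ≡ FS c κ (λ a → FS c κ (Φ (X c κ + a))) - FS c κ (λ a → Φ (X c κ + a) a)
  raise-A-FS [] Φ [] = ring 0 (# 0 := # 0 :- # 0) refl
  raise-A-FS (c ∷ cs) Φ (nothing ∷ κ) = trans (cong₂ _+_ (cong (λ y → FS cs κ (Φ y)) (+-comm c x))
      (trans (raise-+ mA _ _ κ) (cong₂ _+_ (raise-A cs (λ y → Φ y c) κ) (raise-A-FS cs Φ κ))))
     (trans (ring 5 (λ p u v w q → u :+ (v :+ (w :- q)) := (p :+ u) :+ (v :+ w) :- (p :+ q)) refl (Φ (x + c) c)
         (FS cs κ (Φ (x + c))) (FS cs κ (λ a → Φ (x + a) c)) _ _)
       (cong (λ z → (Φ (x + c) c + FS cs κ (Φ (x + c))) + z - (Φ (x + c) c + FS cs κ (λ a → Φ (x + a) a))) (sym (FS-+ cs κ _ _))))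
    where
    x : ℚ
    x = X cs κ
    raise-A : ∀ {n} (c : Vec ℚ n) (F : ℚ → ℚ) κ → raise mA (λ κ → F (X c κ)) κ ≡ FS c κ (λ a → F (X c κ + a))
    raise-A [] F [] = refl
    raise-A (c ∷ cs) F (nothing ∷ κ) = cong₂ _+_ (cong F (+-comm c (X cs κ))) (raise-A cs F κ)
    raise-A (c ∷ cs) F (just mA ∷ κ) = trans (raise-A cs (λ x → F (c + x)) κ)
        (FS-cong cs κ (λ b → cong F (sym (+-assoc c (X cs κ) b))))
    raise-A (c ∷ cs) F (just mB ∷ κ) = trans (raise-A cs (λ x → F ((- c) + x)) κ)
        (FS-cong cs κ (λ b → cong F (sym (+-assoc (- c) (X cs κ) b))))
    raise-A (c ∷ cs) F (just mE ∷ κ) = raise-A cs F κ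
  raise-A-FS (c ∷ cs) Φ (just mA ∷ κ) = trans (raise-A-FS cs (λ y → Φ (c + y)) κ)
      (cong₂ _-_ (FS-cong cs κ (λ a → cong (λ t → FS cs κ (Φ t)) (sym (+-assoc c (X cs κ) a))))
      (FS-cong cs κ (λ a → cong (λ t → Φ t a) (sym (+-assoc c (X cs κ) a)))))
  raise-A-FS (c ∷ cs) Φ (just mB ∷ κ) = trans (raise-A-FS cs (λ y → Φ ((- c) + y)) κ)
      (cong₂ _-_ (FS-cong cs κ (λ a → cong (λ t → FS cs κ (Φ t)) (sym (+-assoc (- c) (X cs κ) a))))
      (FS-cong cs κ (λ a → cong (λ t → Φ t a) (sym (+-assoc (- c) (X cs κ) a)))))
  raise-A-FS (c ∷ cs) Φ (just mE ∷ κ) = raise-A-FS cs Φ κ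

  -- `P` picks two different points. The full double sum also contains a = b, which leaves X
  -- unchanged and adds F(X) once per free point.
  P-X : ∀ {n} (c : Vec ℚ n) (F : ℚ → ℚ) κ → P (λ κ → F (X c κ)) κ ≡ S2 c κ (λ a b → F (X c κ + (a - b))) - ι (ν κ) * F (X c κ)
  P-X c F κ = trans (raise-cong mA (raise-B-X c F) κ) (trans (raise-A-FS c (λ y b → F (y - b)) κ)
    (cong₂ _-_ (FS-cong c κ (λ a → FS-cong c κ (λ b → cong F (+-assoc (X c κ) a (- b)))))
        (trans (FS-cong c κ (λ a → cong F (ring 2 (λ x a → x :+ a :- a := x) refl (X c κ) a))) (FS-const c κ (F (X c κ))))))

  raise-FS : ∀ {n} m (c : Vec ℚ n) (G : ℚ → ℚ) κ → raise m (λ κ → FS c κ G) κ ≡ (ι (ν κ) - 𝟙) * FS c κ G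
  raise-FS m [] G [] = sym (zeroʳ _)
  raise-FS m (c ∷ cs) G (nothing ∷ κ) = trans (cong (FS cs κ G +_) (trans (raise-+ m _ _ κ)
      (cong₂ _+_ (raise-const m (G c) κ) (raise-FS m cs G κ))))
    (trans (ring 3 (λ w v g → w :+ (v :* g :+ (v :- # 1) :* w) := ((# 1 :+ v) :- # 1) :* (g :+ w)) refl _ _ _)
        (cong (λ t → (t - 𝟙) * (G c + FS cs κ G)) (sym (ι-suc (ν κ)))))
  raise-FS m (c ∷ cs) G (just _ ∷ κ) = raise-FS m cs G κ

  S2-∷ : ∀ {n} c (cs : Vec ℚ n) κ G → S2 (c ∷ cs) (nothing ∷ κ) G ≡ (G c c + FS cs κ (G c)) + (FS cs κ (λ a → G a c) + S2 cs κ G)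
  S2-∷ c cs κ G = cong (G c c + FS cs κ (G c) +_) (FS-+ cs κ _ _)

  -- A pair of distinct free points survives the ν - 2 choices that avoid both, a diagonal pair
  -- survives ν - 1; the last term makes up the difference.
  raise-S2 : ∀ {n} m (c : Vec ℚ n) (G : ℚ → ℚ → ℚ) κ → raise m (λ κ → S2 c κ G) κ ≡ (ι (ν κ) - 𝟚) * S2 c κ G + FS c κ (λ a → G a a)
  raise-S2 m [] G [] = ring 0 (# 0 := (# 0 :- # 2) :* # 0 :+ # 0) refl
  raise-S2 m (c ∷ cs) G (nothing ∷ κ) = trans (cong (S2 cs κ G +_) (trans (raise-cong m (λ κ → S2-∷ c cs κ G) κ)
      (trans (raise-+ m _ _ κ)
      (cong₂ _+_ (trans (raise-+ m _ _ κ) (cong₂ _+_ (raise-const m (G c c) κ) (raise-FS m cs (G c) κ)))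
          (trans (raise-+ m _ _ κ) (cong₂ _+_ (raise-FS m cs (λ a → G a c) κ) (raise-S2 m cs G κ)))))))
    (trans (ring 6 (λ S v g p q D → S :+ ((v :* g :+ (v :- # 1) :* p) :+ ((v :- # 1) :* q :+ ((v :- # 2) :* S :+ D))) :=
        ((# 1 :+ v) :- # 2) :* ((g :+ p) :+ (q :+ S)) :+ (g :+ D)) refl _ _ _ _ _ _)
     (cong₂ (λ t u → (t - 𝟚) * u + (G c c + FS cs κ (λ a → G a a))) (sym (ι-suc (ν κ))) (sym (S2-∷ c cs κ G))))
  raise-S2 m (c ∷ cs) G (just _ ∷ κ) = raise-S2 m cs G κ

  ι-∸ : ∀ {a b} → b ≤ℕ a → ι (a ∸ b) ≡ ι a - ι b
  ι-∸ {a} {b} p = trans (ring 2 (λ x y → x := (x :+ y) :- y) refl (ι (a ∸ b)) (ι b))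
      (cong (_- ι b) (trans (sym (ι-+ (a ∸ b) b)) (cong ι (ℕ.m∸n+n≡m p))))

  ceil-half : ∀ k → Σ ℕ λ j → (k ≤ℕ j +ℕ j) × (j +ℕ j ≤ℕ suc k)
  ceil-half zero = 0 , z≤n , z≤n
  ceil-half (suc zero) = 1 , s≤s z≤n , ℕ.≤-refl
  ceil-half (suc (suc k)) with ceil-half k
  ... | j , p , q = suc j , subst (2 +ℕ k ≤ℕ_) (cong suc (sym (ℕ.+-suc j j))) (s≤s (s≤s p)) , subst (_≤ℕ 3 +ℕ k)
      (cong suc (sym (ℕ.+-suc j j))) (s≤s (s≤s q))

  module PairSampling {n : ℕ} (c : Vec ℚ n) where

    Θ W : Colouring n → ℚ
    Θ κ = ψ (X c κ)
    W κ = S2 c κ (λ a b → ψ (a - b))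

    -- Stage j: `T` and `ω` sum over the ordered choices of j pairs, `Nn` counts these choices, and
    -- `v` is the number of points left.
    T ω Nn v : ℕ → ℚ
    T j = iter j P Θ (blank n)
    ω j = iter j P W (blank n)
    Nn j = fall n (j +ℕ j)
    v j = ι (n ∸ (j +ℕ j))

    Wt : ℚ
    Wt = W (blank n)

    0≤W : ∀ κ → 𝟘 ≤ W κ
    0≤W κ = 0≤FS c κ (λ a → 0≤FS c κ (λ b → 0≤ψ (a - b)))

    W≤Wt : ∀ κ → W κ ≤ Wt
    W≤Wt κ = ℚ.≤-trans (FS-≤ c κ (λ a → FS-≤blank c κ (λ b → 0≤ψ (a - b))))
        (FS-≤blank c κ (λ a → 0≤FS c (blank n) (λ b → 0≤ψ (a - b))))

    raise-W : ∀ m κ → raise m W κ ≡ (ι (ν κ) - 𝟚) * W κ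
    raise-W m κ = trans (raise-S2 m c (λ a b → ψ (a - b)) κ) (trans (cong ((ι (ν κ) - 𝟚) * W κ +_)
       (trans (FS-cong c κ (λ a → trans (cong ψ (ring 1 (λ a → a :- a := # 0) refl a)) ψ0)) (trans (FS-const c κ 𝟘) (zeroʳ _))))
           (+-identityʳ _))

    P-W : ∀ κ → P W κ ≡ (ι (ν κ) - 𝟚) * (ι (ν κ) - ι 3) * W κ
    P-W κ = trans (raise-cong mA (raise-W mB) κ) (trans (raise-local mA κ
        (λ κ′ e → cong (_* W κ′) (trans (ring 1 (λ x → x :- # 2 := (# 1 :+ x) :- # 3) refl (ι (ν κ′)))
        (cong (_- ι 3) (trans (sym (ι-suc (ν κ′))) (cong ι e))))))
      (trans (raise-* mA (ι (ν κ) - ι 3) W κ) (trans (cong ((ι (ν κ) - ι 3) *_) (raise-W mA κ))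
          (ring 3 (λ p q w → p :* (q :* w) := q :* p :* w) refl _ _ _))))

    -- Pairing (a, b) with (b, a) makes `ψ-parallelogram` applicable at X and a - b. Its error sums
    -- to 96 ψ(X) W, which is at most 96 ψ(X) `Wt`; halving leaves 48.
    P-Θ : ∀ κ → (ι (ν κ) * ι (ν κ) - ι (ν κ) - ι 48 * Wt) * Θ κ + 𝟙 * W κ ≤ P Θ κ
    P-Θ κ = *-cancel-≤ 𝟚 (0<ι-suc 1) (ℚ.≤-trans (≤-cert _
        (ring 4 (λ N p t w → (# 2 :* (N :* (N :* p) :- N :* p) :+ (# 2 :* w :- # 96 :* (p :* w))) :- # 2 :*
            ((N :* N :- N :- # 48 :* t) :* p :+ # 1 :* w) := # 96 :* (p :* (t :- w))) refl N (ψ x) Wt (W κ))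
        (0≤* (0≤ι 96) (0≤* (0≤ψ x) (0≤- (W≤Wt κ)))))
       (ℚ.≤-trans (≤-cert (A - B) (trans (ring 4 (λ s N p w → # 2 :* (s :- N :* p) :-
           (# 2 :* (N :* (N :* p) :- N :* p) :+ (# 2 :* w :- # 96 :* (p :* w))) := (s :+ s) :-
           (# 2 :* (N :* (N :* p)) :+ (# 2 :- # 96 :* p) :* w)) refl S₁ N (ψ x) (W κ))
             (cong₂ _-_ (trans (cong (S₁ +_) swap) (sym A-split)) (sym B-value))) (0≤- B≤A))
        (ℚ.≤-reflexive (cong (𝟚 *_) (sym (P-X c ψ κ))))))
      where
      x N S₁ A B : ℚ
      x = X c κ
      N = ι (ν κ)
      S₁ = S2 c κ (λ a b → ψ (x + (a - b)))
      A = S2 c κ (λ a b → ψ (x + (a - b)) + ψ (x - (a - b)))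
      B = S2 c κ (λ a b → 𝟚 * ψ x + (𝟚 - ι 96 * ψ x) * ψ (a - b))
      swap : S₁ ≡ S2 c κ (λ a b → ψ (x - (a - b)))
      swap = trans (FS-swap c κ c κ (λ a b → ψ (x + (a - b)))) (FS-cong c κ
          (λ a → FS-cong c κ (λ b → cong ψ (ring 3 (λ x a b → x :+ (b :- a) := x :- (a :- b)) refl x a b))))
      A-split : A ≡ S₁ + S2 c κ (λ a b → ψ (x - (a - b)))
      A-split = trans (FS-cong c κ (λ a → FS-+ c κ _ _)) (FS-+ c κ _ _)
      B-value : B ≡ 𝟚 * (N * (N * ψ x)) + (𝟚 - ι 96 * ψ x) * W κ
      B-value = trans (FS-cong c κ (λ a → FS-lin c κ 𝟚 (𝟚 - ι 96 * ψ x) (λ _ → ψ x) (λ b → ψ (a - b))))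
          (trans (FS-lin c κ 𝟚 (𝟚 - ι 96 * ψ x) _ _)
         (cong (λ t → 𝟚 * t + (𝟚 - ι 96 * ψ x) * W κ) (trans (FS-const c κ _) (cong (N *_) (FS-const c κ (ψ x))))))
      B≤A : B ≤ A
      B≤A = FS-≤ c κ (λ a → FS-≤ c κ (λ b → ℚ.≤-trans (ℚ.≤-reflexive (ring 2
          (λ p q → # 2 :* p :+ (# 2 :- # 96 :* p) :* q := # 2 :* p :+ # 2 :* q :- # 96 :* (p :* q)) refl (ψ x) (ψ (a - b))))
          (ψ-parallelogram x (a - b))))

    reach : ∀ j (κ : Colouring n) → (j +ℕ j) +ℕ ν κ ≡ ν (blank n) → ν κ ≡ n ∸ (j +ℕ j)
    reach j κ e = trans (sym (ℕ.m+n∸m≡n (j +ℕ j) (ν κ))) (cong (_∸ (j +ℕ j)) (trans e (ν-blank n)))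

    T-step : ∀ j → (v j * v j - v j - ι 48 * Wt) * T j + 𝟙 * ω j ≤ T (suc j)
    T-step j = subst₂ _≤_ (Ps-lin j _ _ Θ W (blank n)) (sym (Ps-shift j Θ (blank n)))
      (Ps-≤ j (blank n) (λ κ e → ℚ.≤-trans (ℚ.≤-reflexive (cong (λ t → (ι t * ι t - ι t - ι 48 * Wt) * Θ κ + 𝟙 * W κ)
          (sym (reach j κ e)))) (P-Θ κ)))

    ω-step : ∀ j → ω (suc j) ≡ (v j - 𝟚) * (v j - ι 3) * ω j
    ω-step j = trans (Ps-shift j W (blank n)) (trans (Ps-local j (blank n)
        (λ κ e → trans (P-W κ) (trans (cong (λ t → (ι t - 𝟚) * (ι t - ι 3) * W κ) (reach j κ e))
        (ring 2 (λ a w → a :* w := a :* w :+ # 0 :* w) refl _ (W κ)))))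
      (trans (Ps-lin j _ 𝟘 W W (blank n)) (ring 2 (λ a w → a :* w :+ # 0 :* w := a :* w) refl _ _)))

    v-suc : ∀ j → suc j +ℕ suc j ≤ℕ n → v (suc j) ≡ v j - 𝟚
    v-suc j p = trans (ι-∸ p) (trans (cong (λ t → ι n - t) (trans (cong (λ t → ι (suc t)) (ℕ.+-suc j j)) (ι-+ 2 (j +ℕ j))))
        (trans (ring 2 (λ n t → n :- (# 2 :+ t) := n :- t :- # 2) refl _ _)
        (cong (_- 𝟚) (sym (ι-∸ (ℕ.≤-trans (ℕ.+-mono-≤ (ℕ.n≤1+n j) (ℕ.n≤1+n j)) p))))))

    N-suc : ∀ j → suc j +ℕ suc j ≤ℕ n → Nn (suc j) ≡ v j * (v j - 𝟙) * Nn j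
    N-suc j p = trans (cong (fall n) (trans (cong suc (ℕ.+-suc j j)) (ℕ.+-comm 2 (j +ℕ j)))) (trans (fall-+ n (j +ℕ j) 2)
       (trans (cong (λ t → Nn j * (v j * (t * 𝟙))) (ι-∸ {n ∸ (j +ℕ j)} {1} pos))
           (ring 2 (λ N v → N :* (v :* ((v :- # 1) :* # 1)) := v :* (v :- # 1) :* N) refl (Nn j) (v j))))
      where
      pos : 1 ≤ℕ n ∸ (j +ℕ j)
      pos = ℕ.m<n⇒0<n∸m (ℕ.≤-trans (s≤s (ℕ.+-monoʳ-≤ j (ℕ.n≤1+n j))) p)

    -- By symmetry every ordered pair of distinct points stays free in the same number
    -- Nn(j+1)/(n(n-1)) of stage-j choices.
    ω-value : ∀ j → suc j +ℕ suc j ≤ℕ n → ι n * (ι n - 𝟙) * ω j ≡ Wt * Nn (suc j)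
    ω-value zero p = trans (ring 2 (λ n w → n :* (n :- # 1) :* w := w :* (n :* (n :- # 1) :* # 1)) refl (ι n) Wt)
        (cong (Wt *_) (sym (N-suc 0 p)))
    ω-value (suc j) p = trans (cong (ι n * (ι n - 𝟙) *_) (ω-step j)) (trans
        (ring 3 (λ a b w → a :* (b :* w) := b :* (a :* w)) refl (ι n * (ι n - 𝟙)) ((v j - 𝟚) * (v j - ι 3)) (ω j))
      (trans (cong ((v j - 𝟚) * (v j - ι 3) *_) (ω-value j p′)) (trans (ring 3
          (λ v w N → (v :- # 2) :* (v :- # 3) :* (w :* N) := w :* ((v :- # 2) :* ((v :- # 2) :- # 1) :* N)) refl (v j) Wt
          (Nn (suc j)))
      (cong (Wt *_) (trans (cong (λ t → t * (t - 𝟙) * Nn (suc j)) (sym (v-suc j p′))) (sym (N-suc (suc j) p)))))))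
      where
      p′ : suc j +ℕ suc j ≤ℕ n
      p′ = ℕ.≤-trans (ℕ.+-mono-≤ (ℕ.n≤1+n (suc j)) (ℕ.n≤1+n (suc j))) p

    -- The error term of T-step is absorbed as long as T j is a small multiple of Nn j.
    T-lower : ∀ J → (∀ j → suc j ≤ℕ J → suc j +ℕ suc j ≤ℕ n × ι 96 * (ι n * (ι n - 𝟙)) * T j ≤ v j * (v j - 𝟙) * Nn j) →
      ∀ j → j ≤ℕ J → ι j * (Wt * Nn j) ≤ 𝟚 * (ι n * (ι n - 𝟙)) * T j
    T-lower J small zero le = ℚ.≤-reflexive (trans (zeroˡ _) (sym (trans (cong (𝟚 * (ι n * (ι n - 𝟙)) *_) T0) (zeroʳ _))))
      where
      X-blank : ∀ {n} (c : Vec ℚ n) → X c (blank n) ≡ 𝟘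
      X-blank [] = refl
      X-blank (c ∷ cs) = X-blank cs
      T0 : T 0 ≡ 𝟘
      T0 = trans (cong ψ (X-blank c)) ψ0
    -- Let τ = T/Nn be the mean at stage j. One step gains Wt/(n(n-1)) and loses at most 48 Wt
    -- τ/(v(v-1)). By `small` the loss is at most half the gain, hence the factor 2 on the right.
    T-lower J small (suc j) le = ℚ.≤-trans (≤-cert
        _
        (trans (cong₂ (λ s t → 𝟚 * q * ((v j * v j - v j - ι 48 * Wt) * T j + 𝟙 * ω j) - s * (Wt * t)) (ι-suc j) (N-suc j p))
        (trans (ring 6 (λ q v w T o r → # 2 :* q :* ((v :* v :- v :- # 48 :* w) :* T :+ # 1 :* o) :- r := # 2 :* (q :* o) :+
            (# 2 :* q :* ((v :* v :- v :- # 48 :* w) :* T) :- r)) refl q (v j) Wt (T j) (ω j) _)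
        (trans (cong (λ t → 𝟚 * t + (𝟚 * q * ((v j * v j - v j - ι 48 * Wt) * T j) - (𝟙 + ι j) * (Wt * (v j * (v j - 𝟙) * Nn j))))
            (trans (ω-value j p) (cong (Wt *_) (N-suc j p))))
        (ring 6 (λ q v w T N j → # 2 :* (w :* (v :* (v :- # 1) :* N)) :+
            (# 2 :* q :* ((v :* v :- v :- # 48 :* w) :* T) :- (# 1 :+ j) :* (w :* (v :* (v :- # 1) :* N)))
           := v :* (v :- # 1) :* (# 2 :* q :* T :- j :* (w :* N)) :+ w :* (v :* (v :- # 1) :* N :- # 96 :* q :* T)) refl q (v j) Wt
               (T j) (Nn j) (ι j)))))
        (0≤+ (0≤* 0≤vv (0≤- (T-lower J small j (ℕ.≤-trans (ℕ.n≤1+n j) le)))) (0≤* (0≤W (blank n)) (0≤- (proj₂ (small j le))))))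
      (*-monoˡ (𝟚 * q) (0≤* (0≤ι 2) 0≤q) (T-step j))
      where
      q : ℚ
      q = ι n * (ι n - 𝟙)
      p : suc j +ℕ suc j ≤ℕ n
      p = proj₁ (small j le)
      0≤ι-1 : ∀ m → 1 ≤ℕ m → 𝟘 ≤ ι m * (ι m - 𝟙)
      0≤ι-1 m e = 0≤* (0≤ι m) (0≤- (ι-mono e))
      0≤q : 𝟘 ≤ q
      0≤q = 0≤ι-1 n (ℕ.≤-trans (s≤s z≤n) p)
      0≤vv : 𝟘 ≤ v j * (v j - 𝟙)
      0≤vv = 0≤ι-1 (n ∸ (j +ℕ j)) (ℕ.m<n⇒0<n∸m (ℕ.≤-trans (s≤s (ℕ.+-monoʳ-≤ j (ℕ.n≤1+n j))) p))

  -- Rounding the coefficients to integers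

  pick : ∀ {n} (c : Vec ℚ (suc n)) (G : ℚ → ℚ) q → FS c (blank (suc n)) G ≤ ι (suc n) * q → Σ ℚ λ y → G y ≤ q
  pick {zero} (c ∷ []) G q p = c , subst₂ _≤_ (+-identityʳ _) (*-identityˡ q) p
  pick {suc n} (c ∷ cs) G q p with ℚ.≤-total (G c) q
  ... | inj₁ le = c , le
  ... | inj₂ ge = pick cs G q (≤-cert _ (trans (ring 4 (λ g r n q → n :* q :- r := ((# 1 :+ n) :* q :- (g :+ r)) :+ (g :- q)) refl
      (G c) (FS cs (blank (suc n)) G) (ι (suc n)) q)
       (cong (λ t → (t * q - (G c + FS cs (blank (suc n)) G)) + (G c - q)) (sym (ι-suc (suc n))))) (0≤+ (0≤- p) (0≤- ge)))

  dot-comm : ∀ {n} (v w : Vec ℚ n) → dot v w ≡ dot w v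
  dot-comm [] [] = refl
  dot-comm (x ∷ v) (y ∷ w) = cong₂ _+_ (*-comm x y) (dot-comm v w)

  bin-mono : ∀ n k → bin n k ≤ bin (suc n) k
  bin-mono n zero = ℚ.≤-refl
  bin-mono n (suc k) = subst (_≤ bin n k + bin n (suc k)) (+-identityˡ _) (+-mono-≤ (0≤bin n k) ℚ.≤-refl)

  wtℤ : ∀ {n} → Vec ℤ n → Subset n → ℤ
  wtℤ [] [] = ℤ.+ 0
  wtℤ (t ∷ ts) (true ∷ S) = t ℤ.+ wtℤ ts S
  wtℤ (t ∷ ts) (false ∷ S) = wtℤ ts S

  wt-ζ : ∀ {n} (t : Vec ℤ n) S → wt (map ζ t) S ≡ ζ (wtℤ t S)
  wt-ζ [] [] = refl
  wt-ζ (t ∷ ts) (true ∷ S) = trans (cong (ζ t +_) (wt-ζ ts S)) (sym (ζ-+ t _))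
  wt-ζ (t ∷ ts) (false ∷ S) = wt-ζ ts S

  wt-round : ∀ {n} (c : Vec ℚ n) y S → wt c S ≡ ι (size S) * y + (wt (map ζ (map (λ a → nearest (a - y)) c)) S + wt
      (map (λ a → rem (a - y)) c) S)
  wt-round [] y [] = ring 1 (λ y → # 0 := # 0 :* y :+ (# 0 :+ # 0)) refl y
  wt-round (c ∷ cs) y (true ∷ S) = trans (cong (c +_) (wt-round cs y S))
      (trans (ring 6 (λ c s y t u z → c :+ (s :* y :+ (t :+ u)) := (# 1 :+ s) :* y :+ ((z :+ t) :+ ((c :- y :- z) :+ u))) refl c
      (ι (size S)) y _ _ (ζ (nearest (c - y))))
    (cong (_+ ((ζ (nearest (c - y)) + wt (map ζ (map (λ a → nearest (a - y)) cs)) S) +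
        (rem (c - y) + wt (map (λ a → rem (a - y)) cs) S))) (cong (_* y) (sym (ι-suc (size S))))))
  wt-round (c ∷ cs) y (false ∷ S) = wt-round cs y S

  wt-shift : ∀ {n} (v : Vec ℚ n) r S → wt (map (λ x → 𝟙 * (x - r)) v) S ≡ wt v S - ι (size S) * r
  wt-shift [] r [] = ring 1 (λ r → # 0 := # 0 :- # 0 :* r) refl r
  wt-shift (x ∷ v) r (true ∷ S) = trans (cong (𝟙 * (x - r) +_) (wt-shift v r S))
      (trans (ring 4 (λ x r w s → # 1 :* (x :- r) :+ (w :- s :* r) := x :+ w :- (# 1 :+ s) :* r) refl x r (wt v S) (ι (size S)))
      (cong (λ s → x + wt v S - s * r) (sym (ι-suc (size S)))))
  wt-shift (x ∷ v) r (false ∷ S) = wt-shift v r S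

  rem-dot : ∀ {n} (c : Vec ℚ n) y → dot (map (λ a → rem (a - y)) c) (map (λ a → rem (a - y)) c) ≤ 𝟚 * FS c (blank n)
      (λ a → ψ (a - y))
  rem-dot [] y = ℚ.≤-reflexive (sym (zeroʳ 𝟚))
  rem-dot (c ∷ cs) y = ℚ.≤-trans (+-mono-≤ (rem≤ψ (c - y)) (rem-dot cs y)) (ℚ.≤-reflexive (sym (distribˡ 𝟚 _ _)))

  sq-+ : ∀ x y → (x + y) * (x + y) ≤ 𝟚 * (x * x) + 𝟚 * (y * y)
  sq-+ x y = ≤-cert _ (ring 2 (λ x y → (# 2 :* (x :* x) :+ # 2 :* (y :* y)) :- (x :+ y) :* (x :+ y) := (x :- y) :* (x :- y)) refl x
      y) (0≤sq _)

  lev-≤ : ∀ {n} k (S : Subset n) {x y : ℚ} → (size S ≡ k → x ≤ y) → lev k S * x ≤ lev k S * y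
  lev-≤ k S {x} {y} e with size S ℕ.≟ k
  ... | yes p = *-monoˡ (lev k S) (0≤lev k S) (e p)
  ... | no p = ℚ.≤-reflexive (onLevel k S (λ q → ⊥-elim (p q)))

  module FKN {N k′ d : ℕ} (n≡ : suc (suc N) ≡ suc k′ +ℕ (suc k′ +ℕ suc d)) (f : Subset (suc (suc N)) → ℚ)
    (f-Supp : Supp (suc k′) f) (f-bool : ∀ S → f S * f S ≡ f S) (fz : Subset (suc (suc N)) → ℤ) (f≡ζ : ∀ S → f S ≡ ζ (fz S))
    (small : ι 1536 * Projection.H n≡ f f-Supp f-bool ≤ Projection.M n≡ f f-Supp f-bool) where

    open Projection n≡ f f-Supp f-bool
    open PairSampling c

    Hf : Subset n → ℚ
    Hf S = (f S - wt c S) * (f S - wt c S)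

    levH : ⟨ lev k , Hf ⟩ ≡ H
    levH = sumS-cong (λ S → trans (cong (_* Hf S) (sym (lev-idem k S))) (ring 2 (λ l x → l :* l :* (x :* x) := (l :* x) :* (l :* x))
        refl (lev k S) (f S - wt c S)))

    ψ≤Hf : ∀ S S′ → ψ (wt c S - wt c S′) ≤ 𝟚 * Hf S + 𝟚 * Hf S′
    ψ≤Hf S S′ = ℚ.≤-trans (ψ≤ _ (fz S ℤ.- fz S′)) (ℚ.≤-trans (ℚ.≤-reflexive
        (trans (cong (λ t → (wt c S - wt c S′ - t) * (wt c S - wt c S′ - t))
        (trans (ζ-- (fz S) (fz S′)) (sym (cong₂ _-_ (f≡ζ S) (f≡ζ S′)))))
        (ring 4 (λ w w′ f f′ → (w :- w′ :- (f :- f′)) :* (w :- w′ :- (f :- f′)) := ((w :- f) :+ (f′ :- w′)) :*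
            ((w :- f) :+ (f′ :- w′))) refl (wt c S) (wt c S′) (f S) (f S′))))
      (ℚ.≤-trans (sq-+ (wt c S - f S) (f S′ - wt c S′)) (ℚ.≤-reflexive (cong (λ t → 𝟚 * t + 𝟚 * Hf S′)
          (ring 2 (λ w f → (w :- f) :* (w :- f) := (f :- w) :* (f :- w)) refl (wt c S) (f S))))))

    k+k<n : k +ℕ k <ℕ n
    k+k<n = subst (suc (k +ℕ k) ≤ℕ_) (sym n≡) (subst (_≤ℕ k +ℕ (k +ℕ suc d)) (ℕ.+-suc k k)
        (ℕ.+-monoʳ-≤ k (subst (_≤ℕ k +ℕ suc d) (ℕ.+-comm k 1) (ℕ.+-monoʳ-≤ k (s≤s z≤n)))))

    k≤n : k ≤ℕ n
    k≤n = ℕ.≤-trans (ℕ.m≤m+n k k) (ℕ.<⇒≤ k+k<n)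

    M≤Nb : M ≤ Nb
    M≤Nb = *-cancel-≤ (ι k) (0<ι-suc k′) (subst (ι k * M ≤_) (sym k*Nb) (≤-cert _
        (ring 3 (λ n k M → n :* M :- k :* M := (n :- k) :* M) refl (ι n) (ι k) M) (0≤* (0≤- (ι-mono k≤n)) (ℚ.<⇒≤ 0<M))))

    -- The mean of ψ(c(A) - c(B)) over disjoint j-sets is at most 4H/Nb, whatever j is. This is
    -- `ψ-transfer` with |E| = k - j; the counts cancel because choosing A, B, E in order is
    -- choosing a k-set and then j further points in order.
    T-upper : ∀ j → j ≤ℕ k → Nb * T j ≤ ι 4 * (Nn j * H)
    T-upper j j≤k = *-cancel-≤ Y 0<Y (≤-cert _
        (trans (ring 5 (λ Y N H b T → Y :* (# 4 :* (N :* H)) :- Y :* (b :* T) := # 4 :* ((N :* Y) :* H) :- b :* (Y :* T)) refl Y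
            (Nn j) H Nb (T j))
         (trans (cong (λ t → ι 4 * (t * H) - Nb * (Y * T j)) counts) (ring 6
             (λ a b F H Y T → # 4 :* (a :* b :* F :* H) :- b :* (Y :* T) := b :* (# 4 :* (F :* (a :* H)) :- Y :* T)) refl (fact k)
             Nb F H Y (T j))))
        (0≤* (0≤bin n k) (0≤- transfer)))
      where
      i : ℕ
      i = k ∸ j
      j+i : j +ℕ i ≡ k
      j+i = ℕ.m+[n∸m]≡n j≤k
      Y F : ℚ
      Y = fall (n ∸ (j +ℕ j)) i
      F = fall (n ∸ k) j
      sizes : (j +ℕ j) +ℕ i ≡ k +ℕ j
      sizes = trans (ℕ.+-assoc j j i) (trans (cong (j +ℕ_) j+i) (ℕ.+-comm j k))
      0<Y : 𝟘 < Y
      0<Y = 0<fall _ i (ℕ.m+n≤o⇒m≤o∸n i (subst (_≤ℕ n) (trans (sym sizes) (ℕ.+-comm (j +ℕ j) i))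
          (ℕ.≤-trans (ℕ.+-monoʳ-≤ k j≤k) (ℕ.<⇒≤ k+k<n))))
      counts : Nn j * Y ≡ fact k * Nb * F
      counts = trans (sym (fall-+ n (j +ℕ j) i)) (trans (cong (fall n) sizes) (trans (fall-+ n k j) (cong (_* F) (fall-bin n k))))
      transfer : Y * T j ≤ ι 4 * (F * (fact k * H))
      transfer = subst (Y * T j ≤_) (trans (cong (λ t → ι 4 * (fall (n ∸ t) j * (fact t * ⟨ lev t , Hf ⟩))) j+i)
          (cong (λ t → ι 4 * (F * (fact k * t))) levH)) (ψ-transfer c Hf ψ≤Hf (λ S → 0≤sq _) j i)

    -- About k/2 steps: few enough that before each of them more than half of the points are free,
    -- many enough that 2J ≥ k.
    J : ℕ
    J = proj₁ (ceil-half k)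

    Q : ℚ
    Q = ι n * (ι n - 𝟙)

    1≤n : 𝟙 ≤ ι n
    1≤n = 1≤ι-suc (suc N)

    0≤Q : 𝟘 ≤ Q
    0≤Q = 0≤* (0≤ι n) (0≤- 1≤n)

    0≤H : 𝟘 ≤ H
    0≤H = 0≤⟨⟩ h

    -- The 1536 is 96 · 4 · 4: the error constant of the parallelogram law, the 4 of `T-upper`, and
    -- 4v(v-1) ≥ n(n-1), which holds since 2j < k < n/2.
    T-small : ∀ j → suc j ≤ℕ J → suc j +ℕ suc j ≤ℕ n × ι 96 * Q * T j ≤ v j * (v j - 𝟙) * Nn j
    T-small j le = ℕ.≤-trans sj (ℕ.≤-trans (s≤s (ℕ.m≤m+n k k)) k+k<n) , *-cancel-≤ M 0<M (≤-cert
        _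
        (ring 7 (λ M u Q T N H b → M :* (u :* N) :- M :* (# 96 :* Q :* T) := u :* N :* (M :- # 1536 :* H) :+
            (# 384 :* (N :* H :* (# 4 :* u :- Q)) :+ # 96 :* Q :* ((# 4 :* (N :* H) :- b :* T) :+ (b :- M) :* T))) refl M
            (v j * (v j - 𝟙)) Q (T j) (Nn j) H Nb)
        (0≤+ (0≤* (0≤* 0≤u 0≤N) (0≤- small)) (0≤+ (0≤* (0≤ι 384) (0≤* (0≤* 0≤N 0≤H) 0≤4u-Q))
            (0≤* (0≤* (0≤ι 96) 0≤Q) (0≤+ (0≤- (T-upper j j≤k)) (0≤* (0≤- M≤Nb) 0≤T))))))
      where
      sj : suc j +ℕ suc j ≤ℕ suc k
      sj = ℕ.≤-trans (ℕ.+-mono-≤ le le) (proj₂ (proj₂ (ceil-half k)))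
      x<k : suc (j +ℕ j) ≤ℕ k
      x<k = s≤s⁻¹ (subst (_≤ℕ suc k) (cong suc (ℕ.+-suc j j)) sj)
      j≤k : j ≤ℕ k
      j≤k = ℕ.≤-trans (ℕ.m≤m+n j j) (ℕ.≤-trans (ℕ.n≤1+n _) x<k)
      x≤n : j +ℕ j ≤ℕ n
      x≤n = ℕ.≤-trans (ℕ.n≤1+n _) (ℕ.≤-trans x<k k≤n)
      0≤N : 𝟘 ≤ Nn j
      0≤N = ℚ.<⇒≤ (0<fall n (j +ℕ j) x≤n)
      0≤T : 𝟘 ≤ T j
      0≤T = ℚ.≤-trans (ℚ.≤-reflexive (sym zero-sum)) (Ps-≤ j (blank n) (λ κ _ → 0≤ψ (X c κ)))
        where
        zero-sum : iter j P (λ _ → 𝟘) (blank n) ≡ 𝟘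
        zero-sum = trans (Ps-local j (blank n) (λ _ _ → ring 0 (# 0 := # 0 :* # 0 :+ # 0 :* # 0) refl))
            (trans (Ps-lin j 𝟘 𝟘 (λ _ → 𝟘) (λ _ → 𝟘) (blank n)) (ring 1 (λ x → # 0 :* x :+ # 0 :* x := # 0) refl _))
      x : ℚ
      x = ι (j +ℕ j)
      vx : v j ≡ ι n - x
      vx = ι-∸ x≤n
      1+x≤k : 𝟙 + x ≤ ι k
      1+x≤k = subst (_≤ ι k) (ι-suc (j +ℕ j)) (ι-mono x<k)
      1+2k≤n : 𝟙 + (ι k + ι k) ≤ ι n
      1+2k≤n = subst (_≤ ι n) (trans (ι-suc (k +ℕ k)) (cong (𝟙 +_) (ι-+ k k))) (ι-mono k+k<n)
      gap : 𝟘 ≤ ι n - 𝟚 * x - 𝟙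
      gap = subst (𝟘 ≤_) (ring 3 (λ n k x → (n :- (# 1 :+ (k :+ k))) :+ # 2 :* (k :- (# 1 :+ x)) :+ # 2 := n :- # 2 :* x :- # 1)
          refl (ι n) (ι k) x) (0≤+ (0≤+ (0≤- 1+2k≤n) (0≤* (0≤ι 2) (0≤- 1+x≤k))) (0≤ι 2))
      0≤v-1 : 𝟘 ≤ v j - 𝟙
      0≤v-1 = subst (𝟘 ≤_) (sym (trans (cong (_- 𝟙) vx) (ring 2 (λ n x → n :- x :- # 1 := (n :- # 2 :* x :- # 1) :+ x) refl (ι n)
          x))) (0≤+ gap (0≤ι _))
      0≤u : 𝟘 ≤ v j * (v j - 𝟙)
      0≤u = 0≤* (0≤ι _) 0≤v-1
      0≤4u-Q : 𝟘 ≤ ι 4 * (v j * (v j - 𝟙)) - Q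
      0≤4u-Q = subst (𝟘 ≤_) (sym (trans (cong (λ v → ι 4 * (v * (v - 𝟙)) - Q) vx)
         (ring 2 (λ n x → # 4 :* ((n :- x) :* (n :- x :- # 1)) :- n :* (n :- # 1) := (n :- # 2 :* x :- # 1 :+ # 1) :*
             (# 2 :* (n :- # 2 :* x :- # 1 :+ x)) :+ n :* (n :- # 2 :* x :- # 1)) refl (ι n) x)))
         (0≤+ (0≤* (0≤+ gap (0≤ι 1)) (0≤* (0≤ι 2) (0≤+ gap (0≤ι _)))) (0≤* (0≤ι n) gap))

    -- `T-lower` and `T-upper` at stage J give J · Wt ≤ 8n(n-1)H/Nb. Then 2J ≥ k turns 8 into 16,
    -- and k · Nb = n · M absorbs the factor k.
    Wt-bound : M * Wt ≤ ι 16 * (ι n * H)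
    Wt-bound = ℚ.≤-trans (*-cancel-≤ (ι n * (ι J * Nn J)) (0<* (0<ι-suc (suc N)) (0<* 0<J 0<N)) (≤-cert
        _
        (trans (ring 6 (λ n J N H M W → n :* (J :* N) :* (# 16 :* ((n :- # 1) :* H)) :- n :* (J :* N) :* (M :* W) := # 16 :*
            (n :* (n :- # 1)) :* (J :* (N :* H)) :- J :* N :* W :* (n :* M)) refl (ι n) (ι J) (Nn J) H M Wt)
        (trans (cong (λ t → ι 16 * Q * (ι J * (Nn J * H)) - ι J * Nn J * Wt * t) (sym k*Nb))
          (ring 8 (λ Q J N H k b T W → # 16 :* Q :* (J :* (N :* H)) :- J :* N :* W :* (k :* b) := # 8 :* (Q :* (N :* H)) :*
              (J :+ J :- k) :+ (# 2 :* Q :* k :* (# 4 :* (N :* H) :- b :* T) :+ k :* b :* (# 2 :* Q :* T :- J :* (W :* N)))) refl Q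
              (ι J) (Nn J) H (ι k) Nb (T J) Wt)))
        (0≤+ (0≤* (0≤* (0≤ι 8) (0≤* 0≤Q (0≤* (ℚ.<⇒≤ 0<N) 0≤H))) (0≤- k≤2J))
            (0≤+ (0≤* (0≤* (0≤* (0≤ι 2) 0≤Q) (0≤ι k)) (0≤- (T-upper J J≤k)))
            (0≤* (0≤* (0≤ι k) (0≤bin n k)) (0≤- (T-lower J T-small J ℕ.≤-refl)))))))
      (≤-cert _ (ring 2 (λ n H → # 16 :* (n :* H) :- # 16 :* ((n :- # 1) :* H) := # 16 :* H) refl (ι n) H) (0≤* (0≤ι 16) 0≤H))
      where
      lo : k ≤ℕ J +ℕ J
      lo = proj₁ (proj₂ (ceil-half k))
      hi : J +ℕ J ≤ℕ suc k
      hi = proj₂ (proj₂ (ceil-half k))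
      k≤2J : ι k ≤ ι J + ι J
      k≤2J = subst (ι k ≤_) (ι-+ J J) (ι-mono lo)
      1≤J : 1 ≤ℕ J
      1≤J = halve J (ℕ.≤-trans (s≤s z≤n) lo)
        where
        halve : ∀ j → 1 ≤ℕ j +ℕ j → 1 ≤ℕ j
        halve (suc j) _ = s≤s z≤n
      J≤k : J ≤ℕ k
      J≤k = s≤s⁻¹ (ℕ.≤-trans (ℕ.+-monoˡ-≤ J 1≤J) hi)
      0<J : 𝟘 < ι J
      0<J = ℚ.<-≤-trans 0<1 (ι-mono 1≤J)
      0<N : 𝟘 < Nn J
      0<N = 0<fall n (J +ℕ J) (ℕ.≤-trans hi (ℕ.≤-trans (s≤s (ℕ.m≤m+n k k)) k+k<n))

    M⁻¹ : ℚ
    M⁻¹ = proj₁ (recip M 0<M)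

    M*M⁻¹ : ∀ x → M * (M⁻¹ * x) ≡ x
    M*M⁻¹ x = trans (sym (*-assoc _ _ _)) (trans (cong (_* x) (proj₂ (recip M 0<M))) (*-identityˡ x))

    -- Averaging the double sum `Wt` over its second index finds a coefficient that serves as common
    -- shift.
    base : Σ ℚ λ y → FS c (blank n) (λ a → ψ (a - y)) ≤ M⁻¹ * (ι 16 * H)
    base = pick c (λ y → FS c (blank n) (λ a → ψ (a - y))) _ (subst (_≤ ι n * (M⁻¹ * (ι 16 * H)))
        (FS-swap c (blank n) c (blank n) (λ a b → ψ (a - b)))
      (*-cancel-≤ M 0<M (ℚ.≤-trans Wt-bound (ℚ.≤-reflexive (trans (ring 2 (λ n H → # 16 :* (n :* H) := n :* (# 16 :* H)) refl (ι n)
          H) (trans (cong (ι n *_) (sym (M*M⁻¹ _))) (ring 3 (λ n M x → n :* (M :* x) := M :* (n :* x)) refl (ι n) M _)))))))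

    -- Centring makes `r′` sum to zero, which removes the (M - K) term of `sum-wt-wt`; that term
    -- could cost a factor k. The mean goes into the constant: on k-sets, wt c = κ₀ + wt t + wt r′.
    y r̄ κ₀ : ℚ
    y = proj₁ base
    t : Vec ℤ n
    t = map (λ a → nearest (a - y)) c
    r r′ : Vec ℚ n
    r = map (λ a → rem (a - y)) c
    r̄ = proj₁ (recip (ι n) (0<ι-suc (suc N))) * tot r
    r′ = map (λ x → 𝟙 * (x - r̄)) r
    κ₀ = ι k * y + ι k * r̄

    n*r̄ : ι n * r̄ ≡ tot r
    n*r̄ = trans (sym (*-assoc _ _ _)) (trans (cong (_* tot r) (proj₂ (recip (ι n) (0<ι-suc (suc N))))) (*-identityˡ _))

    tot-r′ : tot r′ ≡ 𝟘
    tot-r′ = trans (tot-affine 𝟙 r̄ r) (trans (cong (λ z → 𝟙 * (tot r - z)) n*r̄) (ring 1 (λ x → # 1 :* (x :- x) := # 0) refl _))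

    dot-r : M * dot r r ≤ ι 32 * H
    dot-r = ℚ.≤-trans (*-monoˡ M (ℚ.<⇒≤ 0<M) (ℚ.≤-trans (rem-dot c y) (*-monoˡ 𝟚 (0≤ι 2) (proj₂ base))))
      (ℚ.≤-reflexive (trans (ring 2 (λ M x → M :* (# 2 :* x) := # 2 :* (M :* x)) refl M _)
          (trans (cong (𝟚 *_) (M*M⁻¹ _)) (ring 1 (λ H → # 2 :* (# 16 :* H) := # 32 :* H) refl H))))

    dot-r′ : dot r′ r′ ≡ dot r r - ι n * (r̄ * r̄)
    dot-r′ = trans (dot-affine 𝟙 r̄ r r′) (trans (cong₂ (λ u w → 𝟙 * (u - r̄ * w)) (trans (dot-comm r r′) (dot-affine 𝟙 r̄ r r))
        tot-r′)
       (trans (cong (λ u → 𝟙 * (𝟙 * (dot r r - r̄ * u) - r̄ * 𝟘)) (sym n*r̄))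
           (ring 3 (λ d n r → # 1 :* (# 1 :* (d :- r :* (n :* r)) :- r :* # 0) := d :- n :* (r :* r)) refl (dot r r) (ι n) r̄)))

    0≤dot : ∀ {n} (v : Vec ℚ n) → 𝟘 ≤ dot v v
    0≤dot [] = ℚ.≤-refl
    0≤dot (x ∷ v) = 0≤+ (0≤sq x) (0≤dot v)

    r′-norm : sumS (λ S → lev k S * (wt r′ S * wt r′ S)) ≤ ι 32 * H
    r′-norm = ℚ.≤-trans (ℚ.≤-reflexive (trans (sum-wt-wt k′ r′ r′) (trans (cong₂ (λ u w → K * u + (M - K) * (w * w)) dot-r′ tot-r′)
        (ring 4 (λ K M d e → K :* (d :- e) :+ (M :- K) :* (# 0 :* # 0) := K :* (d :- e)) refl K M (dot r r) (ι n * (r̄ * r̄))))))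
      (ℚ.≤-trans (≤-cert _ (ring 4 (λ K M d e → M :* d :- K :* (d :- e) := (M :- K) :* d :+ K :* e) refl K M (dot r r)
          (ι n * (r̄ * r̄)))
        (0≤+ (0≤* (0≤- (bin-mono N k′)) (0≤dot r)) (0≤* (ℚ.<⇒≤ 0<K) (0≤* (0≤ι n) (0≤sq r̄))))) dot-r)

    m : ℤ
    m = nearest κ₀

    u : Subset n → ℚ
    u S = ζ m + wt (map ζ t) S

    -- The integer m is no farther from κ₀ than the integer f - wt t is, so rounding κ₀ at most
    -- doubles the deviation `Dev`. As `Dev` = e₁ + e₂, its square costs another factor 2, which
    -- makes 4 · 2 = 8.
    pointwise : ∀ S → lev k S * ((f S - u S) * (f S - u S)) ≤ ι 8 * (lev k S * Hf S) + ι 8 * (lev k S * (wt r′ S * wt r′ S))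
    pointwise S = ℚ.≤-trans (lev-≤ k S core) (ℚ.≤-reflexive (ring 3 (λ l a b → l :* (# 8 :* a :+ # 8 :* b) := # 8 :* (l :* a) :+ # 8
        :* (l :* b)) refl (lev k S) (Hf S) (wt r′ S * wt r′ S)))
      where
      e₁ e₂ Dev R : ℚ
      e₁ = f S - wt c S
      e₂ = wt r′ S
      Dev = f S - wt (map ζ t) S - κ₀
      R = rem κ₀
      fu : f S - u S ≡ Dev + R
      fu = ring 4 (λ f m w κ → f :- (m :+ w) := (f :- w :- κ) :+ (κ :- m)) refl (f S) (ζ m) (wt (map ζ t) S) κ₀
      D≡ : size S ≡ k → Dev ≡ e₁ + e₂
      D≡ p = sym (trans (cong₂ (λ v w → f S - v + w) (trans (wt-round c y S) (cong (λ z → ι z * y + (wt (map ζ t) S + wt r S)) p))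
          (trans (wt-shift r r̄ S) (cong (λ z → wt r S - ι z * r̄) p)))
        (ring 6 (λ f k y t r e → f :- (k :* y :+ (t :+ r)) :+ (r :- k :* e) := f :- t :- (k :* y :+ k :* e)) refl (f S) (ι k) y
            (wt (map ζ t) S) (wt r S) r̄))
      R≤D : R * R ≤ Dev * Dev
      R≤D = subst (R * R ≤_) (trans (cong (λ z → (κ₀ - z) * (κ₀ - z)) (trans (ζ-- (fz S) (wtℤ t S))
          (sym (cong₂ _-_ (f≡ζ S) (wt-ζ t S)))))
        (ring 3 (λ f w κ → (κ :- (f :- w)) :* (κ :- (f :- w)) := (f :- w :- κ) :* (f :- w :- κ)) refl (f S) (wt (map ζ t) S) κ₀))
            (rem-nearest κ₀ (fz S ℤ.- wtℤ t S))
      core : size S ≡ k → (f S - u S) * (f S - u S) ≤ ι 8 * (e₁ * e₁) + ι 8 * (e₂ * e₂)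
      core p = ≤-cert
          _
          (trans (cong (λ x → (ι 8 * (e₁ * e₁) + ι 8 * (e₂ * e₂)) - x * x) fu)
          (trans (ring 4 (λ a b D R → (# 8 :* (a :* a) :+ # 8 :* (b :* b)) :- (D :+ R) :* (D :+ R)
              := # 4 :* (# 2 :* (a :* a) :+ # 2 :* (b :* b) :- D :* D) :+
                  ((# 2 :* (D :* D) :+ # 2 :* (R :* R) :- (D :+ R) :* (D :+ R)) :+ # 2 :* (D :* D :- R :* R))) refl e₁ e₂ Dev R)
            (cong (λ x → ι 4 * (𝟚 * (e₁ * e₁) + 𝟚 * (e₂ * e₂) - x * x) +
                ((𝟚 * (Dev * Dev) + 𝟚 * (R * R) - (Dev + R) * (Dev + R)) + 𝟚 * (Dev * Dev - R * R))) (D≡ p))))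
          (0≤+ (0≤* (0≤ι 4) (0≤- (sq-+ e₁ e₂))) (0≤+ (0≤- (sq-+ Dev R)) (0≤* (0≤ι 2) (0≤- R≤D))))

    -- The constant is 8 + 8 · 32, from `pointwise` and `r′-norm`.
    rounding : sumS (λ S → lev k S * ((f S - u S) * (f S - u S))) ≤ ι 264 * H
    rounding = ℚ.≤-trans (sumS-mono pointwise) (ℚ.≤-trans (ℚ.≤-reflexive
        (trans (sumS-lin (ι 8) (ι 8) _ _) (cong (λ z → ι 8 * z + ι 8 * sumS (λ S → lev k S * (wt r′ S * wt r′ S))) levH)))
      (ℚ.≤-trans (+-mono-≤ ℚ.≤-refl (*-monoˡ (ι 8) (0≤ι 8) r′-norm)) (ℚ.≤-reflexive
          (ring 1 (λ H → # 8 :* H :+ # 8 :* (# 32 :* H) := # 264 :* H) refl H))))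

  -- Recovering the union of stars

  unit : ∀ {n} → Fin n → Vec ℚ n
  unit {suc n} fzero = 𝟙 ∷ replicate n 𝟘
  unit (fsuc i) = 𝟘 ∷ unit i

  tot-zeros : ∀ n → tot (replicate n 𝟘) ≡ 𝟘
  tot-zeros zero = refl
  tot-zeros (suc n) = trans (+-identityˡ _) (tot-zeros n)

  dot-zeros : ∀ {n} (v : Vec ℚ n) → dot (replicate n 𝟘) v ≡ 𝟘
  dot-zeros [] = refl
  dot-zeros (x ∷ v) = trans (cong₂ _+_ (zeroˡ x) (dot-zeros v)) (+-identityˡ _)

  wt-zeros : ∀ {n} (S : Subset n) → wt (replicate n 𝟘) S ≡ 𝟘
  wt-zeros [] = refl
  wt-zeros (true ∷ S) = trans (+-identityˡ _) (wt-zeros S)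
  wt-zeros (false ∷ S) = wt-zeros S

  tot-unit : ∀ {n} (i : Fin n) → tot (unit i) ≡ 𝟙
  tot-unit {suc n} fzero = trans (cong (𝟙 +_) (tot-zeros n)) (+-identityʳ 𝟙)
  tot-unit (fsuc i) = trans (+-identityˡ _) (tot-unit i)

  dot-unit : ∀ {n} (i : Fin n) (v : Vec ℚ n) → dot (unit i) v ≡ lookup v i
  dot-unit fzero (x ∷ v) = trans (cong₂ _+_ (*-identityˡ x) (dot-zeros v)) (+-identityʳ x)
  dot-unit (fsuc i) (x ∷ v) = trans (cong (_+ dot (unit i) v) (zeroˡ x)) (trans (+-identityˡ _) (dot-unit i v))

  Zero-one : ℚ → Set
  Zero-one x = (x ≡ 𝟘) ⊎ (x ≡ 𝟙)

  0≤01 : ∀ {x} → Zero-one x → 𝟘 ≤ x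
  0≤01 (inj₁ e) = ℚ.≤-reflexive (sym e)
  0≤01 (inj₂ e) = subst (𝟘 ≤_) (sym e) (0≤ι 1)

  wt-unit : ∀ {n} (i : Fin n) S → Zero-one (wt (unit i) S)
  wt-unit fzero (true ∷ S) = inj₂ (trans (cong (𝟙 +_) (wt-zeros S)) (+-identityʳ 𝟙))
  wt-unit fzero (false ∷ S) = inj₁ (wt-zeros S)
  wt-unit (fsuc i) (true ∷ S) with wt-unit i S
  ... | inj₁ e = inj₁ (trans (+-identityˡ _) e)
  ... | inj₂ e = inj₂ (trans (+-identityˡ _) e)
  wt-unit (fsuc i) (false ∷ S) = wt-unit i S

  lookup-unit : ∀ {n} (i j : Fin n) → 𝟘 ≤ lookup (unit i) j
  lookup-unit fzero fzero = 0≤ι 1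
  lookup-unit {suc n} fzero (fsuc j) = ℚ.≤-reflexive (sym (lookup-replicate j 𝟘))
  lookup-unit (fsuc i) fzero = ℚ.≤-refl
  lookup-unit (fsuc i) (fsuc j) = lookup-unit i j

  0≤z²-z : ∀ z → 𝟘 ≤ ζ z * ζ z - ζ z
  0≤z²-z (ℤ.+ zero) = ℚ.≤-reflexive (ring 0 (# 0 := # 0 :* # 0 :- # 0) refl)
  0≤z²-z (ℤ.+ suc m) = subst (𝟘 ≤_) (ring 1 (λ w → w :* (w :- # 1) := w :* w :- w) refl (ι (suc m))) (0≤* (0≤ι _) (0≤- (1≤ι-suc m)))
  0≤z²-z (ℤ.-[1+ m ]) = subst (𝟘 ≤_) (trans (ring 1 (λ w → w :* w :+ w := (:- w) :* (:- w) :- (:- w)) refl (ι (suc m)))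
      (cong (λ t → t * t - t) (sym (ζ-neg-suc m)))) (0≤+ (0≤sq _) (0≤ι _))

  0≤z²+z : ∀ z → 𝟘 ≤ ζ z * ζ z + ζ z
  0≤z²+z z = subst (𝟘 ≤_) (trans (cong (λ t → t * t - t) (ζ-neg z)) (ring 1 (λ w → (:- w) :* (:- w) :- (:- w) := w :* w :+ w) refl
      (ζ z))) (0≤z²-z (ℤ.- z))

  minimum : ∀ {n} (t : Vec ℤ (suc n)) → Σ ℤ λ τ → (Σ (Fin (suc n)) λ i → lookup t i ≡ τ) × (∀ j → τ ℤ.≤ lookup t j)
  minimum (x ∷ []) = x , (fzero , refl) , λ { fzero → ℤ.≤-refl }
  minimum (x ∷ t@(_ ∷ _)) with minimum t
  ... | τ , (i , e) , min with ℤ.≤-total x τ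
  ... | inj₁ p = x , (fzero , refl) , λ { fzero → ℤ.≤-refl ; (fsuc j) → ℤ.≤-trans p (min j) }
  ... | inj₂ p = τ , (fsuc i , e) , λ { fzero → p ; (fsuc j) → min j }

  ind : ∀ {n} → Subset n → Vec ℚ n
  ind = map (λ b → if b then 𝟙 else 𝟘)

  above : ∀ {n} → ℤ → Vec ℤ n → Subset n
  above τ = map (λ x → not (does (x ℤ.≟ τ)))

  wt-above : ∀ {n} τ (t : Vec ℤ n) → (∀ j → (lookup t j ≡ τ) ⊎ (lookup t j ≡ τ ℤ.+ ℤ.+ 1)) → ∀ S → wt (map ζ t) S ≡ ι (size S) * ζ τ
      + wt (ind (above τ t)) S
  wt-above τ [] e [] = ring 1 (λ x → # 0 := # 0 :* x :+ # 0) refl (ζ τ)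
  wt-above τ (x ∷ t) e (false ∷ S) = wt-above τ t (λ j → e (fsuc j)) S
  wt-above τ (x ∷ t) e (true ∷ S) = trans (cong (ζ x +_) (wt-above τ t (λ j → e (fsuc j)) S))
      (trans (cong (_+ (ι (size S) * ζ τ + wt (ind (above τ t)) S)) val)
      (trans (ring 4 (λ τ i s w → (τ :+ i) :+ (s :* τ :+ w) := (# 1 :+ s) :* τ :+ (i :+ w)) refl (ζ τ) _ (ι (size S)) _)
          (cong (_+ (indicator + wt (ind (above τ t)) S)) (cong (_* ζ τ) (sym (ι-suc (size S)))))))
    where
    indicator : ℚ
    indicator = if not (does (x ℤ.≟ τ)) then 𝟙 else 𝟘
    val : ζ x ≡ ζ τ + indicator
    val with x ℤ.≟ τ | e fzero
    ... | yes p | _ = trans (cong ζ p) (sym (+-identityʳ _))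
    ... | no p | inj₁ q = ⊥-elim (p q)
    ... | no p | inj₂ q = trans (cong ζ q) (ζ-+ τ (ℤ.+ 1))

  tot-ind : ∀ {n} (T : Subset n) → tot (ind T) ≡ ι (size T)
  tot-ind [] = refl
  tot-ind (true ∷ T) = trans (cong (𝟙 +_) (tot-ind T)) (sym (ι-suc (size T)))
  tot-ind (false ∷ T) = trans (+-identityˡ _) (tot-ind T)

  dot-ind : ∀ {n} (T : Subset n) → dot (ind T) (ind T) ≡ ι (size T)
  dot-ind [] = refl
  dot-ind (true ∷ T) = trans (cong₂ _+_ (*-identityˡ 𝟙) (dot-ind T)) (sym (ι-suc (size T)))
  dot-ind (false ∷ T) = trans (cong (_+ dot (ind T) (ind T)) (zeroˡ 𝟘)) (trans (+-identityˡ _) (dot-ind T))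

  wt-ind-∁ : ∀ {n} (T S : Subset n) → wt (ind T) S + wt (ind (∁ T)) S ≡ ι (size S)
  wt-ind-∁ [] [] = +-identityʳ 𝟘
  wt-ind-∁ (true ∷ T) (true ∷ S) = trans (ring 2 (λ a b → (# 1 :+ a) :+ (# 0 :+ b) := # 1 :+ (a :+ b)) refl _ _)
      (trans (cong (𝟙 +_) (wt-ind-∁ T S)) (sym (ι-suc (size S))))
  wt-ind-∁ (false ∷ T) (true ∷ S) = trans (ring 2 (λ a b → (# 0 :+ a) :+ (# 1 :+ b) := # 1 :+ (a :+ b)) refl _ _)
      (trans (cong (𝟙 +_) (wt-ind-∁ T S)) (sym (ι-suc (size S))))
  wt-ind-∁ (true ∷ T) (false ∷ S) = wt-ind-∁ T S
  wt-ind-∁ (false ∷ T) (false ∷ S) = wt-ind-∁ T S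

  wt-single : ∀ {n} (T S : Subset n) → size T ≤ℕ 1 → Zero-one (wt (ind T) S)
  wt-single [] [] p = inj₁ refl
  wt-single (false ∷ T) (true ∷ S) p with wt-single T S p
  ... | inj₁ e = inj₁ (trans (+-identityˡ _) e)
  ... | inj₂ e = inj₂ (trans (+-identityˡ _) e)
  wt-single (false ∷ T) (false ∷ S) p = wt-single T S p
  wt-single (true ∷ T) (false ∷ S) (s≤s p) = wt-single T S (ℕ.≤-trans p z≤n)
  wt-single (true ∷ T) (true ∷ S) (s≤s p) = inj₂ (trans (cong (𝟙 +_) (trans
      (cong (λ T → wt (ind T) S) (size≡0⇒none T (ℕ.n≤0⇒n≡0 p))) (ind-none S))) (+-identityʳ 𝟙))
    where
    ind-none : ∀ {n} (S : Subset n) → wt (ind (none n)) S ≡ 𝟘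
    ind-none [] = refl
    ind-none (true ∷ S) = trans (+-identityˡ _) (ind-none S)
    ind-none (false ∷ S) = ind-none S

  0≤Z : ∀ {n} {φ : Subset n → ℚ} → (∀ S → 𝟘 ≤ φ S) → ∀ G → 𝟘 ≤ Z φ G
  0≤Z p [] = p []
  0≤Z p (true ∷ G) = 0≤Z (λ S → p (false ∷ S)) G
  0≤Z p (false ∷ G) = 0≤+ (0≤Z (λ S → p (true ∷ S)) G) (0≤Z (λ S → p (false ∷ S)) G)

  module Endgame {N k′ d : ℕ} (n≡ : suc (suc N) ≡ suc k′ +ℕ (suc k′ +ℕ suc d)) (f : Subset (suc (suc N)) → ℚ)
    (f-Supp : Supp (suc k′) f) (fz : Subset (suc (suc N)) → ℤ) (f≡ζ : ∀ S → f S ≡ ζ (fz S)) (f01 : ∀ S → Zero-one (f S))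
    (s : ℚ) (Ms : Sizes.M n≡ * s ≡ sumS f) (m : ℤ) (t : Vec ℤ (suc (suc N)))
    (100E≤M : ι 100 * sumS (λ S → lev (suc k′) S * ((f S - (ζ m + wt (map ζ t) S)) * (f S - (ζ m + wt (map ζ t) S)))) ≤ Sizes.M n≡)
        where

    open Sizes n≡

    u : Subset n → ℚ
    u S = ζ m + wt (map ζ t) S

    -- M − K is the number of k-sets through two given points.
    Q : ℚ
    Q = M - K

    E : ℚ
    E = sumS (λ S → lev k S * ((f S - u S) * (f S - u S)))

    Q-M : (ι n - 𝟙) * Q ≡ (ι k - 𝟙) * M
    Q-M = trans (cong (λ x → (x - 𝟙) * Q) (ι-suc (suc N))) (trans (ring 4
        (λ n k M K → (# 1 :+ n :- # 1) :* (M :- K) := ((# 1 :+ k) :- # 1) :* M :+ ((n :- k) :* M :- n :* K)) refl (ι (suc N)) (ι k′)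
        M K)
       (trans (cong₂ (λ x y → (x - 𝟙) * M + (y - ι (suc N) * K)) (sym (ι-suc k′)) K-M)
           (ring 2 (λ a b → a :+ (b :- b) := a) refl _ _)))

    ez : Subset n → ℤ
    ez S = fz S ℤ.- (m ℤ.+ wtℤ t S)

    e-int : ∀ S → f S - u S ≡ ζ (ez S)
    e-int S = sym (trans (ζ-- (fz S) (m ℤ.+ wtℤ t S)) (cong₂ _-_ (sym (f≡ζ S))
        (trans (ζ-+ m (wtℤ t S)) (cong (ζ m +_) (sym (wt-ζ t S))))))

    0≤e²-e : ∀ S → 𝟘 ≤ (f S - u S) * (f S - u S) - (f S - u S)
    0≤e²-e S = subst (λ x → 𝟘 ≤ x * x - x) (sym (e-int S)) (0≤z²-z (ez S))

    0≤e²+e : ∀ S → 𝟘 ≤ (f S - u S) * (f S - u S) + (f S - u S)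
    0≤e²+e S = subst (λ x → 𝟘 ≤ x * x + x) (sym (e-int S)) (0≤z²+z (ez S))

    -- For bits, xφ - yφ ≤ x - xy. Replacing φ by w costs at most |φ - w|, and the two hypotheses
    -- say that this is at most (φ - w)², as it is for integers.
    swap-pointwise : ∀ {x y φ w} → Zero-one x → Zero-one y → Zero-one φ → 𝟘 ≤ (φ - w) * (φ - w) - (φ - w) → 𝟘 ≤ (φ - w) * (φ - w) +
        (φ - w) →
      x * w - y * w ≤ x - x * y + (φ - w) * (φ - w)
    swap-pointwise {φ = φ} {w} (inj₁ refl) (inj₁ refl) z p q = ≤-cert _ (ring 2
        (λ f w → (# 0 :- # 0 :* # 0 :+ (f :- w) :* (f :- w)) :- (# 0 :* w :- # 0 :* w) := (f :- w) :* (f :- w)) refl φ w) (0≤sq _)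
    swap-pointwise {φ = φ} {w} (inj₂ refl) (inj₂ refl) z p q = ≤-cert _ (ring 2
        (λ f w → (# 1 :- # 1 :* # 1 :+ (f :- w) :* (f :- w)) :- (# 1 :* w :- # 1 :* w) := (f :- w) :* (f :- w)) refl φ w) (0≤sq _)
    swap-pointwise {φ = φ} {w} (inj₂ refl) (inj₁ refl) z p q = ≤-cert _ (ring 2
        (λ f w → (# 1 :- # 1 :* # 0 :+ (f :- w) :* (f :- w)) :- (# 1 :* w :- # 0 :* w) := (# 1 :- f) :+
        ((f :- w) :* (f :- w) :+ (f :- w))) refl φ w) (0≤+ (0≤- (≤1 z)) q)
      where
      ≤1 : ∀ {φ} → Zero-one φ → φ ≤ 𝟙
      ≤1 (inj₁ refl) = 0≤ι 1
      ≤1 (inj₂ refl) = ℚ.≤-refl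
    swap-pointwise {φ = φ} {w} (inj₁ refl) (inj₂ refl) z p q = ≤-cert _ (ring 2
        (λ f w → (# 0 :- # 0 :* # 1 :+ (f :- w) :* (f :- w)) :- (# 0 :* w :- # 1 :* w) := f :+ ((f :- w) :* (f :- w) :- (f :- w)))
        refl φ w) (0≤+ (0≤01 z) p)

    x[_] : Fin n → Subset n → ℚ
    x[ i ] = wt (unit i)

    moment : ∀ i → sumS (λ S → lev k S * (x[ i ] S * u S)) ≡ ζ m * M + (K * ζ (lookup t i) + Q * tot (map ζ t))
    moment i = trans (sumS-cong (λ S → ring 4 (λ l x m w → l :* (x :* (m :+ w)) := m :* (l :* x) :+ # 1 :* (l :* (x :* w))) refl
        (lev k S) (x[ i ] S) (ζ m) (wt (map ζ t) S)))
      (trans (sumS-lin (ζ m) 𝟙 _ _) (cong₂ (λ x y → ζ m * x + y) (trans (sum-wt k′ (unit i))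
          (trans (cong (M *_) (tot-unit i)) (*-identityʳ M)))
        (trans (*-identityˡ _) (trans (sum-wt-wt k′ (unit i) (map ζ t)) (cong₂ (λ x y → K * x + Q * y)
            (trans (dot-unit i (map ζ t)) (lookup-map i ζ t)) (trans (cong (_* tot (map ζ t)) (tot-unit i)) (*-identityˡ _)))))))

    -- The left side is the correlation of u with x[ i ] − x[ j ]; replacing u by the Boolean f makes
    -- it at most K, at the cost of E.
    t-gap : ∀ i j → K * (ζ (lookup t i) - ζ (lookup t j)) ≤ K + E
    t-gap i j = ℚ.≤-trans (ℚ.≤-reflexive (sym lhs)) (ℚ.≤-trans (sumS-mono pt) (ℚ.≤-trans (ℚ.≤-reflexive rhs)
        (≤-cert _ (ring 4 (λ M K x E → (K :+ E) :- ((M :- (K :* x :+ (M :- K))) :+ E) := K :* x) refl M K (dot (unit i) (unit j)) E)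
          (0≤* (ℚ.<⇒≤ 0<K) (subst (𝟘 ≤_) (sym (dot-unit i (unit j))) (lookup-unit j i))))))
      where
      lhs : sumS (λ S → lev k S * (x[ i ] S * u S) - lev k S * (x[ j ] S * u S)) ≡ K * (ζ (lookup t i) - ζ (lookup t j))
      lhs = trans (sumS-sub _ _) (trans (cong₂ _-_ (moment i) (moment j))
          (ring 5 (λ a K x y q → (a :+ (K :* x :+ q)) :- (a :+ (K :* y :+ q)) := K :* (x :- y)) refl (ζ m * M) K _ _ _))
      pt : ∀ S → lev k S * (x[ i ] S * u S) - lev k S * (x[ j ] S * u S) ≤ (lev k S * x[ i ] S - lev k S * (x[ i ] S * x[ j ] S)) +
          lev k S * ((f S - u S) * (f S - u S))
      pt S = subst₂ _≤_ (ring 4 (λ l x y u → l :* (x :* u :- y :* u) := l :* (x :* u) :- l :* (y :* u)) refl (lev k S) (x[ i ] S)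
          (x[ j ] S) (u S))
        (ring 4 (λ l x y e → l :* (x :- x :* y :+ e) := (l :* x :- l :* (x :* y)) :+ l :* e) refl (lev k S) (x[ i ] S) (x[ j ] S) _)
        (*-monoˡ (lev k S) (0≤lev k S) (swap-pointwise (wt-unit i S) (wt-unit j S) (f01 S) (0≤e²-e S) (0≤e²+e S)))
      rhs : sumS (λ S → (lev k S * x[ i ] S - lev k S * (x[ i ] S * x[ j ] S)) + lev k S * ((f S - u S) * (f S - u S))) ≡
          (M - (K * dot (unit i) (unit j) + Q)) + E
      rhs = trans (sumS-+ _ _) (cong (_+ E) (trans (sumS-sub _ _) (cong₂ _-_
          (trans (sum-wt k′ (unit i)) (trans (cong (M *_) (tot-unit i)) (*-identityʳ M)))
        (trans (sum-wt-wt k′ (unit i) (unit j)) (cong (K * dot (unit i) (unit j) +_)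
            (trans (cong (Q *_) (trans (cong₂ _*_ (tot-unit i) (tot-unit j)) (*-identityˡ 𝟙))) (*-identityʳ Q)))))))

    1+2k≤n : 𝟙 + 𝟚 * ι k ≤ ι n
    1+2k≤n = ≤-cert (ι d) (trans (cong₂ (λ x y → x - (𝟙 + 𝟚 * y)) ιn (ι-suc k′))
        (trans (cong (λ z → (𝟙 + ι k′) + ((𝟙 + ι k′) + z) - (𝟙 + 𝟚 * (𝟙 + ι k′))) (ι-suc d))
        (ring 2 (λ k d → (# 1 :+ k) :+ ((# 1 :+ k) :+ (# 1 :+ d)) :- (# 1 :+ # 2 :* (# 1 :+ k)) := d) refl (ι k′) (ι d)))) (0≤ι d)

    0<n-1 : 𝟘 < ι n - 𝟙
    0<n-1 = subst (𝟘 <_) (trans (ring 1 (λ x → x := # 1 :+ x :- # 1) refl (ι (suc N))) (cong (_- 𝟙) (sym (ι-suc (suc N)))))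
        (0<ι-suc N)

    M≤2K : M ≤ 𝟚 * K
    M≤2K = *-cancel-≤ (ι n - 𝟙) 0<n-1 (≤-cert _
      (trans (ring 3 (λ n M K → (n :- # 1) :* (# 2 :* K) :- (n :- # 1) :* M := (n :- # 1) :* M :- # 2 :* ((n :- # 1) :* (M :- K)))
          refl (ι n) M K) (trans (cong (λ z → (ι n - 𝟙) * M - 𝟚 * z) Q-M)
          (ring 3 (λ n k M → (n :- # 1) :* M :- # 2 :* ((k :- # 1) :* M) := (n :- (# 1 :+ # 2 :* k)) :* M :+ # 2 :* M) refl (ι n)
          (ι k) M)))
      (0≤+ (0≤* (0≤- 1+2k≤n) (ℚ.<⇒≤ 0<M)) (0≤* (0≤ι 2) (ℚ.<⇒≤ 0<M))))

    -- A difference of 2 or more would give K ≤ E by `t-gap`, but E ≤ M/100 ≤ K/50.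
    t-near : ∀ i j → lookup t i ℤ.≤ lookup t j ℤ.+ ℤ.+ 1
    t-near i j with ℤ.≤-total (lookup t i) (lookup t j ℤ.+ ℤ.+ 1) | lookup t i ℤ.≟ lookup t j ℤ.+ ℤ.+ 1
    ... | inj₁ p | _ = p
    ... | inj₂ p | yes q = ℤ.≤-reflexive q
    ... | inj₂ p | no q = ⊥-elim (<⇒≱ 0<M (*-cancel-≤ (ι 98) (0<ι-suc 97) (≤-cert _
           (ring 5 (λ M E K x y → # 98 :* # 0 :- # 98 :* M := # 2 :* (M :- # 100 :* E) :+
               (# 100 :* (# 2 :* K :- M) :+ # 200 :* ((K :+ E :- K :* (x :- y)) :+ K :* (x :- (y :+ # 1 :+ # 1))))) refl M E K ti
               tj)
           (0≤+ (0≤* (0≤ι 2) (0≤- 100E≤M)) (0≤+ (0≤* (0≤ι 100) (0≤- M≤2K))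
               (0≤* (0≤ι 200) (0≤+ (0≤- (t-gap i j)) (0≤* (ℚ.<⇒≤ 0<K) (0≤- far)))))))))
      where
      ti tj : ℚ
      ti = ζ (lookup t i)
      tj = ζ (lookup t j)
      far : tj + 𝟙 + 𝟙 ≤ ti
      far = subst (_≤ ti) (trans (ζ-+ (lookup t j ℤ.+ ℤ.+ 1) (ℤ.+ 1)) (cong (_+ 𝟙) (ζ-+ (lookup t j) (ℤ.+ 1))))
         (ζ-mono (subst (ℤ._≤ lookup t i) (ℤ.+-comm (ℤ.+ 1) (lookup t j ℤ.+ ℤ.+ 1)) (ℤ.i<j⇒suc[i]≤j (ℤ.≤∧≢⇒< p (λ e → q (sym e))))))

    τ : ℤ
    τ = proj₁ (minimum t)

    two-values : ∀ j → (lookup t j ≡ τ) ⊎ (lookup t j ≡ τ ℤ.+ ℤ.+ 1)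
    two-values j with lookup t j ℤ.≟ τ
    ... | yes p = inj₁ p
    ... | no p = inj₂ (ℤ.≤-antisym upper (subst (ℤ._≤ lookup t j) (ℤ.+-comm (ℤ.+ 1) τ)
        (ℤ.i<j⇒suc[i]≤j (ℤ.≤∧≢⇒< (proj₂ (proj₂ (minimum t)) j) (λ e → p (sym e))))))
      where
      upper : lookup t j ℤ.≤ τ ℤ.+ ℤ.+ 1
      upper = subst (λ z → lookup t j ℤ.≤ z ℤ.+ ℤ.+ 1) (proj₂ (proj₁ (proj₂ (minimum t))))
          (t-near j (proj₁ (proj₁ (proj₂ (minimum t)))))

    T : Subset n
    T = above τ t

    -- Every k-set collects k copies of the minimum τ, so these join the constant and |S ∩ T|
    -- remains.
    m₁ : ℤ
    m₁ = m ℤ.+ (ℤ.+ k) ℤ.* τ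

    μ p : ℚ
    μ = ζ m₁
    p = ι (size T)

    z : Subset n → ℚ
    z S = wt (ind T) S

    u≡ : ∀ S → size S ≡ k → u S ≡ μ + z S
    u≡ S e = trans (cong (ζ m +_) (trans (wt-above τ t two-values S) (cong (λ x → ι x * ζ τ + z S) e)))
        (trans (sym (+-assoc _ _ _)) (cong (_+ z S) (sym (trans (ζ-+ m _) (cong (ζ m +_) (ζ-* (ℤ.+ k) τ))))))

    E≡ : E ≡ sumS (λ S → lev k S * ((f S - (μ + z S)) * (f S - (μ + z S))))
    E≡ = sumS-cong (λ S → onLevel k S (λ e → cong (λ x → (f S - x) * (f S - x)) (u≡ S e)))

    sum-u : sumS (λ S → lev k S * u S) ≡ μ * Nb + p * M
    sum-u = trans (sumS-cong (λ S → trans (onLevel k S (u≡ S)) (ring 3 (λ l m z → l :* (m :+ z) := m :* l :+ # 1 :* (l :* z)) refl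
        (lev k S) μ (z S))))
      (trans (sumS-lin μ 𝟙 _ _) (cong₂ (λ x y → μ * x + y) (sum-lev n k)
          (trans (*-identityˡ _) (trans (sum-wt k′ (ind T)) (trans (cong (M *_) (tot-ind T)) (*-comm M p))))))

    sum-u² : sumS (λ S → lev k S * (u S * u S)) ≡ μ * μ * Nb + 𝟚 * μ * p * M + (K * p + Q * (p * p))
    sum-u² = trans (sumS-cong (λ S → trans (onLevel k S (λ e → cong₂ _*_ (u≡ S e) (u≡ S e)))
        (ring 3 (λ l m z → l :* ((m :+ z) :* (m :+ z)) := (m :* m :* l :+ # 2 :* m :* (l :* z)) :+
        (# 1 :* (l :* (z :* z)) :+ # 0 :* l)) refl (lev k S) μ (z S))))
      (trans (sumS-lin4 (μ * μ) (𝟚 * μ) 𝟙 𝟘 _ _ _ _) (trans (cong₂ _+_ (cong₂ (λ x y → μ * μ * x + 𝟚 * μ * y) (sum-lev n k)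
          (trans (sum-wt k′ (ind T)) (cong (M *_) (tot-ind T))))
         (cong (λ x → 𝟙 * x + 𝟘 * sumS {n} (lev k)) (trans (sum-wt-wt k′ (ind T) (ind T))
             (cong₂ (λ x y → K * x + Q * y) (dot-ind T) (cong₂ _*_ (tot-ind T) (tot-ind T))))))
        (ring 7 (λ m N M p K Q x → (m :* m :* N :+ # 2 :* m :* (M :* p)) :+ (# 1 :* (K :* p :+ Q :* (p :* p)) :+ # 0 :* x) := m :* m
            :* N :+ # 2 :* m :* p :* M :+ (K :* p :+ Q :* (p :* p))) refl μ Nb M p K Q (sumS {n} (lev k)))))

    sum-f : sumS (λ S → lev k S * f S) ≡ M * s
    sum-f = trans (sumS-cong (Supp-lev f-Supp)) (sym Ms)

    first-lower : μ * Nb + p * M ≤ M * s + E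
    first-lower = subst₂ _≤_ sum-u (trans (sumS-+ _ _) (cong (_+ E) sum-f)) (sumS-mono (λ S → ≤-cert _
      (ring 4 (λ l f u e → (l :* f :+ l :* e) :- l :* u := l :* (e :+ (f :- u))) refl (lev k S) (f S) (u S) _)
          (0≤* (0≤lev k S) (0≤e²+e S))))

    first-upper : M * s ≤ μ * Nb + p * M + E
    first-upper = subst₂ _≤_ sum-f (trans (sumS-+ _ _) (cong (_+ E) sum-u)) (sumS-mono (λ S → ≤-cert _
      (ring 4 (λ l f u e → (l :* u :+ l :* e) :- l :* f := l :* (e :- (f :- u))) refl (lev k S) (f S) (u S) _)
          (0≤* (0≤lev k S) (0≤e²-e S))))

    -- The function u is almost Boolean: with e = f - u and f in {0, 1}, u² - u = e² ± e ≤ 2e². The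
    -- left side is the sum of u² - u over the k-sets, computed from its two moments.
    second : μ * (μ - 𝟙) * Nb + 𝟚 * μ * p * M + Q * (p * (p - 𝟙)) ≤ 𝟚 * E
    second = subst₂ _≤_ (trans (sumS-sub _ _) (trans (cong₂ _-_ sum-u² sum-u)
        (ring 5 (λ m N p M K → m :* m :* N :+ # 2 :* m :* p :* M :+ (K :* p :+ (M :- K) :* (p :* p)) :- (m :* N :+ p :* M) := m :*
        (m :- # 1) :* N :+ # 2 :* m :* p :* M :+ (M :- K) :* (p :* (p :- # 1))) refl μ Nb p M K)))
        (sumS-* 𝟚 _) (sumS-mono pt)
      where
      pt : ∀ S → lev k S * (u S * u S) - lev k S * u S ≤ 𝟚 * (lev k S * ((f S - u S) * (f S - u S)))
      pt S with f01 S
      ... | inj₁ e = ≤-cert _ (trans (cong (λ φ → 𝟚 * (lev k S * ((φ - u S) * (φ - u S))) - (lev k S * (u S * u S) - lev k S * u S))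
          e)
              (trans (ring 2 (λ l u → # 2 :* (l :* ((# 0 :- u) :* (# 0 :- u))) :- (l :* (u :* u) :- l :* u) := l :*
                  ((# 0 :- u) :* (# 0 :- u) :- (# 0 :- u))) refl (lev k S) (u S))
                  (cong (λ φ → lev k S * ((φ - u S) * (φ - u S) - (φ - u S))) (sym e)))) (0≤* (0≤lev k S) (0≤e²-e S))
      ... | inj₂ e = ≤-cert _ (trans (cong (λ φ → 𝟚 * (lev k S * ((φ - u S) * (φ - u S))) - (lev k S * (u S * u S) - lev k S * u S))
          e)
              (trans (ring 2 (λ l u → # 2 :* (l :* ((# 1 :- u) :* (# 1 :- u))) :- (l :* (u :* u) :- l :* u) := l :*
                  ((# 1 :- u) :* (# 1 :- u) :+ (# 1 :- u))) refl (lev k S) (u S))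
                  (cong (λ φ → lev k S * ((φ - u S) * (φ - u S) + (φ - u S))) (sym e)))) (0≤* (0≤lev k S) (0≤e²+e S))

    -- Excluding every shape except a union of ℓ stars

    module Cases (ℓ′ : ℕ) (B : ℚ) (n-large : 𝟚 * (ι k * (ι (suc ℓ′) * ι (suc ℓ′))) ≤ ι n)
      (s-lower : ι 100 * (ι (suc ℓ′) - s) ≤ 𝟙) (s-upper : ι 100 * (s - ι (suc ℓ′)) ≤ 𝟙) (0≤B : 𝟘 ≤ B)
          (B≤ : ι 100 * (ι n * B) ≤ ι (suc d))
      (dp≤ : ⟨ f , Z f ⟩ ≤ (ι (suc ℓ′) * ι (suc ℓ′) - ι (suc ℓ′) + 𝟚 * B) * (M * b)) where

      L : ℚ
      L = ι (suc ℓ′)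

      0≤L-1 : 𝟘 ≤ L - 𝟙
      0≤L-1 = 0≤- (1≤ι-suc ℓ′)

      0≤M : 𝟘 ≤ M
      0≤M = ℚ.<⇒≤ 0<M

      Nb-large : 𝟚 * (L * L) * M ≤ Nb
      Nb-large = *-cancel-≤ (ι k) (0<ι-suc k′) (≤-cert _ (trans (cong (λ x → x - ι k * (𝟚 * (L * L) * M)) k*Nb)
          (ring 4 (λ n k L M → n :* M :- k :* (# 2 :* L :* M) := (n :- # 2 :* (k :* L)) :* M) refl (ι n) (ι k) (L * L) M))
          (0≤* (0≤- n-large) 0≤M))

      0≤Nb : 𝟘 ≤ Nb
      0≤Nb = 0≤bin n k

      -- Each contradiction exhibits non-negative terms adding up to -98M. Of 100 parts, two are
      -- spent on the errors |s - ℓ| ≤ 1/100 and E ≤ M/100.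
      absurd : ∀ {X} → X ≡ ι 98 * 𝟘 - ι 98 * M → 𝟘 ≤ X → ⊥
      absurd eq q = <⇒≱ 0<M (*-cancel-≤ (ι 98) (0<ι-suc 97) (≤-cert _ (sym eq) q))

      0≤slack : 𝟘 ≤ (𝟙 - ι 100 * (s - L)) * M + (M - ι 100 * E)
      0≤slack = 0≤+ (0≤* (0≤- s-upper) 0≤M) (0≤- 100E≤M)

      -- The family has about LM members, whereas n ≥ 2kL² makes Nb at least 2L²M.
      Nb-too-large : ¬ (Nb ≤ M * s + E)
      Nb-too-large q = absurd (ring 5 (λ M L s E N → # 100 :* (M :* s :+ E :- N) :+
          (# 100 :* (N :- # 2 :* (L :* L) :* M) :+ (((# 1 :- # 100 :* (s :- L)) :* M :+ (M :- # 100 :* E)) :+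
          (# 200 :* (L :* (L :- # 1) :* M) :+ # 100 :* ((L :- # 1) :* M)))) := # 98 :* # 0 :- # 98 :* M) refl M L s E Nb)
        (0≤+ (0≤* (0≤ι 100) (0≤- q)) (0≤+ (0≤* (0≤ι 100) (0≤- Nb-large))
            (0≤+ 0≤slack (0≤+ (0≤* (0≤ι 200) (0≤* (0≤* (0≤ι _) 0≤L-1) 0≤M)) (0≤* (0≤ι 100) (0≤* 0≤L-1 0≤M))))))

      μ-positive : ¬ (𝟙 ≤ μ)
      μ-positive q = Nb-too-large (ℚ.≤-trans (≤-cert _ (ring 4 (λ m N p M → (m :* N :+ p :* M) :- N := (m :- # 1) :* N :+ p :* M)
          refl μ Nb p M) (0≤+ (0≤* (0≤- q) 0≤Nb) (0≤* (0≤ι _) 0≤M))) first-lower)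

      -- Here u sums to |T| · M, which is within E of Ms. Thus |T| and ℓ differ by at most 2/100,
      -- and both are integers.
      μ-zero : μ ≡ 𝟘 → size T ≡ suc ℓ′
      μ-zero μ0 with ℕ.<-cmp (size T) (suc ℓ′)
      ... | tri≈ _ e _ = e
      ... | tri> _ _ big = ⊥-elim (absurd
          (ring 6 (λ M L s E N p → # 100 :* (M :* s :+ E :- (# 0 :* N :+ p :* M)) :+
              (# 100 :* ((p :- (# 1 :+ L)) :* M) :+ ((# 1 :- # 100 :* (s :- L)) :* M :+ (M :- # 100 :* E))) := # 98 :* # 0 :- # 98
              :* M) refl M L s E Nb p)
          (0≤+ (0≤* (0≤ι 100) (0≤- (subst (λ μ → μ * Nb + p * M ≤ M * s + E) μ0 first-lower)))
              (0≤+ (0≤* (0≤ι 100) (0≤* (0≤- (subst (_≤ p) (ι-suc (suc ℓ′)) (ι-mono big))) 0≤M)) 0≤slack)))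
      ... | tri< few _ _ = ⊥-elim (absurd
          (ring 6 (λ M L s E N p → # 100 :* (# 0 :* N :+ p :* M :+ E :- M :* s) :+
              (# 100 :* ((L :- (# 1 :+ p)) :* M) :+ ((# 1 :- # 100 :* (L :- s)) :* M :+ (M :- # 100 :* E))) := # 98 :* # 0 :- # 98
              :* M) refl M L s E Nb p)
          (0≤+ (0≤* (0≤ι 100) (0≤- (subst (λ μ → M * s ≤ μ * Nb + p * M + E) μ0 first-upper)))
              (0≤+ (0≤* (0≤ι 100) (0≤* (0≤- (subst (_≤ L) (ι-suc (size T)) (ι-mono few))) 0≤M))
              (0≤+ (0≤* (0≤- s-lower) 0≤M) (0≤- 100E≤M)))))

      -- For negative μ, pass to the complement of T: on k-sets u = y − |S ∩ ∁ T|.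
      y w : ℚ
      y = ι k + μ
      w = ι (size (∁ T))

      p≡ : p ≡ ι n - w
      p≡ = trans (ring 2 (λ p w → p := (w :+ p) :- w) refl p w) (cong (_- w)
          (trans (sym (ι-+ (size (∁ T)) (size T))) (cong ι (trans (cong (_+ℕ size T) (size-∁ T)) (free+size T)))))

      mean≡ : μ * Nb + p * M ≡ y * Nb - w * M
      mean≡ = trans (cong (λ p → μ * Nb + p * M) p≡) (trans (ring 6 (λ m N n w M k → m :* N :+ (n :- w) :* M := (k :+ m) :* N :- w
          :* M :- (k :* N :- n :* M)) refl μ Nb (ι n) w M (ι k)) (trans (cong (λ x → y * Nb - w * M - (x - ι n * M)) k*Nb)
          (ring 2 (λ a b → a :- (b :- b) := a) refl _ _)))

      -- After p = n - w, the two forms differ by multiples of k·Nb - n·M and (k-1)M - (n-1)Q, which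
      -- are both zero.
      second′ : y * (y - 𝟙) * Nb - 𝟚 * (y - 𝟙) * w * M + Q * (w * (w - 𝟙)) ≤ 𝟚 * E
      second′ = subst (_≤ 𝟚 * E) (trans (cong (λ p → μ * (μ - 𝟙) * Nb + 𝟚 * μ * p * M + Q * (p * (p - 𝟙))) p≡)
         (trans (ring 7 (λ m N n w M k Q → m :* (m :- # 1) :* N :+ # 2 :* m :* (n :- w) :* M :+ Q :* ((n :- w) :* ((n :- w) :- # 1))
             := ((k :+ m) :* ((k :+ m) :- # 1) :* N :- # 2 :* ((k :+ m) :- # 1) :* w :* M :+ Q :* (w :* (w :- # 1))) :+
                 ((k :+ # 1 :- # 2 :* (k :+ m)) :* (k :* N :- n :* M) :+ (# 2 :* w :- n) :* ((k :- # 1) :* M :- (n :- # 1) :* Q)))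
                 refl μ Nb (ι n) w M (ι k) Q)
          (trans (cong₂ (λ x z → (y * (y - 𝟙) * Nb - 𝟚 * (y - 𝟙) * w * M + Q * (w * (w - 𝟙))) +
              ((ι k + 𝟙 - 𝟚 * y) * (x - ι n * M) + (𝟚 * w - ι n) * ((ι k - 𝟙) * M - z))) k*Nb Q-M)
            (ring 5 (λ a x y z v → a :+ (x :* (y :- y) :+ z :* (v :- v)) := a) refl _ (ι k + 𝟙 - 𝟚 * y) (ι n * M) (𝟚 * w - ι n)
                ((ι k - 𝟙) * M))))) second

      mean-lower : M * s ≤ y * Nb - w * M + E
      mean-lower = subst (λ x → M * s ≤ x + E) mean≡ first-upper

      mean-upper : y * Nb - w * M ≤ M * s + E
      mean-upper = subst (_≤ M * s + E) mean≡ first-lower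

      0≤w : 𝟘 ≤ w
      0≤w = 0≤ι _

      0≤Q : 𝟘 ≤ Q
      0≤Q = 0≤- (bin-mono N k′)

      y-nonpositive : ¬ (y ≤ 𝟘)
      y-nonpositive q = absurd (ring 7 (λ M L s E N y w → # 100 :* (y :* N :- w :* M :+ E :- M :* s) :+
          (# 100 :* ((# 0 :- y) :* N) :+ (# 100 :* (w :* M) :+ (((# 1 :- # 100 :* (L :- s)) :* M :+ (M :- # 100 :* E)) :+ # 100 :*
          ((L :- # 1) :* M)))) := # 98 :* # 0 :- # 98 :* M) refl M L s E Nb y w)
        (0≤+ (0≤* (0≤ι 100) (0≤- mean-lower)) (0≤+ (0≤* (0≤ι 100) (0≤* (0≤- q) 0≤Nb))
            (0≤+ (0≤* (0≤ι 100) (0≤* 0≤w 0≤M)) (0≤+ (0≤+ (0≤* (0≤- s-lower) 0≤M) (0≤- 100E≤M)) (0≤* (0≤ι 100) (0≤* 0≤L-1 0≤M))))))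

      2kL≤n : 𝟚 * (ι k * L) ≤ ι n
      2kL≤n = ℚ.≤-trans (≤-cert _ (ring 2 (λ k L → # 2 :* (k :* (L :* L)) :- # 2 :* (k :* L) := # 2 :* (k :* (L :* (L :- # 1))))
          refl (ι k) L) (0≤* (0≤ι 2) (0≤* (0≤ι k) (0≤* (0≤ι _) 0≤L-1)))) n-large

      0≤n-2k : 𝟘 ≤ ι n - 𝟚 * ι k
      0≤n-2k = subst (𝟘 ≤_) (ring 2 (λ n k → (n :- (# 1 :+ # 2 :* k)) :+ # 1 := n :- # 2 :* k) refl (ι n) (ι k))
          (0≤+ (0≤- 1+2k≤n) (0≤ι 1))

      absurdₙ : ∀ j {X} → X ≡ ι (suc j) * (ι n * 𝟘) - ι (suc j) * (ι n * M) → 𝟘 ≤ X → ⊥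
      absurdₙ j eq q = <⇒≱ 0<M (*-cancel-≤ (ι n) (0<ι-suc _) (*-cancel-≤ (ι (suc j)) (0<ι-suc j) (≤-cert _ (sym eq) q)))

      -- y = 1 and |∁ T| ≥ 2: too many k-sets contain two points of ∁ T.
      many-points : y ≡ 𝟙 → μ ≤ - 𝟙 → ¬ (𝟚 ≤ w)
      -- Since w(w-1) ≥ w, the second moment gives kwM ≤ 2(k-1)wM ≤ 4(n-1)E, at most a 1/25 of nM.
      -- But the mean requires nM - kwM ≤ k(Ms + E), and kL is at most n/2.
      many-points y1 μ≤ q = absurdₙ 89
          (ring 9 (λ M L s E N n k w Q → # 200 :* (k :* (M :* s :+ E :- (# 1 :* N :- w :* M)) :+ (k :* N :- n :* M)) :+
              (# 200 :* ((k :- # 2) :* (w :* M)) :+ (# 400 :* (n :- # 1) :* (# 2 :* E :- Q :* (w :* (w :- # 1))) :+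
              (# 400 :* ((n :- # 1) :* (Q :* (w :* (w :- # 2)))) :+ (# 400 :* w :* ((n :- # 1) :* Q :- (k :- # 1) :* M) :+
              ((# 100 :* ((n :- # 2 :* (k :* L)) :* M) :+ (# 2 :* (k :* ((# 1 :- # 100 :* (s :- L)) :* M)) :+
              (# 2 :* (k :* (M :- # 100 :* E)) :+ (# 8 :* ((n :- # 1) :* (M :- # 100 :* E)) :+
              (# 2 :* ((n :- # 2 :* k) :* M) :+ # 8 :* M)))))))))) := # 90 :* (n :* # 0) :- # 90 :* (n :* M)) refl M L s E Nb (ι n)
              (ι k) w Q)
          (0≤+ (0≤* (0≤ι 200) (0≤+ (0≤* (0≤ι k) (0≤- (subst (λ y → y * Nb - w * M ≤ M * s + E) y1 mean-upper)))
              (ℚ.≤-reflexive (sym (trans (cong (_- ι n * M) k*Nb) (-‿inverseʳ _))))))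
           (0≤+ (0≤* (0≤ι 200) (0≤* 0≤k-2 (0≤* 0≤w 0≤M))) (0≤+ (0≤* (0≤* (0≤ι 400) 0≤n-1) (0≤- second₁))
               (0≤+ (0≤* (0≤ι 400) (0≤* 0≤n-1 (0≤* 0≤Q (0≤* 0≤w (0≤- q)))))
             (0≤+ (0≤* (0≤* (0≤ι 400) 0≤w) (ℚ.≤-reflexive (sym (trans (cong (_- (ι k - 𝟙) * M) Q-M) (-‿inverseʳ _)))))
             (0≤+ (0≤* (0≤ι 100) (0≤* (0≤- 2kL≤n) 0≤M)) (0≤+ (0≤* (0≤ι 2) (0≤* (0≤ι k) (0≤* (0≤- s-upper) 0≤M)))
                 (0≤+ (0≤* (0≤ι 2) (0≤* (0≤ι k) (0≤- 100E≤M))) (0≤+ (0≤* (0≤ι 8) (0≤* 0≤n-1 (0≤- 100E≤M)))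
                 (0≤+ (0≤* (0≤ι 2) (0≤* 0≤n-2k 0≤M)) (0≤* (0≤ι 8) 0≤M)))))))))))
        where
        0≤n-1 : 𝟘 ≤ ι n - 𝟙
        0≤n-1 = ℚ.<⇒≤ 0<n-1
        -- Because k + μ = 1 and μ ≤ -1.
        0≤k-2 : 𝟘 ≤ ι k - 𝟚
        0≤k-2 = subst (𝟘 ≤_) (trans (ring 2 (λ k m → (:- # 1) :- m := k :- (k :+ m) :- # 1) refl (ι k) μ)
            (trans (cong (λ x → ι k - x - 𝟙) y1) (ring 1 (λ k → k :- # 1 :- # 1 := k :- # 2) refl (ι k)))) (0≤- μ≤)
        second₁ : Q * (w * (w - 𝟙)) ≤ 𝟚 * E
        second₁ = subst (_≤ 𝟚 * E) (trans (cong (λ y → y * (y - 𝟙) * Nb - 𝟚 * (y - 𝟙) * w * M + Q * (w * (w - 𝟙))) y1)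
            (ring 4 (λ N w M x → # 1 :* (# 1 :- # 1) :* N :- # 2 :* (# 1 :- # 1) :* w :* M :+ x := x) refl Nb w M _)) second′

      -- y ≥ 2: the variance of |S ∩ ∁ T| exceeds that of a Boolean function of the same mean.
      spread-out : 𝟚 ≤ y → μ ≤ - 𝟙 → ⊥
      spread-out q μ≤ = absurdₙ 87 (ring 4 (λ n k M E → # 100 :* (# 24 :* k :* E :- n :* M) :+
          (# 24 :* (k :* (M :- # 100 :* E)) :+ # 12 :* ((n :- # 2 :* k) :* M)) := # 88 :* (n :* # 0) :- # 88 :* (n :* M)) refl (ι n)
          (ι k) M E)
          (0≤+ (0≤* (0≤ι 100) (0≤- nM≤)) (0≤+ (0≤* (0≤ι 24) (0≤* (0≤ι k) (0≤- 100E≤M))) (0≤* (0≤ι 12) (0≤* 0≤n-2k 0≤M))))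
        where
        -- The mean of u over the k-sets is v/n, and M·G is kn(n-1) times the left side of
        -- `second′`. `A` and `C` measure the slack in 2 ≤ y ≤ k - 1, and `R` is the non-negative
        -- combination used in `G-large`.
        v A C G R : ℚ
        v = ι n * y - ι k * w
        A = y - 𝟚
        C = ι k - 𝟙 - y
        G = ι n * ι n * (ι n - 𝟙) * (y * (y - 𝟙)) - 𝟚 * (ι k * ι n * (ι n - 𝟙) * ((y - 𝟙) * w)) + ι k * ι n *
            ((ι k - 𝟙) * (w * (w - 𝟙)))
        R = ι 3 * (v * (ι n - v)) + (C * ι n * (ι n + ι 3 * (ι n - v)) + (A * ι n * (ι n + ι 3 * v) + ι 3 * (A * C) * (ι n * ι n)))
        0<n : 𝟘 < ι n
        0<n = 0<ι-suc (suc N)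
        0<k : 𝟘 < ι k
        0<k = 0<ι-suc k′
        0≤n-1 : 𝟘 ≤ ι n - 𝟙
        0≤n-1 = ℚ.<⇒≤ 0<n-1
        0≤C : 𝟘 ≤ C
        0≤C = subst (𝟘 ≤_) (ring 2 (λ k m → (:- # 1) :- m := k :- # 1 :- (k :+ m)) refl (ι k) μ) (0≤- μ≤)
        vM : v * M ≡ ι k * (y * Nb - w * M)
        vM = sym (trans (ring 5 (λ k y N w M → k :* (y :* N :- w :* M) := y :* (k :* N) :- k :* w :* M) refl (ι k) y Nb w M)
            (trans (cong (λ x → y * x - ι k * w * M) k*Nb) (ring 5 (λ n y k w M → y :* (n :* M) :- k :* w :* M := (n :* y :- k :* w)
            :* M) refl (ι n) y (ι k) w M)))
        0≤v : 𝟘 ≤ v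
        0≤v = *-cancel-≤ (ι 100 * M) (0<* (0<ι-suc 99) 0<M) (≤-cert _
           (trans (ring 2 (λ v M → # 100 :* M :* v :- # 100 :* M :* # 0 := # 100 :* (v :* M)) refl v M)
               (trans (cong (ι 100 *_) vM) (ring 6 (λ k X E M L s → # 100 :* (k :* X) := k :*
               (# 100 :* (X :+ E :- M :* s) :+ (((# 1 :- # 100 :* (L :- s)) :* M :+ (M :- # 100 :* E)) :+ # 98 :*
               ((L :- # 1) :* M))) :+ k :* (# 2 :* (L :* M) :+ # 96 :* M)) refl (ι k) (y * Nb - w * M) E M L s)))
           (0≤+ (0≤* (0≤ι k) (0≤+ (0≤* (0≤ι 100) (0≤- mean-lower)) (0≤+ (0≤+ (0≤* (0≤- s-lower) 0≤M) (0≤- 100E≤M))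
               (0≤* (0≤ι 98) (0≤* 0≤L-1 0≤M))))) (0≤* (0≤ι k) (0≤+ (0≤* (0≤ι 2) (0≤* (0≤ι _) 0≤M)) (0≤* (0≤ι 96) 0≤M)))))
        v≤n : v ≤ ι n
        v≤n = *-cancel-≤ (ι 100 * M) (0<* (0<ι-suc 99) 0<M) (≤-cert _
           (trans (ring 3 (λ n v M → # 100 :* M :* n :- # 100 :* M :* v := # 100 :* (n :* M) :- # 100 :* (v :* M)) refl (ι n) v M)
               (trans (cong (λ x → ι 100 * (ι n * M) - ι 100 * x) vM) (ring 7
               (λ k X E M L s n → # 100 :* (n :* M) :- # 100 :* (k :* X) := k :*
               (# 100 :* (M :* s :+ E :- X) :+ ((# 1 :- # 100 :* (s :- L)) :* M :+ (M :- # 100 :* E))) :+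
               (# 50 :* ((n :- # 2 :* (k :* L)) :* M) :+ ((n :- # 2 :* k) :* M :+ # 49 :* (n :* M)))) refl (ι k) (y * Nb - w * M) E
               M L s (ι n))))
           (0≤+ (0≤* (0≤ι k) (0≤+ (0≤* (0≤ι 100) (0≤- mean-upper)) 0≤slack))
               (0≤+ (0≤* (0≤ι 50) (0≤* (0≤- 2kL≤n) 0≤M)) (0≤+ (0≤* 0≤n-2k 0≤M) (0≤* (0≤ι 49) (0≤* (0≤ι n) 0≤M))))))
        0≤R : 𝟘 ≤ R
        0≤R = 0≤+ (0≤* (0≤ι 3) (0≤* 0≤v (0≤- v≤n))) (0≤+ (0≤* (0≤* 0≤C (0≤ι n)) (0≤+ (0≤ι n) (0≤* (0≤ι 3) (0≤- v≤n))))
            (0≤+ (0≤* (0≤* (0≤- q) (0≤ι n)) (0≤+ (0≤ι n) (0≤* (0≤ι 3) 0≤v))) (0≤* (0≤* (0≤ι 3) (0≤* (0≤- q) 0≤C)) (0≤sq (ι n)))))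
        G-large : ι n * ι n * (ι n - 𝟙) ≤ ι 12 * G
        G-large = *-cancel-≤ (ι k) 0<k (≤-cert _
          (ring 4 (λ n k y w → k :* (# 12 :* (n :* n :* (n :- # 1) :* (y :* (y :- # 1)) :- # 2 :*
              (k :* n :* (n :- # 1) :* ((y :- # 1) :* w)) :+ k :* n :* ((k :- # 1) :* (w :* (w :- # 1))))) :- k :*
              (n :* n :* (n :- # 1))
            := # 4 :* ((n :- # 2 :* k) :+ k) :* (# 3 :* ((n :* y :- k :* w) :* (n :- (n :* y :- k :* w))) :+
                ((k :- # 1 :- y) :* n :* (n :+ # 3 :* (n :- (n :* y :- k :* w))) :+
                ((y :- # 2) :* n :* (n :+ # 3 :* (n :* y :- k :* w)) :+ # 3 :* ((y :- # 2) :* (k :- # 1 :- y)) :* (n :* n))))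
              :+ (# 4 :* (k :* (n :* n)) :* ((n :- # 2 :* k) :+ # 1) :+ # 3 :* (k :* (n :- # 1)) :*
                  ((n :- # 2 :* (n :* y :- k :* w)) :* (n :- # 2 :* (n :* y :- k :* w))))) refl (ι n) (ι k) y w)
          (0≤+ (0≤* (0≤* (0≤ι 4) (0≤+ 0≤n-2k (0≤ι k))) 0≤R) (0≤+ (0≤* (0≤* (0≤ι 4) (0≤* (0≤ι k) (0≤sq (ι n)))) (0≤+ 0≤n-2k (0≤ι 1)))
              (0≤* (0≤* (0≤ι 3) (0≤* (0≤ι k) 0≤n-1)) (0≤sq _)))))
        MG : M * G ≤ ι k * (ι n * (ι n - 𝟙)) * (𝟚 * E)
        MG = subst (_≤ ι k * (ι n * (ι n - 𝟙)) * (𝟚 * E)) (trans (ring 7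
            (λ k n y N w M Q → k :* (n :* (n :- # 1)) :* (y :* (y :- # 1) :* N :- # 2 :* (y :- # 1) :* w :* M :+ Q :*
            (w :* (w :- # 1))) := n :* (n :- # 1) :* (y :* (y :- # 1)) :* (k :* N) :- # 2 :*
            (k :* n :* (n :- # 1) :* ((y :- # 1) :* w)) :* M :+ k :* n :* (w :* (w :- # 1)) :* ((n :- # 1) :* Q)) refl (ι k) (ι n) y
            Nb w M Q)
           (trans (cong₂ (λ a c → ι n * (ι n - 𝟙) * (y * (y - 𝟙)) * a - 𝟚 * (ι k * ι n * (ι n - 𝟙) * ((y - 𝟙) * w)) * M + ι k * ι n
               * (w * (w - 𝟙)) * c) k*Nb Q-M)
             (ring 5 (λ k n y w M → n :* (n :- # 1) :* (y :* (y :- # 1)) :* (n :* M) :- # 2 :*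
                 (k :* n :* (n :- # 1) :* ((y :- # 1) :* w)) :* M :+ k :* n :* (w :* (w :- # 1)) :* ((k :- # 1) :* M) := M :*
                 (n :* n :* (n :- # 1) :* (y :* (y :- # 1)) :- # 2 :* (k :* n :* (n :- # 1) :* ((y :- # 1) :* w)) :+ k :* n :*
                 ((k :- # 1) :* (w :* (w :- # 1))))) refl (ι k) (ι n) y w M)))
           (*-monoˡ (ι k * (ι n * (ι n - 𝟙))) (0≤* (0≤ι k) (0≤* (0≤ι n) 0≤n-1)) second′)
        nM≤ : ι n * M ≤ ι 24 * ι k * E
        nM≤ = *-cancel-≤ (ι n * (ι n - 𝟙)) (0<* 0<n 0<n-1) (≤-cert _
           (ring 5 (λ n k M E G → n :* (n :- # 1) :* (# 24 :* k :* E) :- n :* (n :- # 1) :* (n :* M) := M :*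
               (# 12 :* G :- n :* n :* (n :- # 1)) :+ # 12 :* (k :* (n :* (n :- # 1)) :* (# 2 :* E) :- M :* G)) refl (ι n) (ι k) M E
               G)
           (0≤+ (0≤* 0≤M (0≤- G-large)) (0≤* (0≤ι 12) (0≤- MG))))

      z′ : Subset n → ℚ
      z′ S = wt (ind (∁ T)) S

      -- y = 1 and |∁ T| = 1: close to the complement of a star, which has too many disjoint pairs.
      module Antistar (y1 : y ≡ 𝟙) (single : size (∁ T) ≡ 1) where

        -- `g` indicates the k-sets that miss the single point of ∁ T, and `e` those among them that
        -- are absent from the family.
        g e : Subset n → ℚ
        g S = lev k S * (𝟙 - z′ S)
        e S = g S * (𝟙 - f S)

        z′01 : ∀ S → Zero-one (z′ S)
        z′01 S = wt-single (∁ T) S (ℕ.≤-reflexive single)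

        w1 : w ≡ 𝟙
        w1 = cong ι single

        1-z′-idem : ∀ S → (𝟙 - z′ S) * (𝟙 - z′ S) ≡ 𝟙 - z′ S
        1-z′-idem S with z′01 S
        ... | inj₁ q = trans (cong (λ x → (𝟙 - x) * (𝟙 - x)) q) (trans (ring 0 ((# 1 :- # 0) :* (# 1 :- # 0) := # 1 :- # 0) refl)
            (cong (λ x → 𝟙 - x) (sym q)))
        ... | inj₂ q = trans (cong (λ x → (𝟙 - x) * (𝟙 - x)) q) (trans (ring 0 ((# 1 :- # 1) :* (# 1 :- # 1) := # 1 :- # 1) refl)
            (cong (λ x → 𝟙 - x) (sym q)))

        0≤1-z′ : ∀ S → 𝟘 ≤ 𝟙 - z′ S
        0≤1-z′ S = subst (𝟘 ≤_) (1-z′-idem S) (0≤sq _)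

        0≤1-f : ∀ S → 𝟘 ≤ 𝟙 - f S
        0≤1-f S with f01 S
        ... | inj₁ q = subst (λ x → 𝟘 ≤ 𝟙 - x) (sym q) (0≤- (0≤ι 1))
        ... | inj₂ q = subst (λ x → 𝟘 ≤ 𝟙 - x) (sym q) (0≤- ℚ.≤-refl)

        u₁ : ∀ S → size S ≡ k → u S ≡ 𝟙 - z′ S
        u₁ S q = trans (u≡ S q) (trans (ring 4 (λ m z z′ k → m :+ z := (k :+ m) :- z′ :+ ((z :+ z′) :- k)) refl μ (z S) (z′ S)
            (ι k)) (trans (cong₂ (λ a c → a - z′ S + (c - ι k)) y1 (trans (wt-ind-∁ T S) (cong ι q)))
            (ring 2 (λ z k → # 1 :- z :+ (k :- k) := # 1 :- z) refl (z′ S) (ι k))))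

        sum-g : sumS g ≡ Nb - M
        sum-g = trans (sumS-cong (λ S → ring 2 (λ l z → l :* (# 1 :- z) := l :- l :* z) refl (lev k S) (z′ S)))
            (trans (sumS-sub _ _) (cong₂ _-_ (sum-lev n k) (trans (sum-wt k′ (ind (∁ T)))
            (trans (cong (M *_) (trans (tot-ind (∁ T)) w1)) (*-identityʳ M)))))

        0≤g : ∀ S → 𝟘 ≤ g S
        0≤g S = 0≤* (0≤lev k S) (0≤1-z′ S)

        0≤e : ∀ S → 𝟘 ≤ e S
        0≤e S = 0≤* (0≤g S) (0≤1-f S)

        sum-e : sumS e ≤ E
        sum-e = sumS-mono (λ S → ℚ.≤-trans (ℚ.≤-reflexive (*-assoc _ _ _))
            (lev-≤ k S (λ q → subst (λ x → (𝟙 - z′ S) * (𝟙 - f S) ≤ (f S - x) * (f S - x)) (sym (u₁ S q)) (pt S (z′01 S) (f01 S)))))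
          where
          pt : ∀ S → Zero-one (z′ S) → Zero-one (f S) → (𝟙 - z′ S) * (𝟙 - f S) ≤ (f S - (𝟙 - z′ S)) * (f S - (𝟙 - z′ S))
          pt S (inj₂ q) _ = subst (λ x → (𝟙 - x) * (𝟙 - f S) ≤ (f S - (𝟙 - x)) * (f S - (𝟙 - x))) (sym q)
              (≤-cert _ (ring 1 (λ f → (f :- (# 1 :- # 1)) :* (f :- (# 1 :- # 1)) :- (# 1 :- # 1) :* (# 1 :- f) := f :* f) refl
              (f S)) (0≤sq _))
          pt S (inj₁ q) (inj₁ r) = ℚ.≤-reflexive (trans (cong₂ (λ x φ → (𝟙 - x) * (𝟙 - φ)) q r)
              (trans (ring 0 ((# 1 :- # 0) :* (# 1 :- # 0) := (# 0 :- (# 1 :- # 0)) :* (# 0 :- (# 1 :- # 0))) refl)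
              (sym (cong₂ (λ x φ → (φ - (𝟙 - x)) * (φ - (𝟙 - x))) q r))))
          pt S (inj₁ q) (inj₂ r) = ℚ.≤-reflexive (trans (cong₂ (λ x φ → (𝟙 - x) * (𝟙 - φ)) q r)
              (trans (ring 0 ((# 1 :- # 0) :* (# 1 :- # 1) := (# 1 :- (# 1 :- # 0)) :* (# 1 :- (# 1 :- # 0))) refl)
              (sym (cong₂ (λ x φ → (φ - (𝟙 - x)) * (φ - (𝟙 - x))) q r))))

        -- Of the C(n-k, k) k-sets disjoint from a member of the antistar, b contain its special
        -- point. So ρ = C(n-k-1, k) is the degree of the Kneser graph inside the antistar.
        λ₀ ρ : ℚ
        λ₀ = bin (k +ℕ suc d) k
        ρ = λ₀ - b

        kρ : ι k * ρ ≡ ι (suc d) * b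
        kρ = trans (ring 3 (λ k l b → k :* (l :- b) := k :* l :- k :* b) refl (ι k) λ₀ b)
            (trans (cong (_- ι k * b) (trans (bin-absorb (k′ +ℕ suc d) k′) (cong (_* b) (ι-+ k (suc d)))))
            (ring 3 (λ k d b → (k :+ d) :* b :- k :* b := d :* b) refl (ι k) (ι (suc d)) b))

        free-k : ∀ F → size F ≡ k → free F ≡ k +ℕ suc d
        free-k F q = ℕ.+-cancelʳ-≡ k _ _ (trans (trans (cong (free F +ℕ_) (sym q)) (free+size F))
            (trans n≡ (ℕ.+-comm k (k +ℕ suc d))))

        Zg : ∀ G → size G ≡ k → Z g G ≡ λ₀ - b * (𝟙 - z′ G)
        Zg G q = trans (Z-cong (λ S → ring 2 (λ l z → l :* (# 1 :- z) := l :+ (:- # 1) :* (l :* z)) refl (lev k S) (z′ S)) G)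
          (trans (Z-+ _ _ G) (trans (cong₂ _+_ (trans (Z-lev k G) (cong (λ x → bin x k) (free-k G q)))
              (trans (Z-* (- 𝟙) _ G) (cong ((- 𝟙) *_) (trans (Z-wt k′ (ind (∁ T)) G)
              (cong₂ (λ x c → bin (x ∸ 1) k′ * c) (free-k G q) cw)))))
            (ring 3 (λ l b x → l :+ (:- # 1) :* (b :* x) := l :- b :* x) refl λ₀ b _)))
          where
          cw : cwt (ind (∁ T)) G ≡ 𝟙 - z′ G
          cw = trans (ring 2 (λ c z → c := (z :+ c) :- z) refl (cwt (ind (∁ T)) G) (z′ G))
              (cong (_- z′ G) (trans (wt+cwt (ind (∁ T)) G) (trans (tot-ind (∁ T)) w1)))

        gZg : ∀ S x → g S * x * Z g S ≡ ρ * (g S * x)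
        gZg S x = trans (ring 4 (λ l y x Z → l :* y :* x :* Z := l :* (y :* x :* Z)) refl (lev k S) (𝟙 - z′ S) x (Z g S))
            (trans (onLevel k S (λ q → trans (cong ((𝟙 - z′ S) * x *_) (Zg S q))
            (trans (ring 4 (λ y x l b → y :* x :* (l :- b :* y) := x :* (l :* y :- b :* (y :* y))) refl (𝟙 - z′ S) x λ₀ b)
           (trans (cong (λ t → x * (λ₀ * (𝟙 - z′ S) - b * t)) (1-z′-idem S))
               (ring 4 (λ y x l b → x :* (l :* y :- b :* y) := (l :- b) :* (y :* x)) refl (𝟙 - z′ S) x λ₀ b)))))
           (ring 4 (λ l r y x → l :* (r :* (y :* x)) := r :* (l :* y :* x)) refl (lev k S) ρ (𝟙 - z′ S) x))

        g-Zg : ⟨ g , Z g ⟩ ≡ ρ * sumS g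
        g-Zg = trans (sumS-cong (λ S → trans (cong (_* Z g S) (sym (*-identityʳ (g S))))
            (trans (gZg S 𝟙) (cong (ρ *_) (*-identityʳ (g S)))))) (sumS-* ρ g)

        e-Zg : ⟨ e , Z g ⟩ ≡ ρ * sumS e
        e-Zg = trans (sumS-cong (λ S → gZg S (𝟙 - f S))) (sumS-* ρ e)

        v : Subset n → ℚ
        v S = g S - e S

        v≡ : ∀ S → v S ≡ g S * f S
        v≡ S = ring 2 (λ g f → g :- g :* (# 1 :- f) := g :* f) refl (g S) (f S)

        0≤v : ∀ S → 𝟘 ≤ v S
        0≤v S = subst (𝟘 ≤_) (sym (v≡ S)) (0≤* (0≤g S) (0≤01 (f01 S)))

        0≤f-v : ∀ S → 𝟘 ≤ f S - v S
        0≤f-v S = subst (𝟘 ≤_) (trans (ring 2 (λ g f → f :* (# 1 :- g) := f :- g :* f) refl (g S) (f S))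
            (cong (λ x → f S - x) (sym (v≡ S)))) (0≤* (0≤01 (f01 S)) 0≤1-g)
          where
          0≤1-g : 𝟘 ≤ 𝟙 - g S
          0≤1-g with size S ℕ.≟ k
          ... | yes q = subst (𝟘 ≤_) (trans (ring 1 (λ z → z := # 1 :- # 1 :* (# 1 :- z)) refl (z′ S))
              (cong (λ l → 𝟙 - l * (𝟙 - z′ S)) (sym (lev-yes k S q)))) (0≤01 (z′01 S))
          ... | no q = subst (𝟘 ≤_) (trans (ring 1 (λ x → # 1 := # 1 :- # 0 :* x) refl (𝟙 - z′ S))
              (cong (λ l → 𝟙 - l * (𝟙 - z′ S)) (sym (lev-no k S q)))) (0≤ι 1)

        f-lower : ⟨ v , Z v ⟩ ≤ ⟨ f , Z f ⟩
        f-lower = sumS-mono (λ S → ≤-cert _ (ring 4 (λ f v a c → f :* a :- v :* c := (f :- v) :* a :+ v :* (a :- c)) refl (f S)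
            (v S) (Z f S) (Z v S))
           (0≤+ (0≤* (0≤f-v S) (0≤Z (λ F → 0≤01 (f01 F)) S)) (0≤* (0≤v S) (subst (𝟘 ≤_) (Zdiff S) (0≤Z 0≤f-v S)))))
          where
          Zdiff : ∀ S → Z (λ F → f F - v F) S ≡ Z f S - Z v S
          Zdiff S = trans (Z-cong (λ F → ring 2 (λ a c → a :- c := a :+ (:- # 1) :* c) refl (f F) (v F)) S)
              (trans (Z-+ _ _ S) (trans (cong (Z f S +_) (Z-* (- 𝟙) v S)) (ring 2 (λ a c → a :+ (:- # 1) :* c := a :- c) refl _ _)))

        -- Deleting `e` from the antistar destroys at most ρ ordered pairs per deleted set in each
        -- coordinate; pairs deleted twice only help.
        v-lower : ρ * (sumS g - 𝟚 * sumS e) ≤ ⟨ v , Z v ⟩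
        v-lower = ℚ.≤-trans (≤-cert ⟨ e , Z e ⟩ (ring 4 (λ r g e z → (r :* g :- r :* e :- (r :* e :- z)) :- r :* (g :- # 2 :* e) :=
            z) refl ρ (sumS g) (sumS e) ⟨ e , Z e ⟩) (0≤sumS (λ S → 0≤* (0≤e S) (0≤Z 0≤e S))))
          (ℚ.≤-reflexive (sym expand))
          where
          expand : ⟨ v , Z v ⟩ ≡ ρ * sumS g - ρ * sumS e - (ρ * sumS e - ⟨ e , Z e ⟩)
          expand = trans (sumS-cong (λ S → trans (cong (v S *_) (Zv S)) (ring 4
              (λ g e a c → (g :- e) :* (a :- c) := (# 1 :* (g :* a) :+ (:- # 1) :* (e :* a)) :+
              ((:- # 1) :* (g :* c) :+ # 1 :* (e :* c))) refl (g S) (e S) (Z g S) (Z e S))))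
            (trans (sumS-lin4 _ _ _ _ _ _ _ _) (trans (cong₂ _+_ (cong₂ (λ x c → 𝟙 * x + (- 𝟙) * c) g-Zg e-Zg)
                (cong (λ x → (- 𝟙) * x + 𝟙 * ⟨ e , Z e ⟩) (trans (sym (Z-adjoint g e)) (trans (⟨⟩-comm _ _) e-Zg))))
              (ring 3 (λ a c z → (# 1 :* a :+ (:- # 1) :* c) :+ ((:- # 1) :* c :+ # 1 :* z) := a :- c :- (c :- z)) refl _ _ _)))
            where
            Zv : ∀ S → Z v S ≡ Z g S - Z e S
            Zv S = trans (Z-cong (λ F → ring 2 (λ a c → a :- c := a :+ (:- # 1) :* c) refl (g F) (e F)) S)
                (trans (Z-+ _ _ S) (trans (cong (Z g S +_) (Z-* (- 𝟙) e S))
                (ring 2 (λ a c → a :+ (:- # 1) :* c := a :- c) refl _ _)))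

        -- The antistar has Nb - M ≥ (2L² - 1)M members but the family only about LM, and 2L² - 1
        -- exceeds L by at least 5 once L ≥ 2.
        L≡1 : ℓ′ ≡ 0
        L≡1 = go ℓ′ refl
          where
          go : ∀ j → ℓ′ ≡ j → ℓ′ ≡ 0
          go zero q = q
          go (suc j) q = ⊥-elim (absurd
              (ring 5 (λ M L s E N → # 100 :* (M :* s :+ E :- (# 1 :* N :- # 1 :* M)) :+
                  (# 100 :* (N :- # 2 :* (L :* L) :* M) :+ (((# 1 :- # 100 :* (s :- L)) :* M :+ (M :- # 100 :* E)) :+
                  ((# 200 :* ((L :- # 2) :* (L :- # 2)) :+ # 700 :* (L :- # 2)) :* M :+ # 400 :* M))) := # 98 :* # 0 :- # 98 :* M)
                  refl M L s E Nb)
              (0≤+ (0≤* (0≤ι 100) (0≤- (subst₂ (λ y w → y * Nb - w * M ≤ M * s + E) y1 w1 mean-upper)))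
                  (0≤+ (0≤* (0≤ι 100) (0≤- Nb-large)) (0≤+ 0≤slack (0≤+ (0≤* (0≤+ (0≤* (0≤ι 200) (0≤sq _)) (0≤* (0≤ι 700) 0≤L-2))
                  0≤M) (0≤* (0≤ι 400) 0≤M))))))
            where
            0≤L-2 : 𝟘 ≤ L - 𝟚
            0≤L-2 = 0≤- (ι-mono (s≤s (subst (1 ≤ℕ_) (sym q) (s≤s z≤n))))

        -- For L = 1 the bound on `dp` allows 2kBMb ≤ (n-2k)Mb/100 after multiplication by k. Since
        -- kρ = (n-2k)b and Nb - M ≥ M, the antistar produces at least 98 such hundredths; 98 - 1
        -- gives the 97.
        antistar : ⊥
        antistar = <⇒≱ (0<ι-suc d) (*-cancel-≤ (ι 97 * (M * b)) (0<* (0<ι-suc 96) (0<* 0<M 0<b)) (≤-cert _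
            (ring 9 (λ D M b k B n N e E → # 97 :* (M :* b) :* # 0 :- # 97 :* (M :* b) :* D
              := # 100 :* (k :* ((# 1 :* # 1 :- # 1 :+ # 2 :* B) :* (M :* b)) :- D :* b :* ((N :- M) :- # 2 :* e)) :+
                  (# 200 :* (D :* b :* (E :- e)) :+ (# 2 :* (D :* b :* (M :- # 100 :* E)) :+
                  (# 100 :* (D :* b :* (N :- # 2 :* (# 1 :* # 1) :* M)) :+
                  (# 100 :* ((n :- # 2 :* k) :* (B :* (M :* b))) :+ (D :- # 100 :* (n :* B)) :* (M :* b)))))) refl D M b (ι k) B
                  (ι n) Nb (sumS e) E)
            (0≤+ (0≤* (0≤ι 100) (0≤- chain)) (0≤+ (0≤* (0≤ι 200) (0≤* 0≤Db (0≤- sum-e)))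
                (0≤+ (0≤* (0≤ι 2) (0≤* 0≤Db (0≤- 100E≤M))) (0≤+ (0≤* (0≤ι 100)
                (0≤* 0≤Db (0≤- (subst (λ x → 𝟚 * (x * x) * M ≤ Nb) L1 Nb-large))))
                (0≤+ (0≤* (0≤ι 100) (0≤* 0≤n-2k (0≤* 0≤B (0≤* 0≤M (ℚ.<⇒≤ 0<b))))) (0≤* (0≤- B≤) (0≤* 0≤M (ℚ.<⇒≤ 0<b))))))))))
          where
          D : ℚ
          D = ι (suc d)
          0≤Db : 𝟘 ≤ D * b
          0≤Db = 0≤* (0≤ι _) (ℚ.<⇒≤ 0<b)
          L1 : L ≡ 𝟙
          L1 = cong (λ j → ι (suc j)) L≡1
          chain : D * b * ((Nb - M) - 𝟚 * sumS e) ≤ ι k * ((𝟙 * 𝟙 - 𝟙 + 𝟚 * B) * (M * b))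
          chain = subst (_≤ ι k * ((𝟙 * 𝟙 - 𝟙 + 𝟚 * B) * (M * b))) (trans (sym (*-assoc (ι k) ρ _))
              (cong₂ (λ x y → x * (y - 𝟚 * sumS e)) kρ sum-g))
            (*-monoˡ (ι k) (0≤ι k) (ℚ.≤-trans v-lower (ℚ.≤-trans f-lower
                (subst (λ x → ⟨ f , Z f ⟩ ≤ (x * x - x + 𝟚 * B) * (M * b)) L1 dp≤))))

      μ-negative : ¬ (μ ≤ - 𝟙)
      μ-negative q = go Y refl
        where
        Y : ℤ
        Y = ℤ.+ k ℤ.+ m₁
        Y≡ : ζ Y ≡ y
        Y≡ = ζ-+ (ℤ.+ k) m₁
        points : y ≡ 𝟙 → ∀ j → size (∁ T) ≡ j → ⊥
        points y1 zero e = Nb-too-large (ℚ.≤-trans (ℚ.≤-reflexive (sym (trans (cong₂ (λ y w → y * Nb - w * M) y1 (cong ι e))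
            (ring 2 (λ N M → # 1 :* N :- # 0 :* M := N) refl Nb M)))) mean-upper)
        points y1 (suc zero) e = Antistar.antistar y1 e
        points y1 (suc (suc j)) e = many-points y1 q (subst (λ x → 𝟚 ≤ ι x) (sym e) (ι-mono (s≤s (s≤s z≤n))))
        go : ∀ Z′ → Y ≡ Z′ → ⊥
        go (ℤ.+ zero) e = y-nonpositive (ℚ.≤-reflexive (trans (sym Y≡) (cong ζ e)))
        go (ℤ.+ suc zero) e = points (trans (sym Y≡) (cong ζ e)) (size (∁ T)) refl
        go (ℤ.+ suc (suc j)) e = spread-out (subst (𝟚 ≤_) (trans (cong ζ (sym e)) Y≡) (ι-mono (s≤s (s≤s z≤n)))) q
        go (ℤ.-[1+ j ]) e = y-nonpositive (subst (_≤ 𝟘) (trans (cong ζ (sym e)) Y≡) (ζ-mono ℤ.-≤+))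

      μ≡0 : μ ≡ 𝟘
      μ≡0 = go m₁ refl
        where
        go : ∀ z → m₁ ≡ z → μ ≡ 𝟘
        go (ℤ.+ zero) e = cong ζ e
        go (ℤ.+ suc j) e = ⊥-elim (μ-positive (subst (𝟙 ≤_) (cong ζ (sym e)) (1≤ι-suc j)))
        go (ℤ.-[1+ j ]) e = ⊥-elim (μ-negative (subst₂ _≤_ (cong ζ (sym e)) (ζ-neg-suc 0)
            (ζ-mono {ℤ.-[1+ j ]} {ℤ.-[1+ 0 ]} (ℤ.-≤- z≤n))))

      size-T : size T ≡ suc ℓ′
      size-T = μ-zero μ≡0

      close : sumS (λ S → lev k S * ((f S - z S) * (f S - z S))) ≡ E
      close = sym (trans E≡ (sumS-cong (λ S → cong (λ x → lev k S * ((f S - x) * (f S - x)))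
          (trans (cong (_+ z S) μ≡0) (+-identityˡ _)))))

  -- Families of sets

  [_]ℤ : Bool → ℤ
  [ true ]ℤ = ℤ.+ 1
  [ false ]ℤ = ℤ.+ 0

  [_] : Bool → ℚ
  [ x ] = ζ [ x ]ℤ

  []01 : ∀ x → Zero-one [ x ]
  []01 true = inj₂ refl
  []01 false = inj₁ refl

  sumL : ∀ {A : Set} → (A → ℚ) → List A → ℚ
  sumL φ [] = 𝟘
  sumL φ (x ∷ xs) = φ x + sumL φ xs

  sumL-++ : ∀ {A : Set} (φ : A → ℚ) xs ys → sumL φ (xs ++ ys) ≡ sumL φ xs + sumL φ ys
  sumL-++ φ [] ys = sym (+-identityˡ _)
  sumL-++ φ (x ∷ xs) ys = trans (cong (φ x +_) (sumL-++ φ xs ys)) (sym (+-assoc _ _ _))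

  sumL-map : ∀ {A A′ : Set} (φ : A′ → ℚ) (g : A → A′) xs → sumL φ (mapL g xs) ≡ sumL (λ x → φ (g x)) xs
  sumL-map φ g [] = refl
  sumL-map φ g (x ∷ xs) = cong (φ (g x) +_) (sumL-map φ g xs)

  sumL-cong : ∀ {A : Set} {φ ψ : A → ℚ} → (∀ x → φ x ≡ ψ x) → ∀ xs → sumL φ xs ≡ sumL ψ xs
  sumL-cong e [] = refl
  sumL-cong e (x ∷ xs) = cong₂ _+_ (e x) (sumL-cong e xs)

  sumL-+ : ∀ {A : Set} (φ ψ : A → ℚ) xs → sumL (λ x → φ x + ψ x) xs ≡ sumL φ xs + sumL ψ xs
  sumL-+ φ ψ [] = sym (+-identityˡ 𝟘)
  sumL-+ φ ψ (x ∷ xs) = trans (cong (φ x + ψ x +_) (sumL-+ φ ψ xs)) (interchange _ _ _ _)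

  sumL-allSubsets : ∀ n (φ : Subset n → ℚ) → sumL φ (allSubsets n) ≡ sumS φ
  sumL-allSubsets zero φ = trans (+-identityʳ _) (sym (sumS-[] φ))
  sumL-allSubsets (suc n) φ = trans (sumL-++ φ (mapL (true ∷_) (allSubsets n)) _)
      (trans (cong₂ _+_ (trans (sumL-map φ (true ∷_) (allSubsets n)) (sumL-allSubsets n _))
      (trans (sumL-map φ (false ∷_) (allSubsets n)) (sumL-allSubsets n _))) (sym (sumS-∷ φ)))

  countL≡sumL : ∀ {A : Set} (p : A → Bool) xs → ι (countL p xs) ≡ sumL (λ x → [ p x ]) xs
  countL≡sumL p [] = refl
  countL≡sumL p (x ∷ xs) = trans (ι-+ (if p x then 1 else 0) (countL p xs)) (cong₂ _+_ (step (p x)) (countL≡sumL p xs))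
    where
    step : ∀ y → ι (if y then 1 else 0) ≡ [ y ]
    step true = refl
    step false = refl

  countL≡sumS : ∀ {n} (p : Subset n → Bool) → ι (countL p (allSubsets n)) ≡ sumS (λ S → [ p S ])
  countL≡sumS {n} p = trans (countL≡sumL p (allSubsets n)) (sumL-allSubsets n _)

  disjointB-comm : ∀ {n} (x y : Subset n) → disjointB x y ≡ disjointB y x
  disjointB-comm [] [] = refl
  disjointB-comm (true ∷ x) (true ∷ y) = refl
  disjointB-comm (true ∷ x) (false ∷ y) = disjointB-comm x y
  disjointB-comm (false ∷ x) (true ∷ y) = disjointB-comm x y
  disjointB-comm (false ∷ x) (false ∷ y) = disjointB-comm x y

  disjointB-self : ∀ {n} (x : Subset n) → disjointB x x ≡ true → size x ≡ 0
  disjointB-self [] e = refl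
  disjointB-self (false ∷ x) e = disjointB-self x e

  Z-disjoint : ∀ {n} (φ : Subset n → ℚ) G → Z φ G ≡ sumS (λ F → φ F * [ disjointB G F ])
  Z-disjoint φ [] = sym (trans (sumS-[] _) (*-identityʳ _))
  Z-disjoint {suc n} φ (true ∷ G) = sym (trans (sumS-∷ _) (trans (cong₂ _+_ (trans (sumS-cong (λ F → zeroʳ _)) (sumS-0 {n}))
      (sym (Z-disjoint _ G))) (+-identityˡ _)))
  Z-disjoint φ (false ∷ G) = sym (trans (sumS-∷ _) (cong₂ _+_ (sym (Z-disjoint _ G)) (sym (Z-disjoint _ G))))

  -- The double sum runs over ordered pairs, while `dpL` counts each unordered pair at its earlier
  -- member; the diagonal is zero by assumption.
  pairs-dp : ∀ {n} (𝓕 : Family n) → (∀ x → [ 𝓕 x ] * ([ 𝓕 x ] * [ disjointB x x ]) ≡ 𝟘) → ∀ xs →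
    sumL (λ x → sumL (λ y → [ 𝓕 x ] * ([ 𝓕 y ] * [ disjointB x y ])) xs) xs ≡ 𝟚 * ι (dpL 𝓕 xs)
  pairs-dp 𝓕 diag [] = sym (zeroʳ 𝟚)
  pairs-dp {n} 𝓕 diag (x ∷ xs) = trans (cong (D x x + sumL (D x) xs +_) (trans (sumL-+ _ _ xs)
      (cong₂ _+_ (sumL-cong (λ y → D-comm y x) xs) (pairs-dp 𝓕 diag xs))))
    (trans (cong (λ z → z + sumL (D x) xs + (sumL (D x) xs + 𝟚 * ι (dpL 𝓕 xs))) (diag x))
        (trans (ring 2 (λ r t → # 0 :+ r :+ (r :+ # 2 :* t) := # 2 :* (r :+ t)) refl _ _)
     (cong (𝟚 *_) (trans (cong (_+ ι (dpL 𝓕 xs)) row) (sym (ι-+ _ (dpL 𝓕 xs)))))))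
    where
    D : Subset n → Subset n → ℚ
    D x y = [ 𝓕 x ] * ([ 𝓕 y ] * [ disjointB x y ])
    D-comm : ∀ x y → D x y ≡ D y x
    D-comm x y = trans (cong (λ z → [ 𝓕 x ] * ([ 𝓕 y ] * [ z ])) (disjointB-comm x y))
        (ring 3 (λ a b c → a :* (b :* c) := b :* (a :* c)) refl _ _ _)
    and : ∀ a b → [ a ∧ b ] ≡ [ a ] * [ b ]
    and true b = sym (*-identityˡ _)
    and false b = sym (zeroˡ _)
    row : sumL (D x) xs ≡ ι (if 𝓕 x then countL (λ y → 𝓕 y ∧ disjointB x y) xs else 0)
    row with 𝓕 x
    ... | true = trans (sumL-cong (λ y → trans (*-identityˡ _) (sym (and (𝓕 y) (disjointB x y)))) xs) (sym (countL≡sumL _ xs))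
    ... | false = trans (sumL-cong (λ y → zeroˡ _) xs) (zeros xs)
      where
      zeros : ∀ (xs : List (Subset n)) → sumL (λ _ → 𝟘) xs ≡ 𝟘
      zeros [] = refl
      zeros (x ∷ xs) = trans (+-identityˡ _) (zeros xs)

  -- Only the empty set is disjoint from itself, and uniformity with a positive size excludes it.
  dp-form : ∀ {n} k′ (𝓕 : Family n) → IsKUniform (suc k′) 𝓕 → ⟨ (λ S → [ 𝓕 S ]) , Z (λ S → [ 𝓕 S ]) ⟩ ≡ 𝟚 * ι (dp 𝓕)
  dp-form {n} k′ 𝓕 uniform = trans (sumS-cong (λ G → trans (cong ([ 𝓕 G ] *_) (Z-disjoint _ G)) (sym (sumS-* [ 𝓕 G ] _))))
    (trans (sym (trans (sumL-cong (λ G → sumL-allSubsets n _) (allSubsets n)) (sumL-allSubsets n _)))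
        (pairs-dp 𝓕 diag (allSubsets n)))
    where
    diag : ∀ x → [ 𝓕 x ] * ([ 𝓕 x ] * [ disjointB x x ]) ≡ 𝟘
    diag x with 𝓕 x in e | disjointB x x in e′
    ... | false | _ = zeroˡ _
    ... | true | false = trans (cong (𝟙 *_) (zeroʳ 𝟙)) (zeroʳ 𝟙)
    ... | true | true with trans (sym (uniform x e)) (disjointB-self x e′)
    ... | ()

  wt-disjoint : ∀ {n} (S T : Subset n) → disjointB S T ≡ true → wt (ind T) S ≡ 𝟘
  wt-disjoint [] [] e = refl
  wt-disjoint (true ∷ S) (false ∷ T) e = trans (+-identityˡ _) (wt-disjoint S T e)
  wt-disjoint (false ∷ S) (_ ∷ T) e = wt-disjoint S T e

  0≤wt-ind : ∀ {n} (S T : Subset n) → 𝟘 ≤ wt (ind T) S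
  0≤wt-ind [] [] = ℚ.≤-refl
  0≤wt-ind (true ∷ S) (true ∷ T) = 0≤+ (0≤ι 1) (0≤wt-ind S T)
  0≤wt-ind (true ∷ S) (false ∷ T) = 0≤+ ℚ.≤-refl (0≤wt-ind S T)
  0≤wt-ind (false ∷ S) (_ ∷ T) = 0≤wt-ind S T

  wt-meet : ∀ {n} (S T : Subset n) → disjointB S T ≡ false → 𝟙 ≤ wt (ind T) S
  wt-meet [] [] ()
  wt-meet (true ∷ S) (true ∷ T) e = subst (_≤ 𝟙 + wt (ind T) S) (+-identityʳ 𝟙) (+-mono-≤ ℚ.≤-refl (0≤wt-ind S T))
  wt-meet (true ∷ S) (false ∷ T) e = subst (𝟙 ≤_) (sym (+-identityˡ _)) (wt-meet S T e)
  wt-meet (false ∷ S) (_ ∷ T) e = wt-meet S T e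

  ≡ᵇ-refl : ∀ k → (k ≡ᵇ k) ≡ true
  ≡ᵇ-refl zero = refl
  ≡ᵇ-refl (suc k) = ≡ᵇ-refl k

  ≡ᵇ-no : ∀ a k → a ≢ k → (a ≡ᵇ k) ≡ false
  ≡ᵇ-no zero zero p = ⊥-elim (p refl)
  ≡ᵇ-no zero (suc k) p = refl
  ≡ᵇ-no (suc a) zero p = refl
  ≡ᵇ-no (suc a) (suc k) p = ≡ᵇ-no a k (λ e → p (cong suc e))

  -- A k-set in exactly one of the families has f = 1 and |S ∩ T| = 0, or f = 0 and |S ∩ T| ≥ 1; in
  -- both cases the square is at least 1.
  symDiff-≤ : ∀ {n} k (𝓕 : Family n) → IsKUniform k 𝓕 → ∀ T →
    ι (symDiffCard 𝓕 (starUnion k T)) ≤ sumS (λ S → lev k S * (([ 𝓕 S ] - wt (ind T) S) * ([ 𝓕 S ] - wt (ind T) S)))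
  symDiff-≤ k 𝓕 uniform T = ℚ.≤-trans (ℚ.≤-reflexive (countL≡sumS _)) (sumS-mono (λ S → pt S (𝓕 S) refl (disjointB S T) refl))
    where
    pt : ∀ S F → 𝓕 S ≡ F → ∀ D → disjointB S T ≡ D → [ 𝓕 S xor starUnion k T S ] ≤ lev k S *
        (([ 𝓕 S ] - wt (ind T) S) * ([ 𝓕 S ] - wt (ind T) S))
    pt S F eF D eD with size S ℕ.≟ k
    pt S true eF D eD | no p = ⊥-elim (p (uniform S eF))
    pt S false eF D eD | no p = ℚ.≤-trans (ℚ.≤-reflexive (cong₂ (λ F m → [ F xor (m ∧ not (disjointB S T)) ]) eF
        (≡ᵇ-no (size S) k p))) (0≤* (0≤lev k S) (0≤sq _))
    pt S F eF D eD | yes p = subst₂ _≤_ (sym lhs) (sym rhs) (core F D eD)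
      where
      x : ℚ
      x = wt (ind T) S
      lhs : [ 𝓕 S xor starUnion k T S ] ≡ [ F xor not D ]
      lhs = cong₂ (λ F m → [ F xor m ]) eF (cong₂ (λ m D → m ∧ not D) (trans (cong (_≡ᵇ k) p) (≡ᵇ-refl k)) eD)
      rhs : lev k S * (([ 𝓕 S ] - x) * ([ 𝓕 S ] - x)) ≡ ([ F ] - x) * ([ F ] - x)
      rhs = trans (cong₂ (λ l F → l * (([ F ] - x) * ([ F ] - x))) (lev-yes k S p) eF) (*-identityˡ _)
      core : ∀ F D → disjointB S T ≡ D → [ F xor not D ] ≤ ([ F ] - x) * ([ F ] - x)
      core true true e = ℚ.≤-reflexive (sym (trans (cong (λ x → (𝟙 - x) * (𝟙 - x)) (wt-disjoint S T e))
          (ring 0 ((# 1 :- # 0) :* (# 1 :- # 0) := # 1) refl)))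
      core true false e = 0≤sq _
      core false true e = 0≤sq _
      core false false e = ≤-cert _ (ring 1 (λ x → (# 0 :- x) :* (# 0 :- x) :- # 1 := (x :- # 1) :* (x :- # 1) :+ # 2 :* (x :- # 1))
          refl x) (0≤+ (0≤sq _) (0≤* (0≤ι 2) (0≤- (wt-meet S T e))))

  choose-two : ∀ ℓ → 𝟚 * ι (ℓ C 2) ≡ ι ℓ * ι ℓ - ι ℓ
  choose-two ℓ = trans (cong (𝟚 *_) (sym (bin≡C ℓ 2))) (trans (bin-next ℓ 1)
      (trans (cong ((ι ℓ - 𝟙) *_) (trans (sym (*-identityˡ _)) (bin-next ℓ 0)))
      (ring 1 (λ l → (l :- # 1) :* ((l :- # 0) :* # 1) := l :* l :- l) refl (ι ℓ))))

  -- Matching the constants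

  module Assembly {N k′ d ℓ′ : ℕ} (n≡ : suc (suc N) ≡ suc k′ +ℕ (suc k′ +ℕ suc d))
    (n-large : 𝟚 * (ι (suc k′) * (ι (suc ℓ′) * ι (suc ℓ′))) ≤ ι (suc (suc N))) (α β A B : ℚ)
    (α≤A : α ≤ A) (-A≤α : 𝟘 ≤ A + α) (0≤A : 𝟘 ≤ A) (β≤B : β ≤ B) (0≤B : 𝟘 ≤ B)
    (hA : 𝟚 * ι (suc ℓ′) * A * (ι 36000000 * ι (suc (suc N))) ≤ ι (suc d)) (hB : B * (ι 36000000 * ι (suc (suc N))) ≤ ι (suc d))
    (𝓕 : Family (suc (suc N))) (uniform : IsKUniform (suc k′) 𝓕)
    (card≡ : ι (card 𝓕) ≡ (ι (suc ℓ′) - α) * Sizes.M n≡)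
    (dp≤ : ι (dp 𝓕) ≤ (ι (suc ℓ′ C 2) + β) * Sizes.M n≡ * Sizes.b n≡) where

    open Sizes n≡

    L Δ D : ℚ
    L = ι (suc ℓ′)
    Δ = (𝟚 * L - 𝟙) * α + 𝟚 * β
    D = ι (suc d)

    f : Subset n → ℚ
    f S = [ 𝓕 S ]

    f01 : ∀ S → Zero-one (f S)
    f01 S = []01 (𝓕 S)

    f-bool : ∀ S → f S * f S ≡ f S
    f-bool S with f01 S
    ... | inj₁ e = trans (cong (λ x → x * x) e) (trans (zeroʳ 𝟘) (sym e))
    ... | inj₂ e = trans (cong (λ x → x * x) e) (trans (*-identityʳ 𝟙) (sym e))

    f-Supp : Supp k f
    f-Supp S p with 𝓕 S in e
    ... | true = ⊥-elim (p (uniform S e))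
    ... | false = refl

    module Pr = Projection n≡ f f-Supp f-bool
    open Pr using (s; Ms; H)

    s≡ : s ≡ L - α
    s≡ = *-cancel-≡ M 0<M (trans Ms (trans (sym (countL≡sumS 𝓕)) (trans card≡ (*-comm _ _))))

    Zf≤ : ⟨ f , Z f ⟩ ≤ (L * L - L + 𝟚 * β) * (M * b)
    Zf≤ = subst₂ _≤_ (sym (dp-form k′ 𝓕 uniform)) (trans (ring 4 (λ c β M b → # 2 :* ((c :+ β) :* M :* b) := (# 2 :* c :+ # 2 :* β)
        :* (M :* b)) refl (ι (suc ℓ′ C 2)) β M b) (cong (λ x → (x + 𝟚 * β) * (M * b)) (choose-two (suc ℓ′))))
      (*-monoˡ 𝟚 (0≤ι 2) dp≤)

    0<D : 𝟘 < D
    0<D = 0<ι-suc d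

    0≤M : 𝟘 ≤ M
    0≤M = ℚ.<⇒≤ 0<M

    0≤L-1 : 𝟘 ≤ L - 𝟙
    0≤L-1 = 0≤- (1≤ι-suc ℓ′)

    stable : ι (suc d) * H ≤ ι n * (M * Δ)
    stable = proj₂ (Pr.stability s≡ Zf≤)

    -- Here 36000000 = (20 · 300)². Both 2ℓ|α| and |β| are at most (n-2k)/(36000000 n), so Δ ≤ 2ℓ|α|
    -- + 2|β| is at most three times that.
    H-small : ι 36000000 * H ≤ ι 3 * M
    H-small = *-cancel-≤ D 0<D (≤-cert
        _
        (ring 10 (λ q n M L α β A B D H → D :* (# 3 :* M) :- D :* (q :* H) := q :*
            (n :* (M :* ((# 2 :* L :- # 1) :* α :+ # 2 :* β)) :- D :* H) :+ M :*
            ((D :- # 2 :* L :* A :* (q :* n)) :+ (# 2 :* (D :- B :* (q :* n)) :+ q :* n :*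
            ((# 2 :* (L :- # 1) :+ # 1) :* (A :- α) :+ (A :+ # 2 :* (B :- β)))))) refl (ι 36000000) (ι n) M L α β A B D H)
        (0≤+ (0≤* (0≤ι 36000000) (0≤- stable)) (0≤* 0≤M (0≤+ (0≤- hA) (0≤+ (0≤* (0≤ι 2) (0≤- hB))
            (0≤* (0≤* (0≤ι 36000000) (0≤ι n)) (0≤+ (0≤* (0≤+ (0≤* (0≤ι 2) 0≤L-1) (0≤ι 1)) (0≤- α≤A))
            (0≤+ 0≤A (0≤* (0≤ι 2) (0≤- β≤B))))))))))

    -- The target is 100 · 264: `rounding` loses 264, and `Endgame` asks for an error of at most
    -- M/100.
    tiny : ι 26400 * H ≤ M
    tiny = *-cancel-≤ (ι 3) (0<ι-suc 2) (ℚ.≤-trans (≤-cert _ (ring 1 (λ H → # 36000000 :* H :- # 3 :* (# 26400 :* H) := # 35920800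
        :* H) refl H) (0≤* (0≤ι 35920800) (0≤⟨⟩ Pr.h))) H-small)

    small : ι 1536 * H ≤ M
    small = ℚ.≤-trans (≤-cert _ (ring 1 (λ H → # 26400 :* H :- # 1536 :* H := # 24864 :* H) refl H) (0≤* (0≤ι 24864) (0≤⟨⟩ Pr.h)))
        tiny

    module Fk = FKN n≡ f f-Supp f-bool (λ S → [ 𝓕 S ]ℤ) (λ S → refl) small

    100E≤M : ι 100 * sumS (λ S → lev k S * ((f S - Fk.u S) * (f S - Fk.u S))) ≤ M
    100E≤M = ℚ.≤-trans (*-monoˡ (ι 100) (0≤ι 100) Fk.rounding) (ℚ.≤-trans
        (ℚ.≤-reflexive (ring 1 (λ H → # 100 :* (# 264 :* H) := # 26400 :* H) refl H)) tiny)

    module En = Endgame n≡ f f-Supp (λ S → [ 𝓕 S ]ℤ) (λ S → refl) f01 s Ms Fk.m Fk.t 100E≤M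

    D≤n : D ≤ ι n
    D≤n = ≤-cert _ (trans (cong (_- D) ιn) (ring 2 (λ k d → (# 1 :+ k) :+ ((# 1 :+ k) :+ d) :- d := (# 1 :+ k) :+ (# 1 :+ k)) refl
        (ι k′) D)) (0≤+ (0≤+ (0≤ι 1) (0≤ι k′)) (0≤+ (0≤ι 1) (0≤ι k′)))

    100A≤1 : ι 100 * A ≤ 𝟙
    100A≤1 = *-cancel-≤ (ι n) (0<ι-suc _) (≤-cert _
      (ring 4 (λ n L A D → n :* # 1 :- n :* (# 100 :* A) := (D :- # 2 :* L :* A :* (# 36000000 :* n)) :+
          ((n :- D) :+ A :* n :* (# 72000000 :* (L :- # 1) :+ # 71999900))) refl (ι n) L A D)
      (0≤+ (0≤- hA) (0≤+ (0≤- D≤n) (0≤* (0≤* 0≤A (0≤ι n)) (0≤+ (0≤* (0≤ι 72000000) 0≤L-1) (0≤ι 71999900))))))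

    module Ca = En.Cases ℓ′ B n-large
      (≤-cert _ (trans (cong (λ s → 𝟙 - ι 100 * (L - s)) s≡) (ring 3 (λ L α A → # 1 :- # 100 :* (L :- (L :- α)) :=
          (# 1 :- # 100 :* A) :+ # 100 :* (A :- α)) refl L α A)) (0≤+ (0≤- 100A≤1) (0≤* (0≤ι 100) (0≤- α≤A))))
      (≤-cert _ (trans (cong (λ s → 𝟙 - ι 100 * (s - L)) s≡) (ring 3 (λ L α A → # 1 :- # 100 :* ((L :- α) :- L) :=
          (# 1 :- # 100 :* A) :+ # 100 :* (A :+ α)) refl L α A)) (0≤+ (0≤- 100A≤1) (0≤* (0≤ι 100) -A≤α)))
      0≤B
      (ℚ.≤-trans (≤-cert _ (ring 2 (λ n B → B :* (# 36000000 :* n) :- # 100 :* (n :* B) := # 35999900 :* (n :* B)) refl (ι n) B)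
          (0≤* (0≤ι 35999900) (0≤* (0≤ι n) 0≤B))) hB)
      (ℚ.≤-trans Zf≤ (≤-cert _ (ring 5 (λ l M b B β → (l :+ # 2 :* B) :* (M :* b) :- (l :+ # 2 :* β) :* (M :* b) := # 2 :* (B :- β)
          :* (M :* b)) refl (L * L - L) M b B β) (0≤* (0≤* (0≤ι 2) (0≤- β≤B)) (0≤* 0≤M (ℚ.<⇒≤ 0<b)))))

    -- The symmetric difference is at most 264H, and (n-2k)H ≤ nMΔ by `stability`. Rounding 264 up
    -- to 300 relies on Δ ≥ 0.
    conclusion : Σ (Subset n) λ T → size T ≡ suc ℓ′ × (ι (symDiffCard 𝓕 (starUnion k T)) * D ≤ ι 300 * Δ * ι n * M)
    conclusion = En.T , Ca.size-T , ℚ.≤-trans (ℚ.≤-reflexive (*-comm _ D))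
        (ℚ.≤-trans (*-monoˡ D (ℚ.<⇒≤ 0<D) (ℚ.≤-trans (symDiff-≤ k 𝓕 uniform En.T) (ℚ.≤-trans (ℚ.≤-reflexive Ca.close) Fk.rounding)))
      (≤-cert _ (ring 5 (λ D n M Δ H → # 300 :* Δ :* n :* M :- D :* (# 264 :* H) := # 264 :* (n :* (M :* Δ) :- D :* H) :+ # 36 :*
          (n :* (M :* Δ))) refl D (ι n) M Δ H)
        (0≤+ (0≤* (0≤ι 264) (0≤- stable)) (0≤* (0≤ι 36) (0≤* (0≤ι n) (0≤* 0≤M (proj₁ (Pr.stability s≡ Zf≤))))))))

  opaque
    unfolding _+_

    *-monoʳ : ∀ {x y} a → 𝟘 ≤ a → x ≤ y → x * a ≤ y * a
    *-monoʳ a p q = ℚ.*-monoʳ-≤-nonNeg a {{nonNegative p}} q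

    0≤∣_∣ : ∀ x → 𝟘 ≤ ℚ.∣ x ∣
    0≤∣ x ∣ = ℚ.0≤∣p∣ x

    ∣∣-lower : ∀ x → 𝟘 ≤ ℚ.∣ x ∣ + x
    ∣∣-lower x with ℚ.∣p∣≡p∨∣p∣≡-p x
    ... | inj₁ e = subst (λ y → 𝟘 ≤ y + x) (sym e) (0≤+ (subst (𝟘 ≤_) e (0≤∣ x ∣)) (subst (𝟘 ≤_) e (0≤∣ x ∣)))
    ... | inj₂ e = ℚ.≤-reflexive (sym (trans (cong (_+ x) e) (trans (+-comm (- x) x) (-‿inverseʳ x))))

  ≤∣∣ : ∀ x → x ≤ ℚ.∣ x ∣
  ≤∣∣ x with ℚ.≤-total x 𝟘
  ... | inj₁ p = ℚ.≤-trans p (0≤∣ x ∣)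
  ... | inj₂ p = ℚ.≤-reflexive (sym (ℚ.0≤p⇒∣p∣≡p (0≤⇒ p)))
    where
    opaque
      unfolding _+_
      0≤⇒ : 𝟘 ≤ x → ℚ.0ℚ ≤ x
      0≤⇒ q = q

  1<300 : 𝟙 < ι 300
  1<300 = ℚ.<-≤-trans 1<2 (ι-mono (s≤s (s≤s z≤n)))
    where
    1<2 : 𝟙 < ι 2
    1<2 = subst₂ _<_ (+-identityʳ 𝟙) (sym (ι-+ 1 1)) (subst₂ _<_ (+-comm 𝟘 𝟙) refl (+-mono-<-≤ 0<1 (ℚ.≤-refl {𝟙})))

  main : ∀ (n k ℓ : ℕ) → 1 ≤ℕ n → 1 ≤ℕ k → 1 ≤ℕ ℓ → 2 *ℕ k *ℕ ℓ *ℕ ℓ <ℕ n →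
    ∀ (α β : ℚ) →
    ((ι (2 *ℕ ℓ) * ℚ.∣ α ∣) ℚ.⊔ ℚ.∣ β ∣) * ((ι 20 * ι 300) * (ι 20 * ι 300) * ι n) ≤ ι n - ι (2 *ℕ k) →
    ∀ (𝓕 : Family n) → IsKUniform k 𝓕 →
    ι (card 𝓕) ≡ (ι ℓ - α) * ι ((n ∸ 1) C (k ∸ 1)) →
    ι (dp 𝓕) ≤ (ι (ℓ C 2) + β) * ι ((n ∸ 1) C (k ∸ 1)) * ι ((n ∸ k ∸ 1) C (k ∸ 1)) →
    ∃ λ (T : Subset n) → size T ≡ ℓ ×
      ι (symDiffCard 𝓕 (starUnion k T)) * (ι n - ι (2 *ℕ k))
        ≤ ι 300 * ((ι (2 *ℕ ℓ) - 𝟙) * α + 𝟚 * β) * ι n * ι ((n ∸ 1) C (k ∸ 1))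
  main n (suc k′) (suc ℓ′) _ _ _ large α β hyp 𝓕 uniform card≡ dp≤ = go n≡ 𝓕 uniform card≡ dp≤ hyp large
    where
    k ℓ d : ℕ
    k = suc k′
    ℓ = suc ℓ′
    -- Shifted by one, so that n - 2k appears as `suc d` and is visibly positive.
    d = n ∸ suc (k +ℕ k)
    2k<n : suc (k +ℕ k) ≤ℕ n
    2k<n = ℕ.≤-trans (s≤s (ℕ.≤-trans (ℕ.≤-reflexive (cong (k +ℕ_) (sym (ℕ.+-identityʳ k))))
        (ℕ.≤-trans (ℕ.m≤m*n (2 *ℕ k) ℓ) (ℕ.m≤m*n (2 *ℕ k *ℕ ℓ) ℓ)))) large
    n≡ : n ≡ k +ℕ (k +ℕ suc d)
    n≡ = trans (sym (ℕ.m+[n∸m]≡n 2k<n)) (trans (cong suc (ℕ.+-assoc k k d))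
        (trans (sym (ℕ.+-suc k (k +ℕ d))) (cong (k +ℕ_) (sym (ℕ.+-suc k d)))))
    -- Generalised over n, so that n can be split as N + 2 while d stays fixed.
    go : ∀ {n} → n ≡ k +ℕ (k +ℕ suc d) → (𝓕 : Family n) → IsKUniform k 𝓕 →
      ι (card 𝓕) ≡ (ι ℓ - α) * ι ((n ∸ 1) C (k ∸ 1)) →
      ι (dp 𝓕) ≤ (ι (ℓ C 2) + β) * ι ((n ∸ 1) C (k ∸ 1)) * ι ((n ∸ k ∸ 1) C (k ∸ 1)) →
      ((ι (2 *ℕ ℓ) * ℚ.∣ α ∣) ℚ.⊔ ℚ.∣ β ∣) * ((ι 20 * ι 300) * (ι 20 * ι 300) * ι n) ≤ ι n - ι (2 *ℕ k) →
      2 *ℕ k *ℕ ℓ *ℕ ℓ <ℕ n →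
      ∃ λ (T : Subset n) → size T ≡ ℓ × ι (symDiffCard 𝓕 (starUnion k T)) * (ι n - ι (2 *ℕ k)) ≤ ι 300 *
          ((ι (2 *ℕ ℓ) - 𝟙) * α + 𝟚 * β) * ι n * ι ((n ∸ 1) C (k ∸ 1))
    go {zero} ()
    go {suc zero} e with trans (ℕ.suc-injective e) (ℕ.+-suc k′ _)
    ... | ()
    go {suc (suc N)} e 𝓕 uniform card≡ dp≤ hyp large = proj₁ res , proj₁ (proj₂ res) , subst₂
        (λ x y → ι (symDiffCard 𝓕 (starUnion k (proj₁ res))) * x ≤ y) (sym D≡)
        (cong₂ (λ x y → ι 300 * ((x - 𝟙) * α + 𝟚 * β) * ι (suc (suc N)) * y) (sym (ι-* 2 ℓ)) (bin≡C (suc N) k′)) (proj₂ (proj₂ res))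
      where
      q : ℚ
      q = ι 36000000 * ι (suc (suc N))
      q≡ : (ι 20 * ι 300) * (ι 20 * ι 300) * ι (suc (suc N)) ≡ q
      q≡ = ring 1 (λ n → (# 20 :* # 300) :* (# 20 :* # 300) :* n := # 36000000 :* n) refl (ι (suc (suc N)))
      0≤q : 𝟘 ≤ q
      0≤q = 0≤* (0≤ι 36000000) (0≤ι _)
      D≡ : ι (suc (suc N)) - ι (2 *ℕ k) ≡ ι (suc d)
      D≡ = trans (cong₂ _-_ (trans (cong ι e) (trans (ι-+ k (k +ℕ suc d)) (cong (ι k +_) (ι-+ k (suc d))))) (ι-* 2 k))
          (ring 2 (λ k d → k :+ (k :+ d) :- # 2 :* k := d) refl (ι k) (ι (suc d)))
      bound : ∀ {x} → x ≤ (ι (2 *ℕ ℓ) * ℚ.∣ α ∣) ℚ.⊔ ℚ.∣ β ∣ → x * q ≤ ι (suc d)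
      bound p = ℚ.≤-trans (*-monoʳ q 0≤q p) (subst₂ _≤_ (cong (((ι (2 *ℕ ℓ) * ℚ.∣ α ∣) ℚ.⊔ ℚ.∣ β ∣) *_) q≡) D≡ hyp)
      n-large : 𝟚 * (ι k * (ι ℓ * ι ℓ)) ≤ ι (suc (suc N))
      n-large = subst (_≤ ι (suc (suc N))) (trans (ι-* (2 *ℕ k *ℕ ℓ) ℓ) (trans
          (cong (_* ι ℓ) (trans (ι-* (2 *ℕ k) ℓ) (cong (_* ι ℓ) (ι-* 2 k))))
          (ring 2 (λ k l → # 2 :* k :* l :* l := # 2 :* (k :* (l :* l))) refl (ι k) (ι ℓ)))) (ι-mono (ℕ.<⇒≤ large))
      b≡ : bin (k′ +ℕ suc d) k′ ≡ ι ((suc (suc N) ∸ k ∸ 1) C k′)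
      b≡ = trans (bin≡C (k′ +ℕ suc d) k′) (cong (λ x → ι ((x ∸ 1) C k′)) (sym (trans (cong (_∸ k) e) (ℕ.m+n∸m≡n k (k +ℕ suc d)))))
      res : Σ (Subset (suc (suc N))) λ T → size T ≡ ℓ × (ι (symDiffCard 𝓕 (starUnion k T)) * ι (suc d) ≤ ι 300 *
          ((𝟚 * ι ℓ - 𝟙) * α + 𝟚 * β) * ι (suc (suc N)) * bin (suc N) k′)
      res = Assembly.conclusion {N} {k′} {d} {ℓ′} e n-large α β ℚ.∣ α ∣ ℚ.∣ β ∣ (≤∣∣ α) (∣∣-lower α) (0≤∣ α ∣) (≤∣∣ β) (0≤∣ β ∣)
        (subst (λ x → x * ℚ.∣ α ∣ * q ≤ ι (suc d)) (ι-* 2 ℓ) (bound (ℚ.p≤p⊔q _ _))) (bound (ℚ.p≤q⊔p (ι (2 *ℕ ℓ) * ℚ.∣ α ∣) ℚ.∣ β ∣))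
            𝓕 uniform
        (trans card≡ (cong ((ι ℓ - α) *_) (sym (bin≡C (suc N) k′)))) (subst (ι (dp 𝓕) ≤_)
            (cong₂ (λ x y → (ι (ℓ C 2) + β) * x * y) (sym (bin≡C (suc N) k′)) (sym b≡)) dp≤)

open import Data.Nat using (ℕ; _∸_) renaming (_*_ to _*ℕ_; _<_ to _<ℕ_; _≤_ to _≤ℕ_)
open import Data.Nat.Combinatorics using (_C_)
open import Data.Rational using (ℚ; 1ℚ; _+_; _-_; _*_; ∣_∣; _⊔_; _≤_; _<_)
open import Data.Fin.Subset using (Subset) renaming (∣_∣ to size)
open import Data.Product using (∃; _×_)
open import Relation.Binary.PropositionalEquality using (_≡_)
open import Data.Product using (_,_)

opaque
  unfolding Proof._+_

  theorem1p2 : ∃ λ (c : ℚ) → 1ℚ < c ×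
    (∀ (n k ℓ : ℕ) → 1 ≤ℕ n → 1 ≤ℕ k → 1 ≤ℕ ℓ → 2 *ℕ k *ℕ ℓ *ℕ ℓ <ℕ n →
     ∀ (α β : ℚ) →
     ((ℕ→ℚ (2 *ℕ ℓ) * ∣ α ∣) ⊔ ∣ β ∣) * ((ℕ→ℚ 20 * c) * (ℕ→ℚ 20 * c) * ℕ→ℚ n)
       ≤ ℕ→ℚ n - ℕ→ℚ (2 *ℕ k) →
     ∀ (𝓕 : Family n) → IsKUniform k 𝓕 →
     ℕ→ℚ (card 𝓕) ≡ (ℕ→ℚ ℓ - α) * ℕ→ℚ ((n ∸ 1) C (k ∸ 1)) →
     ℕ→ℚ (dp 𝓕) ≤ (ℕ→ℚ (ℓ C 2) + β) * ℕ→ℚ ((n ∸ 1) C (k ∸ 1)) * ℕ→ℚ ((n ∸ k ∸ 1) C (k ∸ 1)) →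
     ∃ λ (T : Subset n) → size T ≡ ℓ ×
       ℕ→ℚ (symDiffCard 𝓕 (starUnion k T)) * (ℕ→ℚ n - ℕ→ℚ (2 *ℕ k))
         ≤ c * ((ℕ→ℚ (2 *ℕ ℓ) - 1ℚ) * α + ℕ→ℚ 2 * β) * ℕ→ℚ n * ℕ→ℚ ((n ∸ 1) C (k ∸ 1)))
  -- The witness is the 300 of `conclusion`; unfolding identifies the opaque operations in `main`
  -- with those of the statement.
  theorem1p2 = Proof.ι 300 , Proof.1<300 , Proof.main
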